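{- For all $k\ge 1$, $$J_{12\dots k}(x)=\frac{x}{U_k\left(\frac{1}{2x}\right)}\sum_{j=1}^{k-2}U_j\left(\frac{1}{2x}\right),$$ where $J_{12\dots k}(x)=\sum_{n\ge0}J_{12\dots k}(n)x^n$ and $J_{12\dots k}(n)$ is the number of involutions in $S_n$ that avoid $12\dots k$ and contain $132$ exactly once (an empty sum being $0$).
   Context: $S_n$ is the set of permutations of $\{1,\dots,n\}$. An occurrence of a pattern $\tau\in S_k$ in $\alpha\in S_n$ is a choice of indices $1\le i_1<\dots<i_k\le n$ such that $(\alpha_{i_1},\dots,\alpha_{i_k})$ is order-isomorphic to $\tau$; $\alpha$ avoids $\tau$ if it has no occurrence, and contains $\tau$ exactly once if it has exactly one occurrence. An involution is a permutation equal to its own inverse. $U_r$ denotes the Chebyshev polynomial of the second kind, $U_r(\cos\theta)=\sin((r+1)\theta)/\sin\theta$. The identity is one of rational functions, expanded as power series in $x$. -}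

module Defs where

open import Algebra.Bundles using (CommutativeRing)
open import Algebra.Bundles.Raw using (RawRing)
open import Data.Fin.Base as Fin using (Fin; zero; suc; toℕ)
import Data.Fin.Properties as Fin
open import Data.Integer.Base as ℤ using (ℤ; +_; -[1+_]; _⊖_)
open import Data.List.Base as List using (List; []; _∷_; length; filter; cartesianProductWith)
open import Data.Nat.Base as ℕ using (ℕ; zero; suc; _∸_)
import Data.Nat.Properties as ℕ
open import Data.Product.Base using (_×_; _,_)
open import Data.Rational.Base as ℚ using (ℚ; 0ℚ; 1ℚ; ½)
open import Data.Vec.Base as Vec using (Vec; []; _∷_; lookup)
open import Data.Vec.Relation.Unary.AllPairs using (AllPairs; allPairs?)
open import Data.Vec.Relation.Unary.Unique.Propositional using (Unique)
open import Function.Bundles using (_⇔_; mk⇔; module Equivalence)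
open import Relation.Binary.PropositionalEquality using (_≡_)
open import Relation.Nullary.Decidable using (Dec; ¬?; _×-dec_; _→-dec_; map′)

-- Positions and values are 0-based.  An element of S_n is given by its
-- one-line notation, a word of length n over Fin n with distinct letters.

words : ∀ n k → List (Vec (Fin n) k)
words n zero    = [] ∷ []
words n (suc k) = cartesianProductWith _∷_ (List.allFin n) (words n k)

IsInvolution : ∀ {n} → Vec (Fin n) n → Set
IsInvolution α = Unique α × (∀ i → lookup α (lookup α i) ≡ i)

-- The vector `is` lists the chosen indices i₁ < … < i_k.
IsOccurrence : ∀ {k n} → Vec (Fin k) k → Vec (Fin n) n → Vec (Fin n) k → Set
IsOccurrence τ α is =
  AllPairs Fin._<_ is ×
  (∀ a b → (lookup τ a Fin.< lookup τ b) ⇔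
           (lookup α (lookup is a) Fin.< lookup α (lookup is b)))

isInvolution? : ∀ {n} (α : Vec (Fin n) n) → Dec (IsInvolution α)
isInvolution? α =
  allPairs? (λ i j → ¬? (i Fin.≟ j)) α ×-dec
  Fin.all? (λ i → lookup α (lookup α i) Fin.≟ i)

isOccurrence? : ∀ {k n} (τ : Vec (Fin k) k) (α : Vec (Fin n) n) (is : Vec (Fin n) k) →
                Dec (IsOccurrence τ α is)
isOccurrence? τ α is =
  allPairs? Fin._<?_ is ×-dec
  Fin.all? (λ a → Fin.all? (λ b →
    (lookup τ a Fin.<? lookup τ b) ⇔-dec
    (lookup α (lookup is a) Fin.<? lookup α (lookup is b))))
  where
  _⇔-dec_ : {A B : Set} → Dec A → Dec B → Dec (A ⇔ B)
  A? ⇔-dec B? = map′ (λ (f , g) → mk⇔ f g)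
                     (λ e → Equivalence.to e , Equivalence.from e)
                     ((A? →-dec B?) ×-dec (B? →-dec A?))

occurrences : ∀ {k n} → Vec (Fin k) k → Vec (Fin n) n → ℕ
occurrences {k} {n} τ α = length (filter (isOccurrence? τ α) (words n k))

Avoids ContainsOnce : ∀ {k n} → Vec (Fin k) k → Vec (Fin n) n → Set
Avoids       τ α = occurrences τ α ≡ 0
ContainsOnce τ α = occurrences τ α ≡ 1

pattern132 : Vec (Fin 3) 3
pattern132 = zero ∷ suc (suc zero) ∷ suc zero ∷ []

increasing : ∀ k → Vec (Fin k) k
increasing k = Vec.allFin k

Counted : ∀ {k n} → Vec (Fin k) k → Vec (Fin n) n → Set
Counted τ α = IsInvolution α × Avoids τ α × ContainsOnce pattern132 α

counted? : ∀ {k n} (τ : Vec (Fin k) k) (α : Vec (Fin n) n) → Dec (Counted τ α)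
counted? τ α = isInvolution? α ×-dec
               (occurrences τ α ℕ.≟ 0) ×-dec
               (occurrences pattern132 α ℕ.≟ 1)

J₁₃₂ : ∀ {k} → Vec (Fin k) k → ℕ → ℕ
J₁₃₂ τ n = length (filter (counted? τ) (words n n))

-- U r is the Chebyshev polynomial of the second kind as a function on a ring.

module Chebyshev {c ℓ} (R : RawRing c ℓ) where
  open RawRing R

  U : ℕ → Carrier → Carrier
  U zero          t = 1#
  U (suc zero)    t = t + t
  U (suc (suc r)) t = (t + t) * U (suc r) t + - U r t

-- For z = e^{iθ}, w = e^{-iθ} and t = cos θ this is
-- U_r(cos θ) · 2i sin θ = 2i sin((r+1)θ), the trigonometric definition of U_r.
module _ {c ℓ} (R : CommutativeRing c ℓ) where
  open CommutativeRing R
  open Chebyshev rawRing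
  open import Algebra.Definitions.RawSemiring (RawRing.rawSemiring rawRing) using (_^_)
  open import Relation.Binary.Reasoning.Setoid setoid
  open import Algebra.Properties.AbelianGroup +-abelianGroup using (xyx⁻¹≈y)
  open import Algebra.Properties.Ring ring using (-‿distribʳ-*)

  private
    U-step : ∀ {z w t} → z * w ≈ 1# → t + t ≈ z + w →
             ∀ r → U (suc r) t ≈ w ^ suc r + z * U r t
    U-step {z} {w} {t} zw 2t zero = begin
      t + t             ≈⟨ 2t ⟩
      z + w             ≈⟨ +-comm z w ⟩
      w + z             ≈⟨ +-cong (*-identityʳ w) (*-identityʳ z) ⟨
      w * 1# + z * 1#   ∎
    U-step {z} {w} {t} zw 2t (suc r) = begin
      (t + t) * U (suc r) t + - u
        ≈⟨ +-congʳ (trans (*-congʳ (trans 2t (+-comm z w))) (distribʳ _ w z)) ⟩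
      (w * U (suc r) t + zu′) + - u
        ≈⟨ +-congʳ (+-congʳ (trans (*-congˡ (U-step zw 2t r)) (distribˡ w _ _))) ⟩
      ((w * w ^ suc r + w * (z * u)) + zu′) + - u
        ≈⟨ +-congʳ (+-congʳ (+-congˡ (trans (sym (*-assoc w z u))
             (trans (*-congʳ (trans (*-comm w z) zw)) (*-identityˡ u))))) ⟩
      ((w * w ^ suc r + u) + zu′) + - u
        ≈⟨ +-congʳ (trans (+-congʳ (+-comm _ u)) (+-assoc u _ zu′)) ⟩
      (u + (w * w ^ suc r + zu′)) + - u
        ≈⟨ xyx⁻¹≈y u _ ⟩
      w * w ^ suc r + zu′ ∎
      where
      u   = U r t
      zu′ = z * U (suc r) t

  U-trigonometric : ∀ {z w t} → z * w ≈ 1# → t + t ≈ z + w →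
                    ∀ r → U r t * (z + - w) ≈ z ^ suc r + - (w ^ suc r)
  U-trigonometric {z} {w} {t} zw 2t r = begin
    u * (z + - w)                            ≈⟨ distribˡ u z (- w) ⟩
    u * z + u * - w                          ≈⟨ +-cong (*-comm u z) (trans (sym (-‿distribʳ-* u w)) (-‿cong (*-comm u w))) ⟩
    z * u + - (w * u)                        ≈⟨ +-congʳ (xyx⁻¹≈y (w ^ suc r) (z * u)) ⟨
    ((w ^ suc r + z * u) + - (w ^ suc r)) + - (w * u)
      ≈⟨ +-congʳ (+-congʳ (trans (sym (U-step zw 2t r))
           (trans (U-step (trans (*-comm w z) zw) (trans 2t (+-comm z w)) r) (+-comm _ _)))) ⟩
    ((w * u + z ^ suc r) + - (w ^ suc r)) + - (w * u)
      ≈⟨ +-congʳ (+-assoc (w * u) _ _) ⟩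
    (w * u + (z ^ suc r + - (w ^ suc r))) + - (w * u)
      ≈⟨ xyx⁻¹≈y (w * u) _ ⟩
    z ^ suc r + - (w ^ suc r) ∎
    where u = U r t

-- Elements of the field ℚ((x)), in which rational functions in x are expanded
-- at x = 0; x^- m · a stands for x^(-m) Σ_{n ≥ 0} (a n) xⁿ.
record Laurent : Set where
  constructor x^-_·_
  field
    pole   : ℕ
    coeffs : ℕ → ℚ

open Laurent public

extend : (ℕ → ℚ) → ℤ → ℚ
extend a (+ n)    = a n
extend a -[1+ n ] = 0ℚ

-- the coefficient of xⁱ
coeff : Laurent → ℤ → ℚ
coeff f i = extend (coeffs f) (i ℤ.+ + pole f)

-- Equality of series is equality of all coefficients; the representing
-- pole is not unique.
infix 4 _≈ˡ_
_≈ˡ_ : Laurent → Laurent → Set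
f ≈ˡ g = ∀ i → coeff f i ≡ coeff g i

-- x^(-m) a + x^(-n) b = x^(-(m+n)) (xⁿ a + xᵐ b)
_+ˡ_ : Laurent → Laurent → Laurent
(x^- m · a) +ˡ (x^- n · b) = x^- (m ℕ.+ n) · λ i → extend a (i ⊖ n) ℚ.+ extend b (i ⊖ m)

_*ˡ_ : Laurent → Laurent → Laurent
(x^- m · a) *ˡ (x^- n · b) = x^- (m ℕ.+ n) · λ i → ∑ {suc i} (λ j → a (toℕ j) ℚ.* b (i ∸ toℕ j))
  where open import Algebra.Definitions.RawMonoid ℚ.+-0-rawMonoid renaming (sum to ∑)

-ˡ_ : Laurent → Laurent
-ˡ (x^- m · a) = x^- m · λ i → ℚ.- a i

-- the coefficient sequence of c xᵐ
monomial : ℚ → ℕ → ℕ → ℚ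
monomial c zero    zero    = c
monomial c zero    (suc n) = 0ℚ
monomial c (suc m) zero    = 0ℚ
monomial c (suc m) (suc n) = monomial c m n

laurent : RawRing _ _
laurent = record
  { Carrier = Laurent
  ; _≈_     = _≈ˡ_
  ; _+_     = _+ˡ_
  ; _*_     = _*ˡ_
  ; -_      = -ˡ_
  ; 0#      = x^- 0 · λ _ → 0ℚ
  ; 1#      = x^- 0 · monomial 1ℚ 0
  }

x 1/2x : Laurent
x    = x^- 0 · monomial 1ℚ 1
1/2x = x^- 1 · monomial ½ 0

generatingFunction : (ℕ → ℕ) → Laurent
generatingFunction a = x^- 0 · λ n → + a n ℚ./ 1

open RawRing laurent public using (_≈_; _*_; 1#)
open Chebyshev laurent public using (U)
open import Algebra.Definitions.RawMonoid (RawRing.+-rawMonoid laurent) public using (sum)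
open import Algebra.Definitions _≈_ public using (Invertible)

{-# OPTIONS --safe #-}

-- Inverting an involution maps its only occurrence (i, j, k) of 132 to itself,
-- so i is a fixed point and j, k are exchanged.  Split the involution at its
-- largest value n, which stands at position j.  If n is not in the occurrence,
-- the involution is M n or L n M L⁻¹ j, where L is any 132-avoiding permutation
-- placed above everything to the right of n and M is a smaller involution
-- with one occurrence; otherwise it is L c n L⁻¹ j with c = j − 1 fixed.  It
-- avoids 12…k iff L avoids 12…(k−1) and M avoids 12…k (12…(k−1) for M n).
-- Together with L = L₁ n L₂ for 132-avoiding permutations this gives
--   Cₖ₊₁ = 1 + x² Cₖ Cₖ₊₁,  Jₖ₊₁ = x Jₖ + x² Cₖ Jₖ₊₁ + x³ Cₖ  (k ≥ 2),
-- where Cₖ is taken at x².  With u_k = U_k(1/2x) the first equation yields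
-- x Cₖ₊₁ uₖ₊₁ = uₖ, and then the second one Jₖ₊₁ uₖ₊₁ = Jₖ uₖ + x uₖ₋₁.

module Submission where

import Defs
open import Algebra.Bundles using (CommutativeRing)
import Algebra.Solver.Ring.NaturalCoefficients.Default
open import Algebra.Structures using (IsCommutativeRing)
open import Data.Empty using (⊥; ⊥-elim)
open import Data.Fin.Base as Fin using (Fin; zero; suc; toℕ; fromℕ<)
import Data.Fin.Properties as Fin
open import Data.Integer.Base as ℤ using (-[1+_]; _⊖_) renaming (+_ to pos)
import Data.Integer.Properties as ℤ
open import Data.List.Base as List using (List; []; _∷_; _++_; map; filter; length; cartesianProductWith)
open import Data.List.Membership.Propositional using (_∈_)
open import Data.List.Membership.Propositional.Properties
  using (∈-map⁺; ∈-map⁻; ∈-++⁺ˡ; ∈-++⁺ʳ; ∈-++⁻; ∈-filter⁺; ∈-filter⁻; ∈-cartesianProductWith⁺; ∈-cartesianProductWith⁻; ∈-allFin; ∈-lookup)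
open import Data.List.Properties using (filter-none; filter-accept; filter-reject)
open import Data.List.Relation.Unary.All as All using (All)
open import Data.List.Relation.Unary.AllPairs using ([]; _∷_)
open import Data.List.Relation.Unary.Any using (here; there; index)
open import Data.List.Relation.Unary.Any.Properties using (lookup-index)
import Data.List.Relation.Unary.Unique.Propositional as List
import Data.List.Relation.Unary.Unique.Propositional.Properties as Unique
open import Data.Nat.Base as ℕ using (ℕ; zero; suc; _∸_; _≤_; _<_; z≤n; s≤s; s≤s⁻¹)
import Data.Nat.Coprimality as Coprime
import Data.Nat.Properties as ℕ
open import Data.Nat.Tactic.RingSolver using () renaming (solve-∀ to ℕ-solve-∀)
open import Data.Product.Base using (Σ-syntax; ∃-syntax; _×_; proj₁; proj₂; _,_)
open import Data.Rational.Base as ℚ using (ℚ; 0ℚ; 1ℚ; ½)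
import Data.Rational.Properties as ℚ
open import Data.Sum.Base as Sum using (_⊎_; inj₁; inj₂)
open import Data.Vec.Base as Vec using (Vec; []; _∷_; lookup; tabulate)
open import Data.Vec.Properties using (∷-injective; lookup∘tabulate; tabulate∘lookup; tabulate-cong; lookup-allFin)
import Data.Vec.Relation.Unary.All as VecAll
import Data.Vec.Relation.Unary.All.Properties as VecAll
open import Data.Vec.Relation.Unary.AllPairs as VecPairs using (AllPairs; []; _∷_)
import Data.Vec.Relation.Unary.Unique.Propositional as Vec
import Data.Vec.Relation.Unary.Unique.Propositional.Properties as VecUnique
open import Function.Base using (_∘_; case_of_)
open import Function.Bundles using (mk⇔; module Equivalence)
open import Level using (0ℓ)
open import Relation.Binary.Bundles using (Setoid)
open import Relation.Binary.Definitions using (tri<; tri≈; tri>)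
import Relation.Binary.PropositionalEquality as ≡
import Relation.Binary.Reasoning.Setoid
open import Relation.Binary.Structures using (IsEquivalence)
open import Relation.Nullary using (¬_; yes; no; contradiction)
open import Relation.Nullary.Decidable using (dec⇒maybe)
open import Relation.Unary using (Decidable)
open import Tactic.RingSolver using (solve-∀)
open import Tactic.RingSolver.Core.AlmostCommutativeRing using (AlmostCommutativeRing; fromCommutativeRing)

-- The equations for C are those of the generating functions at x² of the
-- trees below, those for J of the involutions with one occurrence of 132.

-- A list of all codes would be infinite, so the equations first relate lists cut off at depths d +
-- 1 and d. Every series on a right-hand side carries a factor x, so each level settles one more
-- coefficient and the limits satisfy the equations exactly. The quotient in the formula makes sense
-- because x Cₖ₊₁ uₖ₊₁ = uₖ exhibits the inverse of uₖ as the product of x C₁, ..., x Cₖ. Blocks of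
-- a permutation keep their absolute positions and values: a block is a set of points in a window,
-- so nothing is standardised, and inversion is reflection in the diagonal. If every value left of n
-- exceeds every value right of it, counting values forces each side into an exact window of values;
-- this is how L, M and L⁻¹ are located. Conversely, a 132 or an increasing sequence that starts in
-- `L n` stays there, because all its later points are higher, and one that starts in the mirror
-- image stays there, because they are further right. That is why the conditions on L and M
-- separate. Permutations and codes are matched by a relation that is injective on both sides.

module GeneratingFunctions {c ℓ} (K : CommutativeRing c ℓ) where

  open CommutativeRing K
  open Defs.Chebyshev rawRing using (U)
  open import Algebra.Properties.Monoid.Sum +-monoid using (sum; sum-cong-≋; sum-init-last)
  open import Relation.Binary.Reasoning.Setoid setoid
  open Algebra.Solver.Ring.NaturalCoefficients.Default commutativeSemiring using (solve; _:=_; _:+_; _:*_)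
  open import Algebra.Definitions _≈_ using (Invertible)

  -- Here `y` is 1/x and `t` is 1/(2x), so the factor `t + t` in the recursion of `U` becomes 1/x.
  -- The term x³Cₖ starts only with `J 3`: the occurrence (c, n, j) already contains the increasing
  -- pair c n.
  module Solution (x y t : Carrier) (xy≈1 : x * y ≈ 1#) (t+t≈y : t + t ≈ y)
           (C J : ℕ → Carrier)
           (C-zero : C 0 ≈ 0#)
           (C-suc  : ∀ k → C (suc k) ≈ 1# + x * x * (C k * C (suc k)))
           (J-zero : J 0 ≈ 0#)
           (J-one  : J 1 ≈ x * J 0 + x * x * (C 0 * J 1))
           (J-two  : J 2 ≈ x * J 1 + x * x * (C 1 * J 2))
           (J-suc  : ∀ k → J (3 ℕ.+ k) ≈ x * J (2 ℕ.+ k) + x * x * (C (2 ℕ.+ k) * J (3 ℕ.+ k)) + x * x * x * C (2 ℕ.+ k))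
    where

    private
      u : ℕ → Carrier
      u k = U k t

      u-suc : ∀ k → u (2 ℕ.+ k) + u k ≈ y * u (suc k)
      u-suc k = begin
        (t + t) * u (suc k) + - u k + u k      ≈⟨ +-assoc _ _ _ ⟩
        (t + t) * u (suc k) + (- u k + u k)    ≈⟨ +-congˡ (-‿inverseˡ _) ⟩
        (t + t) * u (suc k) + 0#               ≈⟨ +-identityʳ _ ⟩
        (t + t) * u (suc k)                    ≈⟨ *-congʳ t+t≈y ⟩
        y * u (suc k)                          ∎

      cancel : ∀ {a b} c → a + c ≈ b + c → a ≈ b
      cancel {a} {b} c p = begin
        a              ≈⟨ +-identityʳ a ⟨
        a + 0#         ≈⟨ +-congˡ (-‿inverseʳ c) ⟨
        a + (c + - c)  ≈⟨ +-assoc _ _ _ ⟨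
        a + c + - c    ≈⟨ +-congʳ p ⟩
        b + c + - c    ≈⟨ +-assoc _ _ _ ⟩
        b + (c + - c)  ≈⟨ +-congˡ (-‿inverseʳ c) ⟩
        b + 0#         ≈⟨ +-identityʳ b ⟩
        b              ∎

      -- A ≈ B + x² Cₖ A solves to A ≈ Cₖ₊₁ B.
      solve-recursion : ∀ k {A B} → A ≈ B + x * x * (C k * A) → A ≈ C (suc k) * B
      solve-recursion k {A} {B} p = cancel (x * x * (C k * C (suc k)) * A) (begin
        A + x * x * (C k * C (suc k)) * A             ≈⟨ lemma₁ _ _ ⟩
        (1# + x * x * (C k * C (suc k))) * A          ≈⟨ *-congʳ (C-suc k) ⟨
        C (suc k) * A                                 ≈⟨ *-congˡ p ⟩
        C (suc k) * (B + x * x * (C k * A))           ≈⟨ solve 5 (λ a b c d x → c :* (b :+ x :* x :* (d :* a)) :=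
                                                            c :* b :+ x :* x :* (d :* c) :* a) refl A B (C (suc k)) (C k) x ⟩
        C (suc k) * B + x * x * (C k * C (suc k)) * A ∎)
        where
        lemma₁ : ∀ a b → a + b * a ≈ (1# + b) * a
        lemma₁ a b = sym (trans (distribʳ a 1# b) (+-congʳ (*-identityˡ a)))

    -- Multiplied by x, the Chebyshev recursion reads uₖ₊₁ = x uₖ₊₂ + x uₖ. By induction the last
    -- term is x² Cₖ₊₁ uₖ₊₁, which puts the equation into the form treated by `solve-recursion`.
    x*C*u : ∀ k → x * C (suc k) * u (suc k) ≈ u k
    x*C*u zero = begin
      x * C 1 * (t + t)  ≈⟨ *-cong (*-congˡ C₁≈1) t+t≈y ⟩
      x * 1# * y         ≈⟨ *-congʳ (*-identityʳ x) ⟩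
      x * y              ≈⟨ xy≈1 ⟩
      1#                 ∎
      where
      C₁≈1 : C 1 ≈ 1#
      C₁≈1 = begin
        C 1                             ≈⟨ C-suc 0 ⟩
        1# + x * x * (C 0 * C 1)        ≈⟨ +-congˡ (*-congˡ (trans (*-congʳ C-zero) (zeroˡ _))) ⟩
        1# + x * x * 0#                 ≈⟨ +-congˡ (zeroʳ _) ⟩
        1# + 0#                         ≈⟨ +-identityʳ 1# ⟩
        1#                              ∎
    x*C*u (suc k) = begin
      x * C (2 ℕ.+ k) * u (2 ℕ.+ k)     ≈⟨ solve 3 (λ a b c → a :* b :* c := b :* (a :* c)) refl x _ _ ⟩
      C (2 ℕ.+ k) * (x * u (2 ℕ.+ k))   ≈⟨ solve-recursion (suc k) (begin
        u (suc k)                                                 ≈⟨ *-identityˡ _ ⟨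
        1# * u (suc k)                                            ≈⟨ *-congʳ xy≈1 ⟨
        x * y * u (suc k)                                         ≈⟨ *-assoc x y _ ⟩
        x * (y * u (suc k))                                       ≈⟨ *-congˡ (u-suc k) ⟨
        x * (u (2 ℕ.+ k) + u k)                                   ≈⟨ distribˡ x _ _ ⟩
        x * u (2 ℕ.+ k) + x * u k                                 ≈⟨ +-congˡ (*-congˡ (x*C*u k)) ⟨
        x * u (2 ℕ.+ k) + x * (x * C (suc k) * u (suc k))         ≈⟨ +-congˡ (solve 3 (λ x c u → x :* (x :* c :* u) := x :* x :* (c :* u)) refl x _ _) ⟩
        x * u (2 ℕ.+ k) + x * x * (C (suc k) * u (suc k))         ∎) ⟨
      u (suc k)                         ∎

    -- The factor `x * C (suc k)` stands for the quotient of `u k` by `u (suc k)`, so the product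
    -- telescopes and the inverse is obtained without division in the ring.
    u⁻¹ : ℕ → Carrier
    u⁻¹ zero    = 1#
    u⁻¹ (suc k) = x * C (suc k) * u⁻¹ k

    u⁻¹*u : ∀ k → u⁻¹ k * u k ≈ 1#
    u⁻¹*u zero    = *-identityˡ 1#
    u⁻¹*u (suc k) = begin
      x * C (suc k) * u⁻¹ k * u (suc k)     ≈⟨ solve 3 (λ a b c → a :* b :* c := a :* c :* b) refl (x * C (suc k)) _ _ ⟩
      x * C (suc k) * u (suc k) * u⁻¹ k     ≈⟨ *-congʳ (x*C*u k) ⟩
      u k * u⁻¹ k                           ≈⟨ *-comm _ _ ⟩
      u⁻¹ k * u k                           ≈⟨ u⁻¹*u k ⟩
      1#                                    ∎

    u-invertible : ∀ k → Invertible 1# _*_ (u k)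
    u-invertible k = u⁻¹ k , u⁻¹*u k , trans (*-comm _ _) (u⁻¹*u k)

    -- The inhomogeneous term `b` is 0 for the first two steps and x³Cₖ afterwards. Solving for Jₖ₊₁
    -- gives Cₖ₊₁ (x Jₖ + b), and the factor x Cₖ₊₁ uₖ₊₁ at Jₖ collapses to uₖ.
    J*u-suc : ∀ k {b} → J (suc k) ≈ x * J k + x * x * (C k * J (suc k)) + b →
              J (suc k) * u (suc k) ≈ J k * u k + b * (C (suc k) * u (suc k))
    J*u-suc k {b} p = begin
      J (suc k) * u (suc k)                     ≈⟨ *-congʳ (solve-recursion k (trans p (begin
        x * J k + x * x * (C k * J (suc k)) + b   ≈⟨ +-assoc _ _ _ ⟩
        x * J k + (x * x * (C k * J (suc k)) + b) ≈⟨ +-congˡ (+-comm _ _) ⟩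
        x * J k + (b + x * x * (C k * J (suc k))) ≈⟨ +-assoc _ _ _ ⟨
        x * J k + b + x * x * (C k * J (suc k))   ∎))) ⟩
      C (suc k) * (x * J k + b) * u (suc k)     ≈⟨ solve 5 (λ c x j b u → c :* (x :* j :+ b) :* u := j :* (x :* c :* u) :+ b :* (c :* u))
                                                     refl (C (suc k)) x (J k) b (u (suc k)) ⟩
      J k * (x * C (suc k) * u (suc k)) + b * (C (suc k) * u (suc k)) ≈⟨ +-congʳ (*-congˡ (x*C*u k)) ⟩
      J k * u k + b * (C (suc k) * u (suc k))   ∎

    J*u-two : J 2 * u 2 ≈ 0#
    J*u-two = begin
      J 2 * u 2                           ≈⟨ step 1 J-two ⟩
      J 1 * u 1                           ≈⟨ step 0 J-one ⟩
      J 0 * u 0                           ≈⟨ *-congʳ J-zero ⟩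
      0# * u 0                            ≈⟨ zeroˡ _ ⟩
      0#                                  ∎
      where
      step : ∀ k → J (suc k) ≈ x * J k + x * x * (C k * J (suc k)) → J (suc k) * u (suc k) ≈ J k * u k
      step k p = trans (J*u-suc k (trans p (sym (+-identityʳ _)))) (trans (+-congˡ (zeroˡ _)) (+-identityʳ _))

    J*u : ∀ k → J (2 ℕ.+ k) * u (2 ℕ.+ k) ≈ x * sum {k} (λ j → u (suc (toℕ j)))
    J*u zero    = trans J*u-two (sym (zeroʳ x))
    J*u (suc k) = begin
      J (3 ℕ.+ k) * u (3 ℕ.+ k)
        ≈⟨ J*u-suc (2 ℕ.+ k) (J-suc k) ⟩
      J (2 ℕ.+ k) * u (2 ℕ.+ k) + x * x * x * C (2 ℕ.+ k) * (C (3 ℕ.+ k) * u (3 ℕ.+ k))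
        ≈⟨ +-cong (J*u k) (solve 4 (λ x c d u → x :* x :* x :* c :* (d :* u) := x :* (x :* c :* (x :* d :* u)))
             refl x (C (2 ℕ.+ k)) (C (3 ℕ.+ k)) (u (3 ℕ.+ k))) ⟩
      x * sum {k} (λ j → u (suc (toℕ j))) + x * (x * C (2 ℕ.+ k) * (x * C (3 ℕ.+ k) * u (3 ℕ.+ k)))
        -- Two collapses in a row, from uₖ₊₃ to uₖ₊₂ to uₖ₊₁, use up two of the three factors x and
        -- leave the next summand.
        ≈⟨ +-congˡ (*-congˡ (trans (*-congˡ (x*C*u (2 ℕ.+ k))) (x*C*u (suc k)))) ⟩
      x * sum {k} (λ j → u (suc (toℕ j))) + x * u (suc k)
        ≈⟨ distribˡ x _ _ ⟨
      x * (sum {k} (λ j → u (suc (toℕ j))) + u (suc k))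
        ≈⟨ *-congˡ sum-suc ⟨
      x * sum {suc k} (λ j → u (suc (toℕ j))) ∎
      where
      sum-suc : sum {suc k} (λ j → u (suc (toℕ j))) ≈ sum {k} (λ j → u (suc (toℕ j))) + u (suc k)
      sum-suc = trans (sum-init-last {k} (λ j → u (suc (toℕ j))))
        (+-cong (sum-cong-≋ {k} (λ j → reflexive (≡.cong (λ i → u (suc i)) (Fin.toℕ-inject₁ j))))
                (reflexive (≡.cong (λ i → u (suc i)) (Fin.toℕ-fromℕ k))))

    J-formula : ∀ k → 1 ≤ k → J k ≈ x * u⁻¹ k * sum {k ∸ 2} (λ j → u (suc (toℕ j)))
    J-formula k 1≤k = begin
      J k                              ≈⟨ *-identityʳ _ ⟨
      J k * 1#                         ≈⟨ *-congˡ (u⁻¹*u k) ⟨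
      J k * (u⁻¹ k * u k)              ≈⟨ solve 3 (λ a b c → a :* (b :* c) := b :* (a :* c)) refl (J k) (u⁻¹ k) (u k) ⟩
      u⁻¹ k * (J k * u k)              ≈⟨ *-congˡ (numerator k 1≤k) ⟩
      u⁻¹ k * (x * s)                  ≈⟨ solve 3 (λ a b c → a :* (b :* c) := b :* a :* c) refl (u⁻¹ k) x s ⟩
      x * u⁻¹ k * s                    ∎
      where
      s = sum {k ∸ 2} (λ j → u (suc (toℕ j)))
      numerator : ∀ k → 1 ≤ k → J k * u k ≈ x * sum {k ∸ 2} (λ j → u (suc (toℕ j)))
      -- For k = 1 the truncated difference `1 ∸ 2` is 0, so the sum is empty and both sides vanish.
      numerator 1             _ = trans (J*u-suc 0 (trans J-one (sym (+-identityʳ _))))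
        (trans (+-cong (trans (*-congʳ J-zero) (zeroˡ _)) (zeroˡ _)) (trans (+-identityʳ 0#) (sym (zeroʳ x))))
      numerator (suc (suc k)) _ = J*u k

open import Defs
open ≡ using (_≡_; _≢_; _≗_; refl; cong; cong₂; subst; subst₂)

-- Formal power series over ℚ

Series : Set
Series = ℕ → ℚ

infixl 6 _⊕_
infixl 7 _⊛_ _⊙_
infix 8 X^_

0# : Series
0# _ = 0ℚ

X^_ : ℕ → Series
X^ n = monomial 1ℚ n

_⊙_ : ℚ → Series → Series
(c ⊙ a) i = c ℚ.* a i

-- Opaque, because unification gets lost in unfolded products.
opaque
  _⊕_ : Series → Series → Series
  (a ⊕ b) i = a i ℚ.+ b i

  ⊝_ : Series → Series
  (⊝ a) i = ℚ.- a i

  _⊛_ : Series → Series → Series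
  a ⊛ b = coeffs ((x^- 0 · a) *ˡ (x^- 0 · b))

ℚ-ring : AlmostCommutativeRing 0ℓ 0ℓ
ℚ-ring = fromCommutativeRing ℚ.+-*-commutativeRing (λ q → dec⇒maybe (0ℚ ℚ.≟ q))

opaque
  unfolding _⊕_ ⊝_ _⊛_

  -- The inductions on the degree rest on the unfolding of `(a ⊛ b) (suc i)` to
  -- `a 0 ℚ.* b (suc i) ℚ.+ ((a ∘ suc) ⊛ b) i`: the first factor is shifted, the second stays.
  ⊛-cong-≗ : ∀ {a a′ b b′} → a ≗ a′ → b ≗ b′ → a ⊛ b ≗ a′ ⊛ b′
  ⊛-cong-≗ p q zero    = cong (ℚ._+ 0ℚ) (cong₂ ℚ._*_ (p 0) (q 0))
  ⊛-cong-≗ p q (suc i) = cong₂ ℚ._+_ (cong₂ ℚ._*_ (p 0) (q (suc i))) (⊛-cong-≗ (p ∘ suc) q i)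

  ⊛-distribʳ : ∀ c a b → (a ⊕ b) ⊛ c ≗ a ⊛ c ⊕ b ⊛ c
  ⊛-distribʳ c a b zero    = lemma (a 0) (b 0) (c 0)
    where
    lemma : ∀ u v w → (u ℚ.+ v) ℚ.* w ℚ.+ 0ℚ ≡ (u ℚ.* w ℚ.+ 0ℚ) ℚ.+ (v ℚ.* w ℚ.+ 0ℚ)
    lemma = solve-∀ ℚ-ring
  ⊛-distribʳ c a b (suc i) = ≡.trans
    (cong ((a 0 ℚ.+ b 0) ℚ.* c (suc i) ℚ.+_) (⊛-distribʳ c (a ∘ suc) (b ∘ suc) i))
    (lemma (a 0) (b 0) (c (suc i)) _ _)
    where
    lemma : ∀ u v w p q → (u ℚ.+ v) ℚ.* w ℚ.+ (p ℚ.+ q) ≡ (u ℚ.* w ℚ.+ p) ℚ.+ (v ℚ.* w ℚ.+ q)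
    lemma = solve-∀ ℚ-ring

  ⊙-⊛ : ∀ c a b → (c ⊙ a) ⊛ b ≗ c ⊙ (a ⊛ b)
  ⊙-⊛ c a b zero    = lemma c (a 0) (b 0)
    where
    lemma : ∀ u v w → u ℚ.* v ℚ.* w ℚ.+ 0ℚ ≡ u ℚ.* (v ℚ.* w ℚ.+ 0ℚ)
    lemma = solve-∀ ℚ-ring
  ⊙-⊛ c a b (suc i) = ≡.trans
    (cong (c ℚ.* a 0 ℚ.* b (suc i) ℚ.+_) (⊙-⊛ c (a ∘ suc) b i))
    (lemma c (a 0) (b (suc i)) _)
    where
    lemma : ∀ u v w p → u ℚ.* v ℚ.* w ℚ.+ u ℚ.* p ≡ u ℚ.* (v ℚ.* w ℚ.+ p)
    lemma = solve-∀ ℚ-ring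

  -- The tail of `a ⊛ b` is `(a 0 ⊙ (b ∘ suc)) ⊕ ((a ∘ suc) ⊛ b)`; distributivity and compatibility
  -- with scalars then reduce the claim to the tail of `a`.
  ⊛-assoc : ∀ a b c → (a ⊛ b) ⊛ c ≗ a ⊛ (b ⊛ c)
  ⊛-assoc a b c zero    = lemma (a 0) (b 0) (c 0)
    where
    lemma : ∀ u v w → (u ℚ.* v ℚ.+ 0ℚ) ℚ.* w ℚ.+ 0ℚ ≡ u ℚ.* (v ℚ.* w ℚ.+ 0ℚ) ℚ.+ 0ℚ
    lemma = solve-∀ ℚ-ring
  ⊛-assoc a b c (suc i) = begin
    (a 0 ℚ.* b 0 ℚ.+ 0ℚ) ℚ.* c (suc i) ℚ.+ (((a 0 ⊙ (b ∘ suc)) ⊕ ((a ∘ suc) ⊛ b)) ⊛ c) i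
      ≡⟨ cong ((a 0 ℚ.* b 0 ℚ.+ 0ℚ) ℚ.* c (suc i) ℚ.+_) (⊛-distribʳ c (a 0 ⊙ (b ∘ suc)) ((a ∘ suc) ⊛ b) i) ⟩
    (a 0 ℚ.* b 0 ℚ.+ 0ℚ) ℚ.* c (suc i) ℚ.+ (((a 0 ⊙ (b ∘ suc)) ⊛ c) i ℚ.+ (((a ∘ suc) ⊛ b) ⊛ c) i)
      ≡⟨ cong ((a 0 ℚ.* b 0 ℚ.+ 0ℚ) ℚ.* c (suc i) ℚ.+_) (cong₂ ℚ._+_ (⊙-⊛ (a 0) (b ∘ suc) c i) (⊛-assoc (a ∘ suc) b c i)) ⟩
    (a 0 ℚ.* b 0 ℚ.+ 0ℚ) ℚ.* c (suc i) ℚ.+ (a 0 ℚ.* ((b ∘ suc) ⊛ c) i ℚ.+ ((a ∘ suc) ⊛ (b ⊛ c)) i)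
      ≡⟨ lemma (a 0) (b 0) (c (suc i)) _ _ ⟩
    a 0 ℚ.* (b 0 ℚ.* c (suc i) ℚ.+ ((b ∘ suc) ⊛ c) i) ℚ.+ ((a ∘ suc) ⊛ (b ⊛ c)) i ∎
    where
    open ≡.≡-Reasoning
    lemma : ∀ u v w p q → (u ℚ.* v ℚ.+ 0ℚ) ℚ.* w ℚ.+ (u ℚ.* p ℚ.+ q) ≡ u ℚ.* (v ℚ.* w ℚ.+ p) ℚ.+ q
    lemma = solve-∀ ℚ-ring

  -- The mirror image of the defining recursion, shifting the second factor; commutativity follows
  -- by playing the two against each other.
  ⊛-suc : ∀ a b i → (a ⊛ b) (suc i) ≡ (a ⊛ (b ∘ suc)) i ℚ.+ a (suc i) ℚ.* b 0
  ⊛-suc a b zero    = lemma (a 0) (b 1) (a 1) (b 0)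
    where
    lemma : ∀ u v w p → u ℚ.* v ℚ.+ (w ℚ.* p ℚ.+ 0ℚ) ≡ (u ℚ.* v ℚ.+ 0ℚ) ℚ.+ w ℚ.* p
    lemma = solve-∀ ℚ-ring
  ⊛-suc a b (suc i) = ≡.trans
    (cong (a 0 ℚ.* b (suc (suc i)) ℚ.+_) (⊛-suc (a ∘ suc) b i))
    (≡.sym (ℚ.+-assoc (a 0 ℚ.* b (suc (suc i))) _ _))

  ⊛-comm : ∀ a b → a ⊛ b ≗ b ⊛ a
  ⊛-comm a b zero    = cong (ℚ._+ 0ℚ) (ℚ.*-comm (a 0) (b 0))
  ⊛-comm a b (suc i) = begin
    a 0 ℚ.* b (suc i) ℚ.+ ((a ∘ suc) ⊛ b) i ≡⟨ cong₂ ℚ._+_ (ℚ.*-comm (a 0) _) (⊛-comm (a ∘ suc) b i) ⟩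
    b (suc i) ℚ.* a 0 ℚ.+ (b ⊛ (a ∘ suc)) i ≡⟨ ℚ.+-comm (b (suc i) ℚ.* a 0) _ ⟩
    (b ⊛ (a ∘ suc)) i ℚ.+ b (suc i) ℚ.* a 0 ≡⟨ ⊛-suc b a i ⟨
    (b ⊛ a) (suc i) ∎
    where open ≡.≡-Reasoning

  ⊛-zeroˡ : ∀ a → 0# ⊛ a ≗ 0#
  ⊛-zeroˡ a zero    = cong (ℚ._+ 0ℚ) (ℚ.*-zeroˡ (a 0))
  ⊛-zeroˡ a (suc i) = cong₂ ℚ._+_ (ℚ.*-zeroˡ (a (suc i))) (⊛-zeroˡ a i)

  ⊛-identityˡ-≗ : ∀ a → (X^ 0) ⊛ a ≗ a
  ⊛-identityˡ-≗ a zero    = ≡.trans (ℚ.+-identityʳ _) (ℚ.*-identityˡ (a 0))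
  ⊛-identityˡ-≗ a (suc i) = ≡.trans (cong₂ ℚ._+_ (ℚ.*-identityˡ (a (suc i))) (⊛-zeroˡ a i)) (ℚ.+-identityʳ _)

infix 4 _≋_
record _≋_ (a b : Series) : Set where
  constructor pointwise
  field at : a ≗ b

open _≋_

≋-isEquivalence : IsEquivalence _≋_
≋-isEquivalence = record
  { refl  = pointwise λ _ → refl
  ; sym   = λ p → pointwise λ i → ≡.sym (at p i)
  ; trans = λ p q → pointwise λ i → ≡.trans (at p i) (at q i)
  }

opaque
  unfolding _⊕_ ⊝_ _⊛_

  series-isCommutativeRing : IsCommutativeRing _≋_ _⊕_ _⊛_ ⊝_ 0# (X^ 0)
  series-isCommutativeRing = record
    { isRing = record
      { +-isAbelianGroup = record
        { isGroup = record
          { isMonoid = record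
            { isSemigroup = record
              { isMagma = record
                { isEquivalence = ≋-isEquivalence
                ; ∙-cong = λ p q → pointwise λ i → cong₂ ℚ._+_ (at p i) (at q i) }
              ; assoc = λ a b c → pointwise λ i → ℚ.+-assoc (a i) (b i) (c i) }
            ; identity = (λ a → pointwise λ i → ℚ.+-identityˡ (a i)) , λ a → pointwise λ i → ℚ.+-identityʳ (a i) }
          ; inverse = (λ a → pointwise λ i → ℚ.+-inverseˡ (a i)) , λ a → pointwise λ i → ℚ.+-inverseʳ (a i)
          ; ⁻¹-cong = λ p → pointwise λ i → cong ℚ.-_ (at p i) }
        ; comm = λ a b → pointwise λ i → ℚ.+-comm (a i) (b i) }
      ; *-cong = λ p q → pointwise (⊛-cong-≗ (at p) (at q))
      ; *-assoc = λ a b c → pointwise (⊛-assoc a b c)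
      ; *-identity = (λ a → pointwise (⊛-identityˡ-≗ a))
                   , λ a → pointwise λ i → ≡.trans (⊛-comm a (X^ 0) i) (⊛-identityˡ-≗ a i)
      ; distrib = (λ c a b → pointwise λ i → ≡.trans (⊛-comm c (a ⊕ b) i) (≡.trans (⊛-distribʳ c a b i)
                    (cong₂ ℚ._+_ (⊛-comm a c i) (⊛-comm b c i))))
                , λ c a b → pointwise (⊛-distribʳ c a b) }
    ; *-comm = λ a b → pointwise (⊛-comm a b) }

seriesRing : CommutativeRing 0ℓ 0ℓ
seriesRing = record { isCommutativeRing = series-isCommutativeRing }

private
  module S = CommutativeRing seriesRing

open CommutativeRing seriesRing using () renaming
  ( setoid to seriesSetoid; refl to ≋-refl; sym to ≋-sym; trans to ≋-trans
  ; +-cong to ⊕-cong; +-congˡ to ⊕-congˡ; +-congʳ to ⊕-congʳ; -‿cong to ⊝-cong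
  ; *-cong to ⊛-cong; *-congˡ to ⊛-congˡ; *-congʳ to ⊛-congʳ; *-identityˡ to ⊛-identityˡ )
import Relation.Binary.Reasoning.Setoid seriesSetoid as ≋-Reasoning

opaque
  unfolding _⊛_

  X^1+-⊛ : ∀ n a i → ((X^ (suc n)) ⊛ a) (suc i) ≡ ((X^ n) ⊛ a) i
  X^1+-⊛ n a i = ≡.trans (cong₂ ℚ._+_ (ℚ.*-zeroˡ (a (suc i))) (⊛-cong-≗ {(X^ suc n) ∘ suc} {X^ n} {a} {a} (λ _ → refl) (λ _ → refl) i))
                         (ℚ.+-identityˡ _)

  X^-+ : ∀ m n → X^ (m ℕ.+ n) ≋ X^ m ⊛ X^ n
  X^-+ m n = pointwise (lemma m n)
    where
    lemma : ∀ m n → X^ (m ℕ.+ n) ≗ X^ m ⊛ X^ n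
    lemma zero    n i       = ≡.sym (⊛-identityˡ-≗ (X^ n) i)
    lemma (suc m) n zero    = ≡.sym (≡.trans (ℚ.+-identityʳ _) (ℚ.*-zeroˡ ((X^ n) 0)))
    lemma (suc m) n (suc i) = ≡.trans (lemma m n i) (≡.sym (X^1+-⊛ m (X^ n) i))

  -- Index shifts in the definition of Laurent series become products with powers of x, so that the
  -- ring laws of power series apply to them.
  extend-⊖ : ∀ n a i → extend a (i ⊖ n) ≡ ((X^ n) ⊛ a) i
  extend-⊖ zero    a i       = ≡.sym (⊛-identityˡ-≗ a i)
  extend-⊖ (suc n) a zero    = ≡.sym (≡.trans (ℚ.+-identityʳ _) (ℚ.*-zeroˡ (a 0)))
  extend-⊖ (suc n) a (suc i) = ≡.trans (cong (extend a) (ℤ.[1+m]⊖[1+n]≡m⊖n i n))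
                                 (≡.trans (extend-⊖ n a i) (≡.sym (X^1+-⊛ n a i)))

-- The field ℚ((x)) as a localisation of the ring of power series

coeff-⊖ : ∀ f i n → coeff f (i ⊖ (pole f ℕ.+ n)) ≡ ((X^ n) ⊛ coeffs f) i
coeff-⊖ f i n = ≡.trans (cong (extend (coeffs f)) lemma) (extend-⊖ n (coeffs f) i)
  where
  lemma : (i ⊖ (pole f ℕ.+ n)) ℤ.+ pos (pole f) ≡ i ⊖ n
  lemma = ≡.trans (ℤ.+-comm (i ⊖ (pole f ℕ.+ n)) (pos (pole f)))
    (≡.trans (ℤ.distribʳ-⊖-+-pos (pole f) i (pole f ℕ.+ n)) (ℤ.+-cancelˡ-⊖ (pole f) i n))

-- Clearing denominators: with m and n the two poles, the coefficients are compared at i - (m + n),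
-- which is degree i after multiplication by the common denominator.
≈ˡ⇒≋ : ∀ f g → f ≈ˡ g → (X^ pole g) ⊛ coeffs f ≋ (X^ pole f) ⊛ coeffs g
≈ˡ⇒≋ f g p = pointwise λ i → begin
  ((X^ pole g) ⊛ coeffs f) i            ≡⟨ coeff-⊖ f i (pole g) ⟨
  coeff f (i ⊖ (pole f ℕ.+ pole g))     ≡⟨ p (i ⊖ (pole f ℕ.+ pole g)) ⟩
  coeff g (i ⊖ (pole f ℕ.+ pole g))     ≡⟨ cong (λ m → coeff g (i ⊖ m)) (ℕ.+-comm (pole f) (pole g)) ⟩
  coeff g (i ⊖ (pole g ℕ.+ pole f))     ≡⟨ coeff-⊖ g i (pole f) ⟩
  ((X^ pole f) ⊛ coeffs g) i            ∎
  where open ≡.≡-Reasoning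

≋⇒≈ˡ : ∀ f g → (X^ pole g) ⊛ coeffs f ≋ (X^ pole f) ⊛ coeffs g → f ≈ˡ g
≋⇒≈ˡ f g p i with i ℤ.+ pos (pole f ℕ.+ pole g) in eq
... | pos j      = begin
  coeff f i                             ≡⟨ cong (coeff f) i≡ ⟩
  coeff f (j ⊖ (pole f ℕ.+ pole g))     ≡⟨ coeff-⊖ f j (pole g) ⟩
  ((X^ pole g) ⊛ coeffs f) j            ≡⟨ at p j ⟩
  ((X^ pole f) ⊛ coeffs g) j            ≡⟨ coeff-⊖ g j (pole f) ⟨
  coeff g (j ⊖ (pole g ℕ.+ pole f))     ≡⟨ cong (λ m → coeff g (j ⊖ m)) (ℕ.+-comm (pole g) (pole f)) ⟩
  coeff g (j ⊖ (pole f ℕ.+ pole g))     ≡⟨ cong (coeff g) i≡ ⟨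
  coeff g i                             ∎
  where
  open ≡.≡-Reasoning
  N = pole f ℕ.+ pole g
  i≡ : i ≡ j ⊖ N
  i≡ = begin
    i                       ≡⟨ ℤ.+-identityʳ i ⟨
    i ℤ.+ ℤ.0ℤ              ≡⟨ cong (λ j → i ℤ.+ j) (ℤ.+-inverseʳ (pos N)) ⟨
    i ℤ.+ (pos N ℤ.- pos N) ≡⟨ ℤ.+-assoc i (pos N) (ℤ.- pos N) ⟨
    i ℤ.+ pos N ℤ.- pos N   ≡⟨ cong (ℤ._- pos N) eq ⟩
    pos j ℤ.- pos N         ≡⟨ ℤ.m-n≡m⊖n j N ⟩
    j ⊖ N                   ∎
-- Degrees below -(pole f + pole g) lie below both poles, so both coefficients are 0.
... | -[1+ j ] = ≡.trans (vanish (pole f) (pole g) (coeffs f) eq)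
                  (≡.sym (vanish (pole g) (pole f) (coeffs g)
                    (≡.trans (cong (λ n → i ℤ.+ pos n) (ℕ.+-comm (pole g) (pole f))) eq)))
  where
  vanish : ∀ m n a → i ℤ.+ pos (m ℕ.+ n) ≡ -[1+ j ] → extend a (i ℤ.+ pos m) ≡ 0ℚ
  vanish m n a eq′ with i ℤ.+ pos m in eq″
  ... | -[1+ _ ] = refl
  ... | pos l with () ← ≡.trans (≡.sym eq′) (≡.trans (≡.sym (ℤ.+-assoc i (pos m) (pos n))) (cong (ℤ._+ pos n) eq″))

≈ˡ-isEquivalence : IsEquivalence _≈ˡ_
≈ˡ-isEquivalence = record
  { refl  = λ _ → refl
  ; sym   = λ p i → ≡.sym (p i)
  ; trans = λ p q i → ≡.trans (p i) (q i)
  }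

opaque
  unfolding _⊕_ ⊝_ _⊛_

  +ˡ-coeffs : ∀ f g → coeffs (f +ˡ g) ≋ X^ pole g ⊛ coeffs f ⊕ X^ pole f ⊛ coeffs g
  +ˡ-coeffs f g = pointwise λ i → cong₂ ℚ._+_ (extend-⊖ (pole g) (coeffs f) i) (extend-⊖ (pole f) (coeffs g) i)

  *ˡ-coeffs : ∀ f g → coeffs (f *ˡ g) ≋ coeffs f ⊛ coeffs g
  *ˡ-coeffs f g = ≋-refl

  -ˡ-coeffs : ∀ f → coeffs (-ˡ f) ≋ ⊝ coeffs f
  -ˡ-coeffs f = ≋-refl

module SeriesSolver = Algebra.Solver.Ring.NaturalCoefficients.Default (CommutativeRing.commutativeSemiring seriesRing)
open SeriesSolver using (solve; _:=_; _:+_; _:*_)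

-- Numerator and denominator are kept as ring expressions up to `_≋_`. An identity of Laurent series
-- then becomes a cross-multiplied polynomial identity, which the semiring solver proves.
record _≙_/_ (f : Laurent) (A P : Series) : Set where
  constructor _,_
  field
    numerator   : coeffs f ≋ A
    denominator : X^ pole f ≋ P

fraction : ∀ f → f ≙ coeffs f / (X^ pole f)
fraction f = ≋-refl , ≋-refl

≙-+ : ∀ {f g A B P Q} → f ≙ A / P → g ≙ B / Q → (f +ˡ g) ≙ (Q ⊛ A ⊕ P ⊛ B) / (P ⊛ Q)
≙-+ {f} {g} (a , p) (b , q) =
  ≋-trans (+ˡ-coeffs f g) (⊕-cong (⊛-cong q a) (⊛-cong p b)) ,
  ≋-trans (X^-+ (pole f) (pole g)) (⊛-cong p q)

≙-* : ∀ {f g A B P Q} → f ≙ A / P → g ≙ B / Q → (f *ˡ g) ≙ (A ⊛ B) / (P ⊛ Q)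
≙-* {f} {g} (a , p) (b , q) =
  ≋-trans (*ˡ-coeffs f g) (⊛-cong a b) , ≋-trans (X^-+ (pole f) (pole g)) (⊛-cong p q)

≙⇒≈ˡ : ∀ {f g A B P Q} → f ≙ A / P → g ≙ B / Q → Q ⊛ A ≋ P ⊛ B → f ≈ˡ g
≙⇒≈ˡ {f} {g} (a , p) (b , q) r =
  ≋⇒≈ˡ f g (≋-trans (⊛-cong q a) (≋-trans r (≋-sym (⊛-cong p b))))

+ˡ-cong : ∀ {f f′ g g′} → f ≈ˡ f′ → g ≈ˡ g′ → f +ˡ g ≈ˡ f′ +ˡ g′
+ˡ-cong {f} {f′} {g} {g′} p q = ≙⇒≈ˡ
  (≙-+ (fraction f) (fraction g)) (≙-+ (fraction f′) (fraction g′)) (begin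
    (M′ ⊛ N′) ⊛ (N ⊛ a ⊕ M ⊛ b)             ≈⟨ lemma M′ N′ M N a b ⟩
    N ⊛ N′ ⊛ (M′ ⊛ a) ⊕ M ⊛ M′ ⊛ (N′ ⊛ b)   ≈⟨ ⊕-cong (⊛-congˡ (≈ˡ⇒≋ f f′ p))
                                                      (⊛-congˡ (≈ˡ⇒≋ g g′ q)) ⟩
    N ⊛ N′ ⊛ (M ⊛ a′) ⊕ M ⊛ M′ ⊛ (N ⊛ b′)   ≈⟨ lemma′ M N M′ N′ a′ b′ ⟩
    (M ⊛ N) ⊛ (N′ ⊛ a′ ⊕ M′ ⊛ b′)           ∎)
  where
  open ≋-Reasoning
  a = coeffs f ; a′ = coeffs f′ ; b = coeffs g ; b′ = coeffs g′
  M = X^ pole f ; M′ = X^ pole f′ ; N = X^ pole g ; N′ = X^ pole g′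
  lemma : ∀ m′ n′ m n u v → (m′ ⊛ n′) ⊛ (n ⊛ u ⊕ m ⊛ v) ≋ n ⊛ n′ ⊛ (m′ ⊛ u) ⊕ m ⊛ m′ ⊛ (n′ ⊛ v)
  lemma = solve 6 (λ m′ n′ m n u v → (m′ :* n′) :* (n :* u :+ m :* v) := n :* n′ :* (m′ :* u) :+ m :* m′ :* (n′ :* v)) ≋-refl
  lemma′ : ∀ m n m′ n′ u v → n ⊛ n′ ⊛ (m ⊛ u) ⊕ m ⊛ m′ ⊛ (n ⊛ v) ≋ (m ⊛ n) ⊛ (n′ ⊛ u ⊕ m′ ⊛ v)
  lemma′ = solve 6 (λ m n m′ n′ u v → n :* n′ :* (m :* u) :+ m :* m′ :* (n :* v) := (m :* n) :* (n′ :* u :+ m′ :* v)) ≋-refl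

*ˡ-cong : ∀ {f f′ g g′} → f ≈ˡ f′ → g ≈ˡ g′ → f *ˡ g ≈ˡ f′ *ˡ g′
*ˡ-cong {f} {f′} {g} {g′} p q = ≙⇒≈ˡ
  (≙-* (fraction f) (fraction g)) (≙-* (fraction f′) (fraction g′)) (begin
    (X^ pole f′ ⊛ X^ pole g′) ⊛ (coeffs f ⊛ coeffs g)     ≈⟨ interchange (X^ pole f′) (X^ pole g′) (coeffs f) (coeffs g) ⟩
    (X^ pole f′ ⊛ coeffs f) ⊛ (X^ pole g′ ⊛ coeffs g)     ≈⟨ ⊛-cong (≈ˡ⇒≋ f f′ p) (≈ˡ⇒≋ g g′ q) ⟩
    (X^ pole f ⊛ coeffs f′) ⊛ (X^ pole g ⊛ coeffs g′)     ≈⟨ interchange (X^ pole f) (X^ pole g) (coeffs f′) (coeffs g′) ⟨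
    (X^ pole f ⊛ X^ pole g) ⊛ (coeffs f′ ⊛ coeffs g′)     ∎)
  where
  open ≋-Reasoning
  interchange : ∀ u v w z → (u ⊛ v) ⊛ (w ⊛ z) ≋ (u ⊛ w) ⊛ (v ⊛ z)
  interchange = solve 4 (λ u v w z → (u :* v) :* (w :* z) := (u :* w) :* (v :* z)) ≋-refl

-ˡ-cong : ∀ {f g} → f ≈ˡ g → (-ˡ f) ≈ˡ (-ˡ g)
-ˡ-cong {f} {g} p = ≋⇒≈ˡ (-ˡ f) (-ˡ g) (begin
  X^ pole g ⊛ coeffs (-ˡ f)   ≈⟨ ⊛-congˡ (-ˡ-coeffs f) ⟩
  X^ pole g ⊛ (⊝ coeffs f)   ≈⟨ -‿distribʳ-* (X^ pole g) (coeffs f) ⟨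
  ⊝ (X^ pole g ⊛ coeffs f)   ≈⟨ ⊝-cong (≈ˡ⇒≋ f g p) ⟩
  ⊝ (X^ pole f ⊛ coeffs g)   ≈⟨ -‿distribʳ-* (X^ pole f) (coeffs g) ⟩
  X^ pole f ⊛ (⊝ coeffs g)   ≈⟨ ⊛-congˡ (-ˡ-coeffs g) ⟨
  X^ pole f ⊛ coeffs (-ˡ g)   ∎)
  where
  open ≋-Reasoning
  open import Algebra.Properties.Ring (CommutativeRing.ring seriesRing) using (-‿distribʳ-*)

private
  0ˡ : Laurent
  0ˡ = x^- 0 · λ _ → 0ℚ

+ˡ-assoc : ∀ f g h → (f +ˡ g) +ˡ h ≈ˡ f +ˡ (g +ˡ h)
+ˡ-assoc f g h = ≙⇒≈ˡ
  (≙-+ (≙-+ (fraction f) (fraction g)) (fraction h))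
  (≙-+ (fraction f) (≙-+ (fraction g) (fraction h)))
  (lemma (X^ pole f) (X^ pole g) (X^ pole h) (coeffs f) (coeffs g) (coeffs h))
  where
  lemma : ∀ m n o a b c → (m ⊛ (n ⊛ o)) ⊛ (o ⊛ (n ⊛ a ⊕ m ⊛ b) ⊕ (m ⊛ n) ⊛ c)
                       ≋ ((m ⊛ n) ⊛ o) ⊛ ((n ⊛ o) ⊛ a ⊕ m ⊛ (o ⊛ b ⊕ n ⊛ c))
  lemma = solve 6 (λ m n o a b c → (m :* (n :* o)) :* (o :* (n :* a :+ m :* b) :+ (m :* n) :* c) := ((m :* n) :* o) :* ((n :* o) :* a :+ m :* (o :* b :+ n :* c))) ≋-refl

+ˡ-comm : ∀ f g → f +ˡ g ≈ˡ g +ˡ f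
+ˡ-comm f g = ≙⇒≈ˡ (≙-+ (fraction f) (fraction g)) (≙-+ (fraction g) (fraction f))
  (lemma (X^ pole f) (X^ pole g) (coeffs f) (coeffs g))
  where
  lemma : ∀ m n a b → (n ⊛ m) ⊛ (n ⊛ a ⊕ m ⊛ b) ≋ (m ⊛ n) ⊛ (m ⊛ b ⊕ n ⊛ a)
  lemma = solve 4 (λ m n a b → (n :* m) :* (n :* a :+ m :* b) := (m :* n) :* (m :* b :+ n :* a)) ≋-refl

*ˡ-assoc : ∀ f g h → (f *ˡ g) *ˡ h ≈ˡ f *ˡ (g *ˡ h)
*ˡ-assoc f g h = ≙⇒≈ˡ
  (≙-* (≙-* (fraction f) (fraction g)) (fraction h))
  (≙-* (fraction f) (≙-* (fraction g) (fraction h)))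
  (lemma (X^ pole f) (X^ pole g) (X^ pole h) (coeffs f) (coeffs g) (coeffs h))
  where
  lemma : ∀ m n o a b c → (m ⊛ (n ⊛ o)) ⊛ ((a ⊛ b) ⊛ c) ≋ ((m ⊛ n) ⊛ o) ⊛ (a ⊛ (b ⊛ c))
  lemma = solve 6 (λ m n o a b c → (m :* (n :* o)) :* ((a :* b) :* c) := ((m :* n) :* o) :* (a :* (b :* c))) ≋-refl

*ˡ-comm : ∀ f g → f *ˡ g ≈ˡ g *ˡ f
*ˡ-comm f g = ≙⇒≈ˡ (≙-* (fraction f) (fraction g)) (≙-* (fraction g) (fraction f))
  (lemma (X^ pole f) (X^ pole g) (coeffs f) (coeffs g))
  where
  lemma : ∀ m n a b → (n ⊛ m) ⊛ (a ⊛ b) ≋ (m ⊛ n) ⊛ (b ⊛ a)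
  lemma = solve 4 (λ m n a b → (n :* m) :* (a :* b) := (m :* n) :* (b :* a)) ≋-refl

*ˡ-distribˡ : ∀ h f g → h *ˡ (f +ˡ g) ≈ˡ (h *ˡ f) +ˡ (h *ˡ g)
*ˡ-distribˡ h f g = ≙⇒≈ˡ
  (≙-* (fraction h) (≙-+ (fraction f) (fraction g)))
  (≙-+ (≙-* (fraction h) (fraction f)) (≙-* (fraction h) (fraction g)))
  (lemma (X^ pole f) (X^ pole g) (X^ pole h) (coeffs f) (coeffs g) (coeffs h))
  where
  lemma : ∀ m n o a b c → ((o ⊛ m) ⊛ (o ⊛ n)) ⊛ (c ⊛ (n ⊛ a ⊕ m ⊛ b))
                       ≋ (o ⊛ (m ⊛ n)) ⊛ ((o ⊛ n) ⊛ (c ⊛ a) ⊕ (o ⊛ m) ⊛ (c ⊛ b))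
  lemma = solve 6 (λ m n o a b c → ((o :* m) :* (o :* n)) :* (c :* (n :* a :+ m :* b)) := (o :* (m :* n)) :* ((o :* n) :* (c :* a) :+ (o :* m) :* (c :* b))) ≋-refl

+ˡ-identityˡ : ∀ f → 0ˡ +ˡ f ≈ˡ f
+ˡ-identityˡ f = ≋⇒≈ˡ (0ˡ +ˡ f) f (⊛-congˡ (begin
  coeffs (0ˡ +ˡ f)                        ≈⟨ +ˡ-coeffs 0ˡ f ⟩
  X^ pole f ⊛ 0# ⊕ X^ 0 ⊛ coeffs f        ≈⟨ ⊕-cong (S.zeroʳ (X^ pole f)) (⊛-identityˡ (coeffs f)) ⟩
  0# ⊕ coeffs f                           ≈⟨ S.+-identityˡ (coeffs f) ⟩
  coeffs f                                ∎))
  where open ≋-Reasoning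

*ˡ-identityˡ : ∀ f → 1# *ˡ f ≈ˡ f
*ˡ-identityˡ f = ≋⇒≈ˡ (1# *ˡ f) f (⊛-congˡ (≋-trans (*ˡ-coeffs 1# f) (⊛-identityˡ (coeffs f))))

-ˡ-inverseˡ : ∀ f → (-ˡ f) +ˡ f ≈ˡ 0ˡ
-ˡ-inverseˡ f = ≋⇒≈ˡ ((-ˡ f) +ˡ f) 0ˡ (begin
  X^ 0 ⊛ coeffs ((-ˡ f) +ˡ f)                              ≈⟨ ⊛-identityˡ _ ⟩
  coeffs ((-ˡ f) +ˡ f)                                     ≈⟨ +ˡ-coeffs (-ˡ f) f ⟩
  X^ pole f ⊛ coeffs (-ˡ f) ⊕ X^ pole f ⊛ coeffs f        ≈⟨ ⊕-congʳ (⊛-congˡ (-ˡ-coeffs f)) ⟩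
  X^ pole f ⊛ (⊝ coeffs f) ⊕ X^ pole f ⊛ coeffs f        ≈⟨ S.distribˡ (X^ pole f) (⊝ coeffs f) (coeffs f) ⟨
  X^ pole f ⊛ (⊝ coeffs f ⊕ coeffs f)                    ≈⟨ ⊛-congˡ (S.-‿inverseˡ (coeffs f)) ⟩
  X^ pole f ⊛ 0#                                         ≈⟨ S.zeroʳ (X^ pole f) ⟩
  0#                                                     ≈⟨ S.zeroʳ (X^ pole ((-ˡ f) +ˡ f)) ⟨
  X^ pole ((-ˡ f) +ˡ f) ⊛ 0#                               ∎)
  where open ≋-Reasoning

≈ˡ-setoid : Setoid 0ℓ 0ℓ
≈ˡ-setoid = record { isEquivalence = ≈ˡ-isEquivalence }

laurentRing : CommutativeRing 0ℓ 0ℓ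
laurentRing = record
  { Carrier = Laurent ; _≈_ = _≈ˡ_ ; _+_ = _+ˡ_ ; _*_ = _*ˡ_ ; -_ = -ˡ_ ; 0# = 0ˡ ; 1# = 1#
  ; isCommutativeRing = record
    { isRing = record
      { +-isAbelianGroup = record
        { isGroup = record
          { isMonoid = record
            { isSemigroup = record
              { isMagma = record
                { isEquivalence = ≈ˡ-isEquivalence
                ; ∙-cong = λ {f} {f′} {g} {g′} → +ˡ-cong {f} {f′} {g} {g′} }
              ; assoc = +ˡ-assoc }
            ; identity = comm∧idˡ⇒id +ˡ-comm +ˡ-identityˡ }
          ; inverse = comm∧invˡ⇒inv +ˡ-comm -ˡ-inverseˡ
          ; ⁻¹-cong = λ {f} {g} → -ˡ-cong {f} {g} }
        ; comm = +ˡ-comm }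
      ; *-cong = λ {f} {f′} {g} {g′} → *ˡ-cong {f} {f′} {g} {g′}
      ; *-assoc = *ˡ-assoc
      ; *-identity = comm∧idˡ⇒id *ˡ-comm *ˡ-identityˡ
      ; distrib = comm∧distrˡ⇒distr (λ {f} {f′} {g} {g′} → +ˡ-cong {f} {f′} {g} {g′}) *ˡ-comm *ˡ-distribˡ }
    ; *-comm = *ˡ-comm }
  }
  where
  open import Algebra.Consequences.Setoid ≈ˡ-setoid
    using (comm∧idˡ⇒id; comm∧invˡ⇒inv; comm∧distrˡ⇒distr)

-- The codes of the permutations and their generating functions

-- T k encodes the permutations avoiding 132 and 12…k: node l r is the
-- permutation L n R with L above R, where L avoids 12…(k−1).

data T : ℕ → Set where
  leaf : ∀ {k} → T (suc k)
  node : ∀ {k} → T k → T (suc k) → T (suc k)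

-- JT k encodes the involutions avoiding 12…k and containing 132 once.
-- With L a 132-avoiding permutation and M such an involution, they are
--   fix M    = M n,
--   wrap L M = L n M L⁻¹ j   (the last value j is the position of n),
--   base L   = L c n L⁻¹ j   with c = j − 1 a fixed point; (c, n, j) is the 132.

data JT : ℕ → Set where
  fix  : ∀ {k} → JT k → JT (suc k)
  wrap : ∀ {k} → T k → JT (suc k) → JT (suc k)
  base : ∀ {k} → T (2 ℕ.+ k) → JT (3 ℕ.+ k)

∣_∣ : ∀ {k} → T k → ℕ
∣ leaf ∣     = 0
∣ node l r ∣ = suc (∣ l ∣ ℕ.+ ∣ r ∣)

∥_∥ : ∀ {k} → JT k → ℕ
∥ fix t ∥    = suc ∥ t ∥
∥ wrap l t ∥ = 2 ℕ.+ (∣ l ∣ ℕ.+ ∣ l ∣ ℕ.+ ∥ t ∥)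
∥ base l ∥   = 3 ℕ.+ (∣ l ∣ ℕ.+ ∣ l ∣)

-- The lists are cut off at depth d, which keeps all codes of size up to d.

trees : ℕ → ∀ k → List (T k)
trees d       zero    = []
trees zero    (suc k) = leaf ∷ []
trees (suc d) (suc k) = leaf ∷ cartesianProductWith node (trees d k) (trees d (suc k))

bases : ℕ → ∀ k → List (JT (suc k))
bases d zero          = []
bases d (suc zero)    = []
bases d (suc (suc k)) = map base (trees d (2 ℕ.+ k))

involutions : ℕ → ∀ k → List (JT k)
involutions d       zero    = []
involutions zero    (suc k) = []
involutions (suc d) (suc k) =
  map fix (involutions d k) ++ cartesianProductWith wrap (trees d k) (involutions d (suc k)) ++ bases d k

-- Generating functions of lists

module _ {A : Set} (w : A → ℕ) where

  weights : List A → Series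
  weights []       = 0#
  weights (x ∷ xs) = X^ w x ⊕ weights xs

  weights-++ : ∀ xs ys → weights (xs ++ ys) ≋ weights xs ⊕ weights ys
  weights-++ []       ys = S.sym (S.+-identityˡ (weights ys))
  weights-++ (x ∷ xs) ys = S.trans (⊕-congˡ (weights-++ xs ys))
                                   (S.sym (S.+-assoc (X^ w x) (weights xs) (weights ys)))

weights-map : ∀ {A B : Set} {v : A → ℕ} {w : B → ℕ} {f : A → B} c → (∀ x → w (f x) ≡ c ℕ.+ v x) →
              ∀ xs → weights w (map f xs) ≋ X^ c ⊛ weights v xs
weights-map c p []       = S.sym (S.zeroʳ (X^ c))
weights-map {v = v} {w} {f} c p (x ∷ xs) = begin
  X^ w (f x) ⊕ weights w (map f xs)         ≡⟨ cong (λ n → X^ n ⊕ weights w (map f xs)) (p x) ⟩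
  X^ (c ℕ.+ v x) ⊕ weights w (map f xs)     ≈⟨ ⊕-cong (X^-+ c (v x)) (weights-map c p xs) ⟩
  X^ c ⊛ X^ v x ⊕ X^ c ⊛ weights v xs       ≈⟨ S.distribˡ (X^ c) (X^ v x) (weights v xs) ⟨
  X^ c ⊛ (X^ v x ⊕ weights v xs)            ∎
  where open ≋-Reasoning

weights-product : ∀ {A B C : Set} {u : A → ℕ} {v : B → ℕ} {w : C → ℕ} {f : A → B → C} c →
                  (∀ x y → w (f x y) ≡ c ℕ.+ (u x ℕ.+ v y)) →
                  ∀ xs ys → weights w (cartesianProductWith f xs ys) ≋ X^ c ⊛ (weights u xs ⊛ weights v ys)
weights-product {v = v} c p [] ys = S.sym (S.trans (⊛-congˡ (S.zeroˡ (weights v ys))) (S.zeroʳ (X^ c)))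
weights-product {u = u} {v} {w} {f} c p (x ∷ xs) ys = begin
  weights w (map (f x) ys ++ cartesianProductWith f xs ys)
    ≈⟨ weights-++ w (map (f x) ys) (cartesianProductWith f xs ys) ⟩
  weights w (map (f x) ys) ⊕ weights w (cartesianProductWith f xs ys)
    ≈⟨ ⊕-cong (weights-map (c ℕ.+ u x) (λ y → ≡.trans (p x y) (≡.sym (ℕ.+-assoc c (u x) (v y)))) ys)
              (weights-product c p xs ys) ⟩
  X^ (c ℕ.+ u x) ⊛ weights v ys ⊕ X^ c ⊛ (weights u xs ⊛ weights v ys)
    ≈⟨ ⊕-cong (⊛-cong (X^-+ c (u x)) ≋-refl) ≋-refl ⟩
  X^ c ⊛ X^ u x ⊛ weights v ys ⊕ X^ c ⊛ (weights u xs ⊛ weights v ys)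
    ≈⟨ solve 4 (λ a b c d → a :* b :* d :+ a :* (c :* d) := a :* ((b :+ c) :* d)) ≋-refl
         (X^ c) (X^ u x) (weights u xs) (weights v ys) ⟩
  X^ c ⊛ ((X^ u x ⊕ weights u xs) ⊛ weights v ys) ∎
  where open ≋-Reasoning

opaque
  unfolding _⊕_

  weights-coeff : ∀ {A : Set} (w : A → ℕ) xs n → weights w xs n ≡ pos (length (filter (λ t → w t ℕ.≟ n) xs)) ℚ./ 1
  weights-coeff w []       n = refl
  weights-coeff w (x ∷ xs) n with w x ℕ.≟ n
  ... | yes w≡n = ≡.trans (cong₂ ℚ._+_ (monomial-≡ (w x) n w≡n) (weights-coeff w xs n))
      (≡.trans (1+ (length (filter (λ t → w t ℕ.≟ n) xs)))
               (cong (λ ys → pos (length ys) ℚ./ 1) (≡.sym (filter-accept (λ t → w t ℕ.≟ n) w≡n))))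
    where
    monomial-≡ : ∀ m n → m ≡ n → monomial 1ℚ m n ≡ 1ℚ
    monomial-≡ zero    _ refl = refl
    monomial-≡ (suc m) _ refl = monomial-≡ m m refl
    -- The fraction m/1 is already in lowest terms, so normalisation leaves it alone and the sum can
    -- be evaluated.
    1+ : ∀ m → 1ℚ ℚ.+ (pos m ℚ./ 1) ≡ pos (suc m) ℚ./ 1
    1+ m = ≡.trans (cong (1ℚ ℚ.+_) (ℚ.normalize-coprime {m} (Coprime.sym (Coprime.1-coprimeTo m))))
                   (ℚ./-cong (cong (λ i → pos 1 ℤ.+ i) (ℤ.*-identityʳ (pos m))) refl)
  ... | no  w≢n = ≡.trans (cong₂ ℚ._+_ (monomial-≢ (w x) n w≢n) (weights-coeff w xs n))
      (≡.trans (ℚ.+-identityˡ (pos (length (filter (λ t → w t ℕ.≟ n) xs)) ℚ./ 1))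
               (cong (λ ys → pos (length ys) ℚ./ 1) (≡.sym (filter-reject (λ t → w t ℕ.≟ n) w≢n))))
    where
    monomial-≢ : ∀ m n → m ≢ n → monomial 1ℚ m n ≡ 0ℚ
    monomial-≢ zero    zero    m≢n = contradiction refl m≢n
    monomial-≢ zero    (suc n) m≢n = refl
    monomial-≢ (suc m) zero    m≢n = refl
    monomial-≢ (suc m) (suc n) m≢n = monomial-≢ m n (m≢n ∘ cong suc)

-- Congruence modulo xⁿ

infix 4 _≋_mod_
record _≋_mod_ (a b : Series) (n : ℕ) : Set where
  constructor congruent
  field below : ∀ {i} → i < n → a i ≡ b i

open _≋_mod_

≋-mod : ∀ {a b n} → a ≋ b → a ≋ b mod n
≋-mod p = congruent λ {i} _ → _≋_.at p i

mod-trans : ∀ {a b c n} → a ≋ b mod n → b ≋ c mod n → a ≋ c mod n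
mod-trans p q = congruent λ i<n → ≡.trans (below p i<n) (below q i<n)

opaque
  unfolding _⊕_ _⊛_

  ⊕-cong-mod : ∀ {a a′ b b′ n} → a ≋ a′ mod n → b ≋ b′ mod n → a ⊕ b ≋ a′ ⊕ b′ mod n
  ⊕-cong-mod p q = congruent λ i<n → cong₂ ℚ._+_ (below p i<n) (below q i<n)

  ⊛-cong-mod : ∀ {a a′ b b′ n} → a ≋ a′ mod n → b ≋ b′ mod n → a ⊛ b ≋ a′ ⊛ b′ mod n
  ⊛-cong-mod p q = congruent (lemma p q)
    where
    lemma : ∀ {a a′ b b′ n} → a ≋ a′ mod n → b ≋ b′ mod n → ∀ {i} → i < n → (a ⊛ b) i ≡ (a′ ⊛ b′) i
    lemma p q {zero}  i<n = cong (ℚ._+ 0ℚ) (cong₂ ℚ._*_ (below p i<n) (below q i<n))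
    lemma {n = suc n} p q {suc i} (s≤s i<n) = cong₂ ℚ._+_
      (cong₂ ℚ._*_ (below p (s≤s z≤n)) (below q (s≤s i<n)))
      (lemma (congruent (below p ∘ s≤s)) (congruent λ j<n → below q (ℕ.m≤n⇒m≤1+n j<n)) i<n)

  -- The factor x gains one order of precision. This contraction makes the recursions converge and
  -- determines their limits.
  X^1+-cong-mod : ∀ c {a b n} → a ≋ b mod n → X^ suc c ⊛ a ≋ X^ suc c ⊛ b mod (suc n)
  X^1+-cong-mod c {a} {b} {n} p = congruent lemma
    where
    lemma : ∀ {i} → i < suc n → (X^ suc c ⊛ a) i ≡ (X^ suc c ⊛ b) i
    lemma {zero}  _         = cong (ℚ._+ 0ℚ) (≡.trans (ℚ.*-zeroˡ (a 0)) (≡.sym (ℚ.*-zeroˡ (b 0))))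
    lemma {suc i} (s≤s i<n) = ≡.trans (X^1+-⊛ c a i)
      (≡.trans (below (⊛-cong-mod (≋-mod (≋-refl {X^ c})) p) i<n) (≡.sym (X^1+-⊛ c b i)))

-- Depth `suc i` is the first depth at which stability fixes the coefficient of degree i.
limit : (ℕ → Series) → Series
limit a i = a (suc i) i

Stable : (ℕ → Series) → Set
Stable a = ∀ n {d e} → n ≤ d → n ≤ e → a d ≋ a e mod n

limit-mod : ∀ {a} → Stable a → ∀ n → a n ≋ limit a mod n
limit-mod stable n = congruent λ {i} i<n → below (stable (suc i) i<n ℕ.≤-refl) ℕ.≤-refl

-- The generating functions at x² of the trees, and of the involutions

doubled : ∀ {k} → T k → ℕ
doubled t = ∣ t ∣ ℕ.+ ∣ t ∣

treeSeries : ∀ k → ℕ → Series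
treeSeries k d = weights doubled (trees d k)

baseTerm : ℕ → Series → Series
baseTerm 0             c = 0#
baseTerm 1             c = 0#
baseTerm (suc (suc k)) c = X^ 3 ⊛ c

involutionSeries : ∀ k → ℕ → Series
involutionSeries k d = weights ∥_∥ (involutions d k)

treeSeries-suc : ∀ k d → treeSeries (suc k) (suc d) ≋ X^ 0 ⊕ X^ 2 ⊛ (treeSeries k d ⊛ treeSeries (suc k) d)
treeSeries-suc k d = ⊕-congˡ (weights-product 2 (λ l r → lemma ∣ l ∣ ∣ r ∣) (trees d k) (trees d (suc k)))
  where
  lemma : ∀ l r → suc (l ℕ.+ r) ℕ.+ suc (l ℕ.+ r) ≡ 2 ℕ.+ (l ℕ.+ l ℕ.+ (r ℕ.+ r))
  lemma = ℕ-solve-∀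

involutionSeries-suc : ∀ k d → involutionSeries (suc k) (suc d) ≋
  X^ 1 ⊛ involutionSeries k d ⊕ X^ 2 ⊛ (treeSeries k d ⊛ involutionSeries (suc k) d) ⊕ baseTerm k (treeSeries k d)
involutionSeries-suc k d = begin
  weights ∥_∥ (involutions (suc d) (suc k))
    ≈⟨ weights-++ ∥_∥ (map fix (involutions d k)) _ ⟩
  weights ∥_∥ (map fix (involutions d k)) ⊕ weights ∥_∥ (cartesianProductWith wrap (trees d k) (involutions d (suc k)) ++ bases d k)
    ≈⟨ ⊕-congˡ
         (weights-++ ∥_∥ (cartesianProductWith wrap (trees d k) (involutions d (suc k))) (bases d k)) ⟩
  weights ∥_∥ (map fix (involutions d k)) ⊕
    (weights ∥_∥ (cartesianProductWith wrap (trees d k) (involutions d (suc k))) ⊕ weights ∥_∥ (bases d k))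
    ≈⟨ ⊕-cong (weights-map 1 (λ _ → refl) (involutions d k))
         (⊕-cong (weights-product {u = doubled} 2 (λ _ _ → refl) (trees d k) (involutions d (suc k))) (bases-series k)) ⟩
  X^ 1 ⊛ involutionSeries k d ⊕ (X^ 2 ⊛ (treeSeries k d ⊛ involutionSeries (suc k) d) ⊕ baseTerm k (treeSeries k d))
    ≈⟨ S.+-assoc (X^ 1 ⊛ involutionSeries k d) _ _ ⟨
  X^ 1 ⊛ involutionSeries k d ⊕ X^ 2 ⊛ (treeSeries k d ⊛ involutionSeries (suc k) d) ⊕ baseTerm k (treeSeries k d) ∎
  where
  open ≋-Reasoning
  bases-series : ∀ k → weights ∥_∥ (bases d k) ≋ baseTerm k (treeSeries k d)
  bases-series 0             = ≋-refl
  bases-series 1             = ≋-refl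
  bases-series (suc (suc k)) = weights-map 3 (λ _ → refl) (trees d (2 ℕ.+ k))

treeStep : Series → Series → Series
treeStep c c′ = X^ 0 ⊕ X^ 2 ⊛ (c ⊛ c′)

treeStep-mod : ∀ {a a′ b b′ n} → a ≋ a′ mod n → b ≋ b′ mod n → treeStep a b ≋ treeStep a′ b′ mod (suc n)
treeStep-mod p q = ⊕-cong-mod (≋-mod (≋-refl {X^ 0})) (X^1+-cong-mod 1 (⊛-cong-mod p q))

involutionStep : ℕ → Series → Series → Series → Series
involutionStep k c j j′ = X^ 1 ⊛ j ⊕ X^ 2 ⊛ (c ⊛ j′) ⊕ baseTerm k c

involutionStep-mod : ∀ (k : ℕ) {c c′ i i′ j j′ n} → c ≋ c′ mod n → i ≋ i′ mod n → j ≋ j′ mod n →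
                     involutionStep k c i j ≋ involutionStep k c′ i′ j′ mod (suc n)
involutionStep-mod k {n = n} p q r = ⊕-cong-mod
  (⊕-cong-mod (X^1+-cong-mod 0 q) (X^1+-cong-mod 1 (⊛-cong-mod p r))) (baseTerm-mod k p)
  where
  baseTerm-mod : ∀ (k : ℕ) {c c′} → c ≋ c′ mod n → baseTerm k c ≋ baseTerm k c′ mod (suc n)
  baseTerm-mod 0             p = ≋-mod ≋-refl
  baseTerm-mod 1             p = ≋-mod ≋-refl
  baseTerm-mod (suc (suc k)) p = X^1+-cong-mod 2 p

treeSeries-stable : ∀ k → Stable (treeSeries k)
treeSeries-stable zero    n       _           _           = congruent λ _ → refl
treeSeries-stable (suc k) zero    _           _           = congruent λ ()
treeSeries-stable (suc k) (suc n) {suc d} {suc e} (s≤s n≤d) (s≤s n≤e) =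
  mod-trans (≋-mod (treeSeries-suc k d)) (mod-trans
    (treeStep-mod (treeSeries-stable k n n≤d n≤e) (treeSeries-stable (suc k) n n≤d n≤e))
    (≋-mod (≋-sym (treeSeries-suc k e))))

involutionSeries-stable : ∀ k → Stable (involutionSeries k)
involutionSeries-stable zero    n       _           _           = congruent λ _ → refl
involutionSeries-stable (suc k) zero    _           _           = congruent λ ()
involutionSeries-stable (suc k) (suc n) {suc d} {suc e} (s≤s n≤d) (s≤s n≤e) =
  mod-trans (≋-mod (involutionSeries-suc k d)) (mod-trans
    (involutionStep-mod k (treeSeries-stable k n n≤d n≤e) (involutionSeries-stable k n n≤d n≤e)
                          (involutionSeries-stable (suc k) n n≤d n≤e))
    (≋-mod (≋-sym (involutionSeries-suc k e))))

C J : ℕ → Series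
C k = limit (treeSeries k)
J k = limit (involutionSeries k)

-- Coefficient i of the limit is read at depth i + 1, where it comes from one step applied at depth
-- i. There the series agree with their limits modulo xⁱ, and the step raises this to precision i +
-- 1, just enough for degree i.
C-suc : ∀ k → C (suc k) ≋ treeStep (C k) (C (suc k))
C-suc k = pointwise λ i → ≡.trans (_≋_.at (treeSeries-suc k i) i)
  (below (treeStep-mod (limit-mod (treeSeries-stable k) i) (limit-mod (treeSeries-stable (suc k)) i)) ℕ.≤-refl)

J-suc : ∀ k → J (suc k) ≋ involutionStep k (C k) (J k) (J (suc k))
J-suc k = pointwise λ i → ≡.trans (_≋_.at (involutionSeries-suc k i) i)
  (below (involutionStep-mod k (limit-mod (treeSeries-stable k) i) (limit-mod (involutionSeries-stable k) i)
                        (limit-mod (involutionSeries-stable (suc k)) i)) ℕ.≤-refl)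

-- Embedding the series in the field

⌊_⌋ : Series → Laurent
⌊ a ⌋ = x^- 0 · a

⌊⌋-cong : ∀ {a b} → a ≋ b → ⌊ a ⌋ ≈ˡ ⌊ b ⌋
⌊⌋-cong {a} {b} p = ≋⇒≈ˡ ⌊ a ⌋ ⌊ b ⌋ (⊛-congˡ p)

⌊⌋-+ : ∀ a b → ⌊ a ⊕ b ⌋ ≈ˡ ⌊ a ⌋ +ˡ ⌊ b ⌋
⌊⌋-+ a b = ⌊⌋-cong (S.sym (S.trans (+ˡ-coeffs ⌊ a ⌋ ⌊ b ⌋) (⊕-cong (⊛-identityˡ a) (⊛-identityˡ b))))

private
  module L = CommutativeRing laurentRing

⌊⌋-* : ∀ a b → ⌊ a ⊛ b ⌋ ≈ˡ ⌊ a ⌋ *ˡ ⌊ b ⌋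
⌊⌋-* a b = ⌊⌋-cong (≋-sym (*ˡ-coeffs ⌊ a ⌋ ⌊ b ⌋))

private
  1/x : Laurent
  1/x = x^- 1 · (X^ 0)

  x*1/x : x * 1/x ≈ 1#
  x*1/x = ≋⇒≈ˡ (x * 1/x) 1# (≋-trans (⊛-identityˡ _) (*ˡ-coeffs x 1/x))

  1/2x+1/2x : 1/2x +ˡ 1/2x ≈ 1/x
  1/2x+1/2x = ≋⇒≈ˡ (1/2x +ˡ 1/2x) 1/x (begin
    X^ 1 ⊛ coeffs (1/2x +ˡ 1/2x)                            ≈⟨ ⊛-congˡ (+ˡ-coeffs 1/2x 1/2x) ⟩
    X^ 1 ⊛ (X^ 1 ⊛ monomial ½ 0 ⊕ X^ 1 ⊛ monomial ½ 0)      ≈⟨ ⊛-congˡ (S.distribˡ (X^ 1) (monomial ½ 0) (monomial ½ 0)) ⟨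
    X^ 1 ⊛ (X^ 1 ⊛ (monomial ½ 0 ⊕ monomial ½ 0))           ≈⟨ ⊛-congˡ (⊛-congˡ ½+½) ⟩
    X^ 1 ⊛ (X^ 1 ⊛ X^ 0)                                    ≈⟨ S.*-assoc (X^ 1) (X^ 1) (X^ 0) ⟨
    X^ 1 ⊛ X^ 1 ⊛ X^ 0                                      ≈⟨ ⊛-congʳ (X^-+ 1 1) ⟨
    X^ 2 ⊛ X^ 0                                             ∎)
    where
    open ≋-Reasoning
    opaque
      unfolding _⊕_
      ½+½ : monomial ½ 0 ⊕ monomial ½ 0 ≋ X^ 0
      ½+½ = pointwise λ { zero → refl ; (suc i) → refl }

X² : ⌊ X^ 2 ⌋ ≈ x * x
X² = L.trans {⌊ X^ 2 ⌋} {⌊ X^ 1 ⊛ X^ 1 ⌋} {x * x} (⌊⌋-cong (X^-+ 1 1)) (⌊⌋-* (X^ 1) (X^ 1))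

X³ : ⌊ X^ 3 ⌋ ≈ x * x * x
X³ = L.trans {⌊ X^ 3 ⌋} {⌊ X^ 2 ⊛ X^ 1 ⌋} {x * x * x} (⌊⌋-cong (X^-+ 2 1))
  (L.trans {⌊ X^ 2 ⊛ X^ 1 ⌋} {⌊ X^ 2 ⌋ * x} {x * x * x} (⌊⌋-* (X^ 2) (X^ 1)) (L.*-congʳ {x} {⌊ X^ 2 ⌋} {x * x} X²))

⌊⌋-X²-* : ∀ a b → ⌊ X^ 2 ⊛ (a ⊛ b) ⌋ ≈ x * x * (⌊ a ⌋ * ⌊ b ⌋)
⌊⌋-X²-* a b = L.trans {⌊ X^ 2 ⊛ (a ⊛ b) ⌋} {⌊ X^ 2 ⌋ * ⌊ a ⊛ b ⌋} {x * x * (⌊ a ⌋ * ⌊ b ⌋)} (⌊⌋-* (X^ 2) (a ⊛ b))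
  (L.*-cong {⌊ X^ 2 ⌋} {x * x} {⌊ a ⊛ b ⌋} {⌊ a ⌋ * ⌊ b ⌋} X² (⌊⌋-* a b))

C-equation : ∀ k → ⌊ C (suc k) ⌋ ≈ 1# +ˡ (x * x * (⌊ C k ⌋ * ⌊ C (suc k) ⌋))
C-equation k = L.trans {⌊ C (suc k) ⌋} {⌊ X^ 0 ⊕ d ⌋} {1# +ˡ d′} (⌊⌋-cong (C-suc k))
  (L.trans {⌊ X^ 0 ⊕ d ⌋} {1# +ˡ ⌊ d ⌋} {1# +ˡ d′} (⌊⌋-+ (X^ 0) d)
    (L.+-congˡ {1#} {⌊ d ⌋} {d′} (⌊⌋-X²-* (C k) (C (suc k)))))
  where
  d  = X^ 2 ⊛ (C k ⊛ C (suc k))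
  d′ = x * x * (⌊ C k ⌋ * ⌊ C (suc k) ⌋)

J-equation : ∀ k {b} → ⌊ baseTerm k (C k) ⌋ ≈ b →
  ⌊ J (suc k) ⌋ ≈ ((x * ⌊ J k ⌋) +ˡ (x * x * (⌊ C k ⌋ * ⌊ J (suc k) ⌋))) +ˡ b
J-equation k {b} p = L.trans {⌊ J (suc k) ⌋} {⌊ c ⊕ d ⊕ e ⌋} {(c′ +ˡ d′) +ˡ b} (⌊⌋-cong (J-suc k))
  (L.trans {⌊ c ⊕ d ⊕ e ⌋} {⌊ c ⊕ d ⌋ +ˡ ⌊ e ⌋} {(c′ +ˡ d′) +ˡ b} (⌊⌋-+ (c ⊕ d) e)
    (L.+-cong {⌊ c ⊕ d ⌋} {c′ +ˡ d′} {⌊ e ⌋} {b} (L.trans {⌊ c ⊕ d ⌋} {⌊ c ⌋ +ˡ ⌊ d ⌋} {c′ +ˡ d′} (⌊⌋-+ c d)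
      (L.+-cong {⌊ c ⌋} {c′} {⌊ d ⌋} {d′} (⌊⌋-* (X^ 1) (J k)) (⌊⌋-X²-* (C k) (J (suc k))))) p))
  where
  c  = X^ 1 ⊛ J k
  c′ = x * ⌊ J k ⌋
  d  = X^ 2 ⊛ (C k ⊛ J (suc k))
  d′ = x * x * (⌊ C k ⌋ * ⌊ J (suc k) ⌋)
  e  = baseTerm k (C k)

J-equation₀ : ∀ k → baseTerm k (C k) ≡ 0# →
  ⌊ J (suc k) ⌋ ≈ (x * ⌊ J k ⌋) +ˡ (x * x * (⌊ C k ⌋ * ⌊ J (suc k) ⌋))
J-equation₀ k p = L.trans {⌊ J (suc k) ⌋} {s +ˡ L.0#} {s} (J-equation k (L.reflexive (cong ⌊_⌋ p))) (L.+-identityʳ s)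
  where s = (x * ⌊ J k ⌋) +ˡ (x * x * (⌊ C k ⌋ * ⌊ J (suc k) ⌋))

J-equation₃ : ∀ k → ⌊ J (3 ℕ.+ k) ⌋ ≈
  ((x * ⌊ J (2 ℕ.+ k) ⌋) +ˡ (x * x * (⌊ C (2 ℕ.+ k) ⌋ * ⌊ J (3 ℕ.+ k) ⌋))) +ˡ (x * x * x * ⌊ C (2 ℕ.+ k) ⌋)
J-equation₃ k = J-equation (2 ℕ.+ k) {b}
  (L.trans {⌊ X^ 3 ⊛ c ⌋} {⌊ X^ 3 ⌋ * ⌊ c ⌋} {b} (⌊⌋-* (X^ 3) c) (L.*-congʳ {⌊ c ⌋} {⌊ X^ 3 ⌋} {x * x * x} X³))
  where
  c = C (2 ℕ.+ k)
  b = x * x * x * ⌊ c ⌋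

module Solve = GeneratingFunctions.Solution laurentRing x 1/x 1/2x x*1/x 1/2x+1/2x
  (λ k → ⌊ C k ⌋) (λ k → ⌊ J k ⌋) (L.reflexive (cong ⌊_⌋ {C 0} {0#} refl)) C-equation (L.reflexive (cong ⌊_⌋ {J 0} {0#} refl))
  (J-equation₀ 0 refl) (J-equation₀ 1 refl) J-equation₃

open import Data.Nat.Base using (_+_)
open import Data.Nat.Properties
open ≡ using (sym; trans)

<-castʳ : ∀ {i m n} → m ≡ n → i < m → i < n
<-castʳ refl i<m = i<m

-- Patterns in sets of points

-- A permutation is handled through its points (position, value) in the plane of natural numbers, so
-- that blocks are subsets and inversion is transposition.
Points : Set₁
Points = ℕ → ℕ → Set

infix 4 _⊆_
_⊆_ : Points → Points → Set
G ⊆ H = ∀ {i v} → G i v → H i v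

_ᵀ : Points → Points
(G ᵀ) i v = G v i

-- Inc G n a b: n points of G with increasing positions ≥ a and increasing values ≥ b
data Inc (G : Points) : ℕ → ℕ → ℕ → Set where
  []   : ∀ {a b} → Inc G 0 a b
  step : ∀ {n a b i v} → G i v → a ≤ i → b ≤ v → Inc G n (suc i) (suc v) → Inc G (suc n) a b

record Occ (G : Points) (i j k : ℕ) : Set where
  constructor occ
  field
    {u v w} : ℕ
    first   : G i u
    second  : G j v
    third   : G k w
    i<j     : i < j
    j<k     : j < k
    u<w     : u < w
    w<v     : w < v

record Once (G : Points) : Set where
  constructor once
  field
    {i j k}    : ℕ
    occurrence : Occ G i j k
    unique     : ∀ {i′ j′ k′} → Occ G i′ j′ k′ → i′ ≡ i × j′ ≡ j × k′ ≡ k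

Occ-mono : ∀ {G H i j k} → G ⊆ H → Occ G i j k → Occ H i j k
Occ-mono G⊆H (occ x y z p q r s) = occ (G⊆H x) (G⊆H y) (G⊆H z) p q r s

-- The whole sequence lies in the quadrant from (a, b) on, so membership in `H` is only asked for
-- there. This is how a sequence or its rest is confined to the block in which it starts.
Inc-lift : ∀ {G H n a b} → (∀ {i v} → a ≤ i → b ≤ v → G i v → H i v) → Inc G n a b → Inc H n a b
Inc-lift f []                = []
Inc-lift f (step x a≤i b≤v xs) = step (f a≤i b≤v x) a≤i b≤v
  (Inc-lift (λ p q → f (≤-trans a≤i (<⇒≤ p)) (≤-trans b≤v (<⇒≤ q))) xs)

Inc-mono : ∀ {G H n a b} → G ⊆ H → Inc G n a b → Inc H n a b
Inc-mono G⊆H = Inc-lift (λ _ _ → G⊆H)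

Inc-ᵀ : ∀ {G n a b} → Inc G n a b → Inc (G ᵀ) n b a
Inc-ᵀ []              = []
Inc-ᵀ (step x r s xs) = step x s r (Inc-ᵀ xs)

-- A point of `G` outside `H` has the largest value in the quadrant, so it can only be the last
-- point of an increasing sequence; dropping the last point leaves a sequence in `H`.
Inc-drop : ∀ {G H n a b} →
  (∀ {i v} → a ≤ i → b ≤ v → G i v → H i v ⊎ (∀ {j w} → a ≤ j → b ≤ w → G j w → w ≤ v)) →
  Inc G (suc n) a b → Inc H n a b
Inc-drop {n = zero}  f (step x r s xs) = []
Inc-drop {n = suc n} f (step x r s (step y r′ s′ ys)) with f r s x
... | inj₁ x∈H = step x∈H r s (Inc-drop
  (λ p q g → Sum.map₂ (λ m p q → m (≤-trans r (<⇒≤ p)) (≤-trans s (<⇒≤ q))) (f (≤-trans r (<⇒≤ p)) (≤-trans s (<⇒≤ q)) g))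
  (step y r′ s′ ys))
... | inj₂ max = contradiction (max (≤-trans r (<⇒≤ r′)) (≤-trans s (<⇒≤ s′)) y) (<⇒≱ s′)

-- The counterpart of `Inc-drop`: a point above and to the right of all others lengthens every
-- sequence. Hence the part before n avoids a pattern that is shorter by one.
Inc-append : ∀ {G H n a b j w} → G ⊆ H → H j w → a ≤ j → b ≤ w → (∀ {i v} → G i v → i < j × v < w) →
             Inc G n a b → Inc H (suc n) a b
Inc-append G⊆H y a≤j b≤w f []              = step y a≤j b≤w []
Inc-append G⊆H y a≤j b≤w f (step x r s xs) =
  step (G⊆H x) r s (Inc-append G⊆H y (proj₁ (f x)) (proj₂ (f x)) f xs)

-- The points of the permutation t placed at positions p, p+1, … with values q, q+1, …

data ⟦_⟧ : ∀ {k} → T k → ℕ → ℕ → Points where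
  left  : ∀ {k} {l : T k} {r p q i v} → ⟦ l ⟧ p (q + ∣ r ∣) i v → ⟦ node l r ⟧ p q i v
  top   : ∀ {k} {l : T k} {r p q i v} → i ≡ p + ∣ l ∣ → v ≡ q + ∣ r ∣ + ∣ l ∣ → ⟦ node l r ⟧ p q i v
  right : ∀ {k} {l : T k} {r p q i v} → ⟦ r ⟧ (suc (p + ∣ l ∣)) q i v → ⟦ node l r ⟧ p q i v

record Box (p p′ q q′ i v : ℕ) : Set where
  constructor box
  field
    p≤i : p ≤ i
    i<p′ : i < p′
    q≤v : q ≤ v
    v<q′ : v < q′

open Box

suc-+-right : ∀ p a b → suc (p + a) + b ≡ p + suc (a + b)
suc-+-right = ℕ-solve-∀

suc-+-left : ∀ q a b → suc (q + b + a) ≡ q + suc (a + b)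
suc-+-left = ℕ-solve-∀

tree-box : ∀ {k} (t : T k) {p q} → ⟦ t ⟧ p q ⊆ Box p (p + ∣ t ∣) q (q + ∣ t ∣)
tree-box (node l r) {p} {q} (left x) with box a b c d ← tree-box l x =
  box a (<-≤-trans b (+-monoʳ-≤ p (≤-trans (m≤m+n ∣ l ∣ ∣ r ∣) (n≤1+n _))))
      (≤-trans (m≤m+n q ∣ r ∣) c) (<-castʳ (suc-+-left q ∣ l ∣ ∣ r ∣) (m≤n⇒m≤1+n d))
tree-box (node l r) {p} {q} (top refl refl) =
  box (m≤m+n p ∣ l ∣) (+-monoʳ-< p (s≤s (m≤m+n ∣ l ∣ ∣ r ∣)))
      (≤-trans (m≤m+n q ∣ r ∣) (m≤m+n _ ∣ l ∣)) (≤-reflexive (suc-+-left q ∣ l ∣ ∣ r ∣))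
tree-box (node l r) {p} {q} (right x) with box a b c d ← tree-box r x =
  box (≤-trans (m≤m+n p ∣ l ∣) (<⇒≤ a)) (<-castʳ (suc-+-right p ∣ l ∣ ∣ r ∣) b)
      c (<-≤-trans d (+-monoʳ-≤ q (≤-trans (m≤n+m ∣ r ∣ ∣ l ∣) (n≤1+n _))))

module _ {k} {l : T k} {r : T (suc k)} {p q i v : ℕ} where

  in-left : ⟦ node l r ⟧ p q i v → i < p + ∣ l ∣ → ⟦ l ⟧ p (q + ∣ r ∣) i v
  in-left (left x)     i< = x
  in-left (top refl _) i< = contradiction i< (<-irrefl refl)
  in-left (right x)    i< = contradiction (p≤i (tree-box r x)) (<⇒≱ (m<n⇒m<1+n i<))

  in-right : ⟦ node l r ⟧ p q i v → suc (p + ∣ l ∣) ≤ i → ⟦ r ⟧ (suc (p + ∣ l ∣)) q i v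
  in-right (left x)     ≤i = contradiction (i<p′ (tree-box l x)) (<⇒≱ (m≤n⇒m≤1+n ≤i))
  in-right (top refl _) ≤i = contradiction ≤i (<-irrefl refl)
  in-right (right x)    ≤i = x

  in-lower : ⟦ node l r ⟧ p q i v → v < q + ∣ r ∣ → ⟦ r ⟧ (suc (p + ∣ l ∣)) q i v
  in-lower (left x)     v< = contradiction (q≤v (tree-box l x)) (<⇒≱ v<)
  in-lower (top _ refl) v< = contradiction (m≤m+n _ ∣ l ∣) (<⇒≱ v<)
  in-lower (right x)    v< = x

  in-upper : ⟦ node l r ⟧ p q i v → q + ∣ r ∣ ≤ v → ⟦ l ⟧ p (q + ∣ r ∣) i v ⊎ (i ≡ p + ∣ l ∣ × v ≡ q + ∣ r ∣ + ∣ l ∣)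
  in-upper (left x)  ≤v = inj₁ x
  in-upper (top a b) ≤v = inj₂ (a , b)
  in-upper (right x) ≤v = contradiction (v<q′ (tree-box r x)) (≤⇒≯ ≤v)

  value-≤-top : ⟦ node l r ⟧ p q i v → v ≤ q + ∣ r ∣ + ∣ l ∣
  value-≤-top x = s≤s⁻¹ (<-castʳ (sym (suc-+-left q ∣ l ∣ ∣ r ∣)) (v<q′ (tree-box (node l r) x)))

at-top : ∀ {k} {l : T k} {r : T (suc k)} {p q i v} → ⟦ node l r ⟧ p q i v →
         v ≡ q + ∣ r ∣ + ∣ l ∣ → i ≡ p + ∣ l ∣
at-top {l = l}         (left x)  refl = contradiction (v<q′ (tree-box l x)) (<-irrefl refl)
at-top                 (top i≡ _) _   = i≡
at-top {l = l} {r} {q = q} (right x) refl = contradiction (v<q′ (tree-box r x)) (≤⇒≯ (m≤m+n (q + ∣ r ∣) ∣ l ∣))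

at-peak : ∀ {k} {l : T k} {r : T (suc k)} {p q i v} → ⟦ node l r ⟧ p q i v →
          i ≡ p + ∣ l ∣ → v ≡ q + ∣ r ∣ + ∣ l ∣
at-peak {l = l} (left x)   refl = contradiction (i<p′ (tree-box l x)) (<-irrefl refl)
at-peak         (top _ v≡) _    = v≡
at-peak {r = r} (right x)  refl = contradiction (p≤i (tree-box r x)) (<-irrefl refl)

tree-functional : ∀ {k} (t : T k) {p q i v w} → ⟦ t ⟧ p q i v → ⟦ t ⟧ p q i w → v ≡ w
tree-functional (node l r) (left x)       y = tree-functional l x (in-left y (i<p′ (tree-box l x)))
tree-functional (node l r) (top i≡ refl) y = sym (at-peak y i≡)
tree-functional (node l r) (right x)      y = tree-functional r x (in-right y (p≤i (tree-box r x)))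

tree-injective : ∀ {k} (t : T k) {p q i j v} → ⟦ t ⟧ p q i v → ⟦ t ⟧ p q j v → i ≡ j
tree-injective (node l r) (left x)      y with in-upper y (q≤v (tree-box l x))
... | inj₁ y′         = tree-injective l x y′
... | inj₂ (_ , refl) = contradiction (v<q′ (tree-box l x)) (<-irrefl refl)
tree-injective (node l r) (top refl v≡) y = sym (at-top y v≡)
tree-injective (node l r) (right x)     y = tree-injective r x (in-lower y (v<q′ (tree-box r x)))

tree-total : ∀ {k} (t : T k) {p q i} → p ≤ i → i < p + ∣ t ∣ → ∃[ v ] ⟦ t ⟧ p q i v
tree-total leaf {p} p≤i i< = contradiction (<-castʳ (+-identityʳ p) i<) (≤⇒≯ p≤i)
tree-total (node l r) {p} {q} {i} p≤i i< with <-cmp i (p + ∣ l ∣)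
... | tri< i<s _ _ = let v , x = tree-total l p≤i i<s in v , left x
... | tri≈ _ i≡s _ = q + ∣ r ∣ + ∣ l ∣ , top i≡s refl
... | tri> _ _ s<i = let v , x = tree-total r s<i (<-castʳ (sym (suc-+-right p ∣ l ∣ ∣ r ∣)) i<) in v , right x

tree-surjective : ∀ {k} (t : T k) {p q v} → q ≤ v → v < q + ∣ t ∣ → ∃[ i ] ⟦ t ⟧ p q i v
tree-surjective leaf {p} {q} q≤v v< = contradiction (<-castʳ (+-identityʳ q) v<) (≤⇒≯ q≤v)
tree-surjective (node l r) {p} {q} {v} q≤v v< with <-≤-connex v (q + ∣ r ∣)
... | inj₁ v<r = let i , x = tree-surjective r q≤v v<r in i , right x
... | inj₂ r≤v with <-cmp v (q + ∣ r ∣ + ∣ l ∣)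
...   | tri< v<e _ _ = let i , x = tree-surjective l r≤v v<e in i , left x
...   | tri≈ _ v≡e _ = p + ∣ l ∣ , top refl v≡e
...   | tri> _ _ e<v = contradiction e<v (≤⇒≯ (s≤s⁻¹ (<-castʳ (sym (suc-+-left q ∣ l ∣ ∣ r ∣)) v<)))

-- The third point decides. In L it forces the two earlier ones into L by position; as the maximum
-- it cannot be exceeded by the second; in R it forces the first, lower point into R by value, and
-- then the second by position.
tree-avoids-132 : ∀ {k} (t : T k) {p q i j k} → ¬ Occ (⟦ t ⟧ p q) i j k
tree-avoids-132 (node l r) (occ x y (left z) i<j j<k u<w w<v) = tree-avoids-132 l
  (occ (in-left x (<-trans i<j j<s)) (in-left y j<s) z i<j j<k u<w w<v)
  where j<s = <-trans j<k (i<p′ (tree-box l z))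
tree-avoids-132 (node l r) (occ x y (top _ refl) i<j j<k u<w w<v) = <⇒≱ w<v (value-≤-top y)
tree-avoids-132 (node l r) (occ x y (right z) i<j j<k u<w w<v) = tree-avoids-132 r
  (occ x′ (in-right y (≤-trans (p≤i (tree-box r x′)) (<⇒≤ i<j))) z i<j j<k u<w w<v)
  where x′ = in-lower x (<-trans u<w (v<q′ (tree-box r z)))

-- The first point decides. From R the sequence never leaves R, by position. From L or the maximum
-- it never enters R, by value, and without the maximum it still has k points in L.
tree-avoids-increasing : ∀ {k} (t : T k) {p q a b} → ¬ Inc (⟦ t ⟧ p q) k a b
tree-avoids-increasing leaf       (step () _ _ _)
tree-avoids-increasing (node l r) {p} {q} xs@(step x _ _ xs′) = case x of λ where
    (left y)      → upper (q≤v (tree-box l y))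
    (top _ refl)  → upper (m≤m+n (q + ∣ r ∣) ∣ l ∣)
    (right y)     → tree-avoids-increasing r (step y ≤-refl z≤n
      (Inc-lift (λ a≤i _ z → in-right z (≤-trans (p≤i (tree-box r y)) (<⇒≤ a≤i))) xs′))
  where
  upper : q + ∣ r ∣ ≤ _ → ⊥
  upper q≤v = tree-avoids-increasing l (Inc-drop
    (λ _ b≤v z → Sum.map₂ (λ { (_ , refl) _ _ → value-≤-top }) (in-upper z (≤-trans q≤v b≤v)))
    (step x ≤-refl ≤-refl xs′))

-- Equal sizes give equal maxima, and the position of the maximum gives the size of L, hence that of
-- R. The subtrees are then placed alike and can be compared.
tree-determined : ∀ {k} (t s : T k) {p q} → ∣ t ∣ ≡ ∣ s ∣ → ⟦ t ⟧ p q ⊆ ⟦ s ⟧ p q → t ≡ s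
tree-determined leaf       leaf         _  _   = refl
tree-determined (node l r) (node l′ r′) {p} {q} n≡ t⊆s = cong₂ node
  (tree-determined l l′ l≡ λ {i} {v} x → subst (λ m → ⟦ l′ ⟧ p (q + m) i v) (sym r≡)
    (in-left (t⊆s (left x)) (subst (λ m → i < p + m) l≡ (i<p′ (tree-box l x)))))
  (tree-determined r r′ r≡ λ {i} {v} x → subst (λ m → ⟦ r′ ⟧ (suc (p + m)) q i v) (sym l≡)
    (in-right (t⊆s (right x)) (subst (λ m → suc (p + m) ≤ i) l≡ (p≤i (tree-box r x)))))
  where
  top≡ : q + ∣ r ∣ + ∣ l ∣ ≡ q + ∣ r′ ∣ + ∣ l′ ∣
  top≡ = suc-injective (trans (suc-+-left q ∣ l ∣ ∣ r ∣) (trans (cong (q +_) n≡) (sym (suc-+-left q ∣ l′ ∣ ∣ r′ ∣))))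
  l≡ : ∣ l ∣ ≡ ∣ l′ ∣
  l≡ = +-cancelˡ-≡ p _ _ (at-top (t⊆s (top refl refl)) top≡)
  r≡ : ∣ r ∣ ≡ ∣ r′ ∣
  r≡ = +-cancelˡ-≡ ∣ l ∣ _ _ (trans (suc-injective n≡) (cong (_+ ∣ r′ ∣) (sym l≡)))

-- The points of L n, with L placed at (p, h) and n at position s.

data Upper {k} (l : T k) (p s h : ℕ) : Points where
  body : ∀ {i v} → ⟦ l ⟧ p h i v → Upper l p s h i v
  peak : ∀ {i v} → i ≡ s → v ≡ h + ∣ l ∣ → Upper l p s h i v

-- Reflection in the diagonal turns the points of `L n` into those of `L⁻¹ j`, with j the position
-- `s` of n.
data Hook {k} (l : T k) (p s h : ℕ) : Points where
  up   : ∀ {i v} → Upper l p s h i v → Hook l p s h i v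
  down : ∀ {i v} → Upper l p s h v i → Hook l p s h i v

-- The points of the involution t placed at the diagonal square [p, p + ∥ t ∥)².

data ⟪_⟫ : ∀ {k} → JT k → ℕ → Points where
  fix-inner  : ∀ {k} {t : JT k} {p i v} → ⟪ t ⟫ p i v → ⟪ fix t ⟫ p i v
  fix-last   : ∀ {k} {t : JT k} {p i v} → i ≡ p + ∥ t ∥ → v ≡ p + ∥ t ∥ → ⟪ fix t ⟫ p i v
  wrap-inner : ∀ {k} {l : T k} {t p i v} → ⟪ t ⟫ (suc (p + ∣ l ∣)) i v → ⟪ wrap l t ⟫ p i v
  wrap-outer : ∀ {k} {l : T k} {t p i v} →
               Hook l p (p + ∣ l ∣) (suc (p + ∣ l ∣) + ∥ t ∥) i v → ⟪ wrap l t ⟫ p i v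
  base-inner : ∀ {k} {l : T (2 + k)} {p i v} → i ≡ p + ∣ l ∣ → v ≡ p + ∣ l ∣ → ⟪ base l ⟫ p i v
  base-outer : ∀ {k} {l : T (2 + k)} {p i v} →
               Hook l p (suc (p + ∣ l ∣)) (suc (suc (p + ∣ l ∣))) i v → ⟪ base l ⟫ p i v

-- Only an inequality is fixed for `s`, because n follows L directly in `wrap` but stands one
-- position later in `base`, where c comes between.
module UpperProperties {k} (l : T k) {p s h : ℕ} (p+l≤s : p + ∣ l ∣ ≤ s) where

  upper-box : Upper l p s h ⊆ Box p (suc s) h (suc (h + ∣ l ∣))
  upper-box (body x) with box a b c d ← tree-box l x = box a (≤-trans b (m≤n⇒m≤1+n p+l≤s)) c (m≤n⇒m≤1+n d)
  upper-box (peak refl refl) = box (≤-trans (m≤m+n p ∣ l ∣) p+l≤s) ≤-refl (m≤m+n h ∣ l ∣) ≤-refl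

  in-body : ∀ {i v} → Upper l p s h i v → i < s → ⟦ l ⟧ p h i v
  in-body (body x)      i<s = x
  in-body (peak refl _) i<s = contradiction i<s (<-irrefl refl)

  in-bodyᵛ : ∀ {i v} → Upper l p s h i v → v < h + ∣ l ∣ → ⟦ l ⟧ p h i v
  in-bodyᵛ (body x)      v< = x
  in-bodyᵛ (peak _ refl) v< = contradiction v< (<-irrefl refl)

  body-< : ∀ {i v} → ⟦ l ⟧ p h i v → i < s
  body-< x = <-≤-trans (i<p′ (tree-box l x)) p+l≤s

  at-s : ∀ {i v} → Upper l p s h i v → i ≡ s → v ≡ h + ∣ l ∣
  at-s (body x)    refl = contradiction (body-< x) (<-irrefl refl)
  at-s (peak _ v≡) _    = v≡

  at-peakᵛ : ∀ {i v} → Upper l p s h i v → v ≡ h + ∣ l ∣ → i ≡ s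
  at-peakᵛ (body x)    refl = contradiction (v<q′ (tree-box l x)) (<-irrefl refl)
  at-peakᵛ (peak i≡ _) _    = i≡

  upper-functional : ∀ {i v w} → Upper l p s h i v → Upper l p s h i w → v ≡ w
  upper-functional (body x)        y = tree-functional l x (in-body y (body-< x))
  upper-functional (peak i≡ refl) y = sym (at-s y i≡)

  upper-injective : ∀ {i j v} → Upper l p s h i v → Upper l p s h j v → i ≡ j
  upper-injective (body x)        y = tree-injective l x (in-bodyᵛ y (v<q′ (tree-box l x)))
  upper-injective (peak refl v≡) y = sym (at-peakᵛ y v≡)

  upper-surjective : ∀ {v} → h ≤ v → v ≤ h + ∣ l ∣ → ∃[ i ] Upper l p s h i v
  upper-surjective {v} h≤v v≤e with m≤n⇒m<n∨m≡n v≤e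
  ... | inj₁ v<e = let i , x = tree-surjective l h≤v v<e in i , body x
  ... | inj₂ v≡e = s , peak refl v≡e

  upper-avoids-132 : ∀ {i j k} → ¬ Occ (Upper l p s h) i j k
  upper-avoids-132 (occ x y (body z) i<j j<k u<w w<v) =
    tree-avoids-132 l (occ (in-body x (<-trans i<j j<s)) (in-body y j<s) z i<j j<k u<w w<v)
    where j<s = <-trans j<k (body-< z)
  upper-avoids-132 (occ x y (peak _ refl) i<j j<k u<w w<v) =
    contradiction (v<q′ (upper-box y)) (<⇒≱ (s≤s w<v))

  -- The pattern 132 is its own inverse; transposition merely exchanges the second and third point
  -- of an occurrence.
  upper-avoids-132ᵀ : ∀ {i j k} → ¬ Occ (Upper l p s h ᵀ) i j k
  upper-avoids-132ᵀ (occ x y z i<j j<k u<w w<v) = upper-avoids-132 (occ x z y u<w w<v i<j j<k)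

  upper-avoids-increasing : ∀ {a b} → ¬ Inc (Upper l p s h) (suc k) a b
  upper-avoids-increasing xs = tree-avoids-increasing l (Inc-drop
    (λ { _ _ (body x) → inj₁ x ; _ _ (peak _ refl) → inj₂ λ _ _ y → s≤s⁻¹ (v<q′ (upper-box y)) }) xs)

  upper-avoids-increasingᵀ : ∀ {a b} → ¬ Inc (Upper l p s h ᵀ) (suc k) a b
  upper-avoids-increasingᵀ xs = upper-avoids-increasing (Inc-ᵀ xs)

-- The point sets of codes: involutions with one 132 and no 12...k

hook-sym : ∀ {k} {l : T k} {p s h} → Hook l p s h ⊆ Hook l p s h ᵀ
hook-sym (up x)   = down x
hook-sym (down x) = up x

involution-sym : ∀ {k} (t : JT k) {p} → ⟪ t ⟫ p ⊆ ⟪ t ⟫ p ᵀ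
involution-sym (fix t)    (fix-inner x)    = fix-inner (involution-sym t x)
involution-sym (fix t)    (fix-last i≡ v≡) = fix-last v≡ i≡
involution-sym (wrap l t) (wrap-inner x)   = wrap-inner (involution-sym t x)
involution-sym (wrap l t) (wrap-outer x)   = wrap-outer (hook-sym x)
involution-sym (base l)   (base-inner i≡ v≡) = base-inner v≡ i≡
involution-sym (base l)   (base-outer x)   = base-outer (hook-sym x)

record Square (p p′ i v : ℕ) : Set where
  constructor square
  field
    p≤i  : p ≤ i
    i<p′ : i < p′
    p≤v  : p ≤ v
    v<p′ : v < p′

wrap-end : ∀ p a m → suc (suc (p + a) + m + a) ≡ p + (2 + (a + a + m))
wrap-end = ℕ-solve-∀

base-end : ∀ p a → suc (suc (suc (p + a)) + a) ≡ p + (3 + (a + a))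
base-end = ℕ-solve-∀

module WrapBounds {k} (l : T k) (t : JT (suc k)) (p : ℕ) where
  s h e : ℕ
  s = p + ∣ l ∣
  h = suc s + ∥ t ∥
  e = h + ∣ l ∣
  s<h : s < h
  s<h = s≤s (m≤m+n s ∥ t ∥)
  end : suc e ≡ p + ∥ wrap l t ∥
  end = wrap-end p ∣ l ∣ ∥ t ∥
  p≤s : p ≤ s
  p≤s = m≤m+n p ∣ l ∣
  h≤e : h ≤ e
  h≤e = m≤m+n h ∣ l ∣
  open UpperProperties l {p} {s} {h} ≤-refl public

module BaseBounds {k} (l : T (2 + k)) (p : ℕ) where
  c s h e : ℕ
  c = p + ∣ l ∣
  s = suc c
  h = suc s
  e = h + ∣ l ∣
  end : suc e ≡ p + ∥ base l ∥
  end = base-end p ∣ l ∣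
  p≤c : p ≤ c
  p≤c = m≤m+n p ∣ l ∣
  h≤e : h ≤ e
  h≤e = m≤m+n h ∣ l ∣
  open UpperProperties l {p} {s} {h} (n≤1+n c) public

box⇒square : ∀ {p s h e} → s < h → h ≤ e → Box p (suc s) h (suc e) ⊆ Square p (suc e)
box⇒square s<h h≤e (box a b c d) =
  square a (<-≤-trans b (≤-trans s<h (m≤n⇒m≤1+n h≤e))) (≤-trans (≤-trans a (s≤s⁻¹ b)) (≤-trans (<⇒≤ s<h) c)) d

square-sym : ∀ {p p′} → Square p p′ ⊆ Square p p′ ᵀ
square-sym (square a b c d) = square c d a b

involution-box : ∀ {k} (t : JT k) {p} → ⟪ t ⟫ p ⊆ Square p (p + ∥ t ∥)
involution-box (fix t) {p} (fix-inner x) with square a b c d ← involution-box t x =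
  square a (<-≤-trans b (+-monoʳ-≤ p (n≤1+n _))) c (<-≤-trans d (+-monoʳ-≤ p (n≤1+n _)))
involution-box (fix t) {p} (fix-last refl refl) = square (m≤m+n p _) last< (m≤m+n p _) last<
  where last< = +-monoʳ-< p (n<1+n ∥ t ∥)
involution-box (wrap l t) {p} (wrap-inner x) with square a b c d ← involution-box t x =
  square (≤-trans p≤s (<⇒≤ a)) (<-castʳ end (<-≤-trans b (m≤n⇒m≤1+n h≤e)))
         (≤-trans p≤s (<⇒≤ c)) (<-castʳ end (<-≤-trans d (m≤n⇒m≤1+n h≤e)))
  where open WrapBounds l t p
involution-box (wrap l t) {p} {i} {v} (wrap-outer x) = subst (λ n → Square p n i v) end (case x of λ where
    (up y)   → box⇒square s<h h≤e (upper-box y)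
    (down y) → square-sym (box⇒square s<h h≤e (upper-box y)))
  where open WrapBounds l t p
involution-box (base l) {p} (base-inner refl refl) = square p≤c c<end p≤c c<end
  where
  open BaseBounds l p
  c<end = <-castʳ end (≤-trans (n≤1+n s) (m≤n⇒m≤1+n h≤e))
involution-box (base l) {p} {i} {v} (base-outer x) = subst (λ n → Square p n i v) end (case x of λ where
    (up y)   → box⇒square (n<1+n s) h≤e (upper-box y)
    (down y) → square-sym (box⇒square (n<1+n s) h≤e (upper-box y)))
  where open BaseBounds l p

fix-in-inner : ∀ {k} {t : JT k} {p i v} → ⟪ fix t ⟫ p i v → i < p + ∥ t ∥ → ⟪ t ⟫ p i v
fix-in-inner (fix-inner x)     _  = x
fix-in-inner (fix-last refl _) i< = contradiction i< (<-irrefl refl)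

fix-at-last : ∀ {k} {t : JT k} {p i v} → ⟪ fix t ⟫ p i v → i ≡ p + ∥ t ∥ → v ≡ p + ∥ t ∥
fix-at-last {t = t} (fix-inner x)  refl = contradiction (Square.i<p′ (involution-box t x)) (<-irrefl refl)
fix-at-last         (fix-last _ v≡) _    = v≡

-- The cuts at `s` and `h` separate `L n`, M and `L⁻¹ j`, both by position and, by symmetry, by
-- value, so one coordinate of a point often tells its block.
module WrapProperties {k} (l : T k) (t : JT (suc k)) {p : ℕ} where
  open WrapBounds l t p public

  at-upper : ∀ {i v} → ⟪ wrap l t ⟫ p i v → i ≤ s → Upper l p s h i v
  at-upper (wrap-inner x)        i≤s = contradiction (Square.p≤i (involution-box t x)) (≤⇒≯ i≤s)
  at-upper (wrap-outer (up x))   _   = x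
  at-upper (wrap-outer (down x)) i≤s = contradiction (q≤v (upper-box x)) (<⇒≱ (≤-<-trans i≤s s<h))

  at-lower : ∀ {i v} → ⟪ wrap l t ⟫ p i v → h ≤ i → Upper l p s h v i
  at-lower (wrap-inner x)        h≤i = contradiction (Square.i<p′ (involution-box t x)) (≤⇒≯ h≤i)
  at-lower (wrap-outer (up x))   h≤i = contradiction (i<p′ (upper-box x)) (≤⇒≯ (≤-trans s<h h≤i))
  at-lower (wrap-outer (down x)) _   = x

  at-upperᵛ : ∀ {i v} → ⟪ wrap l t ⟫ p i v → h ≤ v → Upper l p s h i v
  at-upperᵛ x = at-lower (involution-sym (wrap l t) x)

  at-inner : ∀ {i v} → ⟪ wrap l t ⟫ p i v → s < i → s < v → ⟪ t ⟫ (suc s) i v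
  at-inner (wrap-inner x)        _   _   = x
  at-inner (wrap-outer (up x))   s<i _   = contradiction (i<p′ (upper-box x)) (≤⇒≯ s<i)
  at-inner (wrap-outer (down x)) _   s<v = contradiction (i<p′ (upper-box x)) (≤⇒≯ s<v)

  at-innerⁱ : ∀ {i v} → ⟪ wrap l t ⟫ p i v → s < i → i < h → ⟪ t ⟫ (suc s) i v
  at-innerⁱ (wrap-inner x)        _   _   = x
  at-innerⁱ (wrap-outer (up x))   s<i _   = contradiction (i<p′ (upper-box x)) (≤⇒≯ s<i)
  at-innerⁱ (wrap-outer (down x)) _   i<h = contradiction (q≤v (upper-box x)) (<⇒≱ i<h)

  wrap-at-max : ∀ {i v} → ⟪ wrap l t ⟫ p i v → v ≡ e → i ≡ s
  wrap-at-max x refl = at-peakᵛ (at-upperᵛ x h≤e) refl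

module BaseProperties {k} (l : T (2 + k)) {p : ℕ} where
  open BaseBounds l p public

  at-lower : ∀ {i v} → ⟪ base l ⟫ p i v → h ≤ i → Upper l p s h v i
  at-lower (base-inner refl _)   h≤i = contradiction h≤i (<⇒≱ (m<n⇒m<1+n (n<1+n c)))
  at-lower (base-outer (up x))   h≤i = contradiction (i<p′ (upper-box x)) (≤⇒≯ h≤i)
  at-lower (base-outer (down x)) _   = x

  at-upperᵛ : ∀ {i v} → ⟪ base l ⟫ p i v → h ≤ v → Upper l p s h i v
  at-upperᵛ x = at-lower (involution-sym (base l) x)

  at-centre : ∀ {i v} → ⟪ base l ⟫ p i v → i ≡ c → v ≡ c
  at-centre (base-inner _ v≡)                _    = v≡
  at-centre (base-outer (up (body x)))       refl = contradiction (i<p′ (tree-box l x)) (<-irrefl refl)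
  at-centre (base-outer (up (peak c≡s _)))   refl = contradiction c≡s (<⇒≢ (n<1+n c))
  at-centre (base-outer (down x))            refl = contradiction (q≤v (upper-box x)) (<⇒≱ (m<n⇒m<1+n (n<1+n c)))

  at-upper : ∀ {i v} → ⟪ base l ⟫ p i v → i ≤ s → i ≢ c → Upper l p s h i v
  at-upper (base-inner refl _)   _   i≢c = contradiction refl i≢c
  at-upper (base-outer (up x))   _   _   = x
  at-upper (base-outer (down x)) i≤s _   = contradiction (q≤v (upper-box x)) (<⇒≱ (s≤s i≤s))

  -- These two points form a descent. So (c, c) begins exactly one occurrence of 132 and no
  -- increasing sequence of three points.
  beyond-centre : ∀ {i v} → ⟪ base l ⟫ p i v → c < i → c < v → (i ≡ s × v ≡ e) ⊎ (i ≡ e × v ≡ s)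
  beyond-centre (base-inner refl _)                c<i _   = contradiction c<i (<-irrefl refl)
  beyond-centre (base-outer (up (body x)))         c<i _   = contradiction (i<p′ (tree-box l x)) (<⇒≯ c<i)
  beyond-centre (base-outer (up (peak i≡ v≡)))     _   _   = inj₁ (i≡ , v≡)
  beyond-centre (base-outer (down (body x)))       _   c<v = contradiction (i<p′ (tree-box l x)) (<⇒≯ c<v)
  beyond-centre (base-outer (down (peak v≡ i≡)))   _   _   = inj₂ (i≡ , v≡)

  base-at-max : ∀ {i v} → ⟪ base l ⟫ p i v → v ≡ e → i ≡ s
  base-at-max x refl = at-peakᵛ (at-upperᵛ x h≤e) refl

involution-functional : ∀ {k} (t : JT k) {p i v w} → ⟪ t ⟫ p i v → ⟪ t ⟫ p i w → v ≡ w
involution-functional (fix t) (fix-inner x)     y = involution-functional t x (fix-in-inner y (Square.i<p′ (involution-box t x)))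
involution-functional (fix t) (fix-last i≡ refl) y = sym (fix-at-last y i≡)
involution-functional (wrap l t) (wrap-inner x) y with square a b _ _ ← involution-box t x =
  involution-functional t x (WrapProperties.at-innerⁱ l t y a b)
involution-functional (wrap l t) (wrap-outer (up x)) y = upper-functional x (at-upper y (s≤s⁻¹ (i<p′ (upper-box x))))
  where open WrapProperties l t
involution-functional (wrap l t) (wrap-outer (down x)) y = upper-injective x (at-lower y (q≤v (upper-box x)))
  where open WrapProperties l t
involution-functional (base l) (base-inner i≡ refl) y = sym (BaseProperties.at-centre l y i≡)
involution-functional (base l) (base-outer (up (body x))) y =
  upper-functional (body x) (at-upper y (<⇒≤ (body-< x)) (<⇒≢ (i<p′ (tree-box l x))))
  where open BaseProperties l
involution-functional (base l) (base-outer (up (peak refl refl))) y =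
  upper-functional (peak refl refl) (at-upper y ≤-refl (<⇒≢ (n<1+n _) ∘ sym))
  where open BaseProperties l
involution-functional (base l) (base-outer (down x)) y = upper-injective x (at-lower y (q≤v (upper-box x)))
  where open BaseProperties l

involution-total : ∀ {k} (t : JT k) {p i} → p ≤ i → i < p + ∥ t ∥ → ∃[ v ] ⟪ t ⟫ p i v
involution-total (fix t) {p} {i} p≤i i< with m≤n⇒m<n∨m≡n (s≤s⁻¹ (<-castʳ (+-suc p ∥ t ∥) i<))
... | inj₁ i<e = let v , x = involution-total t p≤i i<e in v , fix-inner x
... | inj₂ i≡e = p + ∥ t ∥ , fix-last i≡e refl
involution-total (wrap l t) {p} {i} p≤i i< with <-cmp i s
  where open WrapBounds l t p
... | tri< i<s _ _ = let v , x = tree-total l p≤i i<s in v , wrap-outer (up (body x))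
... | tri≈ _ i≡s _ = _ , wrap-outer (up (peak i≡s refl))
... | tri> _ _ s<i with <-≤-connex i h
  where open WrapBounds l t p
...   | inj₁ i<h = let v , x = involution-total t s<i i<h in v , wrap-inner x
...   | inj₂ h≤i = let v , x = upper-surjective h≤i (s≤s⁻¹ (<-castʳ (sym end) i<)) in v , wrap-outer (down x)
  where open WrapBounds l t p
involution-total (base l) {p} {i} p≤i i< with <-cmp i c
  where open BaseBounds l p
... | tri< i<c _ _ = let v , x = tree-total l p≤i i<c in v , base-outer (up (body x))
... | tri≈ _ i≡c _ = _ , base-inner i≡c refl
... | tri> _ _ c<i with m≤n⇒m<n∨m≡n c<i
...   | inj₂ s≡i = _ , base-outer (up (peak (sym s≡i) refl))
...   | inj₁ h≤i = let v , x = upper-surjective h≤i (s≤s⁻¹ (<-castʳ (sym end) i<)) in v , base-outer (down x)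
  where open BaseBounds l p

-- The last fixed point of `fix` is both last and highest, which no point of a 132 can be. Otherwise
-- the first point decides: from `L n` the occurrence stays there because the others are higher,
-- from `L⁻¹ j` because they are further right, and neither contains 132. Only M remains for `wrap`,
-- and only the centre for `base`.
involution-once : ∀ {k} (t : JT k) {p} → Once (⟪ t ⟫ p)
involution-once (fix t) {p} with once o uniq ← involution-once t = once (Occ-mono fix-inner o) (uniq ∘ restrict)
  where
  e = p + ∥ t ∥
  bound : ∀ {i v} → ⟪ fix t ⟫ p i v → i ≤ e
  bound x = s≤s⁻¹ (<-castʳ (+-suc p ∥ t ∥) (Square.i<p′ (involution-box (fix t) x)))
  restrict : ∀ {i j k} → Occ (⟪ fix t ⟫ p) i j k → Occ (⟪ t ⟫ p) i j k
  restrict (occ x y z i<j j<k u<w w<v) = occ (fix-in-inner x (<-trans i<j j<e)) (fix-in-inner y j<e)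
    (fix-in-innerᵛ z (<-≤-trans w<v (bound (involution-sym (fix t) y)))) i<j j<k u<w w<v
    where
    j<e = <-≤-trans j<k (bound z)
    fix-in-innerᵛ : ∀ {i v} → ⟪ fix t ⟫ p i v → v < e → ⟪ t ⟫ p i v
    fix-in-innerᵛ x v< = involution-sym t (fix-in-inner (involution-sym (fix t) x) v<)
involution-once (wrap l t) {p} with once o uniq ← involution-once t = once (Occ-mono wrap-inner o) (uniq ∘ restrict)
  where
  open WrapProperties l t {p}
  restrict : ∀ {i j k} → Occ (⟪ wrap l t ⟫ p) i j k → Occ (⟪ t ⟫ (suc s)) i j k
  restrict (occ (wrap-inner x) y z i<j j<k u<w w<v) with square a _ b _ ← involution-box t x =
    occ x (at-inner y (<-trans a i<j) (<-trans b (<-trans u<w w<v)))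
          (at-inner z (<-trans a (<-trans i<j j<k)) (<-trans b u<w)) i<j j<k u<w w<v
  restrict (occ (wrap-outer (up x)) y z i<j j<k u<w w<v) =
    contradiction (occ x (at-upperᵛ y (≤-trans h≤w (<⇒≤ w<v))) (at-upperᵛ z h≤w) i<j j<k u<w w<v) upper-avoids-132
    where h≤w = ≤-trans (q≤v (upper-box x)) (<⇒≤ u<w)
  restrict (occ (wrap-outer (down x)) y z i<j j<k u<w w<v) =
    contradiction (occ x (at-lower y h≤j) (at-lower z (≤-trans h≤j (<⇒≤ j<k))) i<j j<k u<w w<v) upper-avoids-132ᵀ
    where h≤j = ≤-trans (q≤v (upper-box x)) (<⇒≤ i<j)
involution-once (base l) {p} = once
  (occ (base-inner refl refl) (base-outer (up (peak refl refl))) (base-outer (down (peak refl refl)))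
       (n<1+n c) h≤e (n<1+n c) h≤e)
  uniq
  where
  open BaseProperties l {p}
  uniq : ∀ {i j k} → Occ (⟪ base l ⟫ p) i j k → i ≡ c × j ≡ s × k ≡ e
  uniq (occ (base-inner refl refl) y z i<j j<k u<w w<v)
    with beyond-centre y i<j (<-trans u<w w<v) | beyond-centre z (<-trans i<j j<k) u<w
  ... | inj₁ (j≡ , _) | inj₂ (k≡ , _)           = refl , j≡ , k≡
  ... | inj₁ (refl , _) | inj₁ (refl , _)       = contradiction j<k (<-irrefl refl)
  ... | inj₂ (refl , refl) | inj₁ (refl , refl) = contradiction h≤e (<⇒≯ j<k)
  ... | inj₂ (refl , _) | inj₂ (refl , _)       = contradiction j<k (<-irrefl refl)
  uniq (occ (base-outer (up x)) y z i<j j<k u<w w<v) =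
    contradiction (occ x (at-upperᵛ y (≤-trans h≤w (<⇒≤ w<v))) (at-upperᵛ z h≤w) i<j j<k u<w w<v) upper-avoids-132
    where h≤w = ≤-trans (q≤v (upper-box x)) (<⇒≤ u<w)
  uniq (occ (base-outer (down x)) y z i<j j<k u<w w<v) =
    contradiction (occ x (at-lower y h≤j) (at-lower z (≤-trans h≤j (<⇒≤ j<k))) i<j j<k u<w w<v) upper-avoids-132ᵀ
    where h≤j = ≤-trans (q≤v (upper-box x)) (<⇒≤ i<j)

-- For `fix` the last point is dropped. Otherwise the first point confines the sequence to `L n`, to
-- its mirror image or to M; from the centre of `base` at most two points are possible.
involution-avoids-increasing : ∀ {k} (t : JT k) {p a b} → ¬ Inc (⟪ t ⟫ p) k a b
involution-avoids-increasing (fix t) {p} xs = involution-avoids-increasing t (Inc-drop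
  (λ { _ _ (fix-inner x)   → inj₁ x
     ; _ _ (fix-last _ refl) → inj₂ λ _ _ y → s≤s⁻¹ (<-castʳ (+-suc p ∥ t ∥) (Square.v<p′ (involution-box (fix t) y))) }) xs)
involution-avoids-increasing (wrap l t) {p} (step x a≤i b≤v xs) = case x of λ where
    (wrap-inner y) → let square c _ d _ = involution-box t y in
      involution-avoids-increasing t (step y ≤-refl ≤-refl
        (Inc-lift (λ r q z → at-inner z (≤-trans c (<⇒≤ r)) (≤-trans d (<⇒≤ q))) xs))
    (wrap-outer (up y)) → upper-avoids-increasing (step y ≤-refl ≤-refl
        (Inc-lift (λ _ q z → at-upperᵛ z (≤-trans (q≤v (upper-box y)) (<⇒≤ q))) xs))
    (wrap-outer (down y)) → upper-avoids-increasingᵀ (step y ≤-refl ≤-refl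
        (Inc-lift (λ r _ z → at-lower z (≤-trans (q≤v (upper-box y)) (<⇒≤ r))) xs))
  where open WrapProperties l t {p}
involution-avoids-increasing (base l) {p} (step x a≤i b≤v xs) = case x of λ where
    (base-inner refl refl) → centre xs
    (base-outer (up y)) → upper-avoids-increasing (step y ≤-refl ≤-refl
        (Inc-lift (λ _ q z → at-upperᵛ z (≤-trans (q≤v (upper-box y)) (<⇒≤ q))) xs))
    (base-outer (down y)) → upper-avoids-increasingᵀ (step y ≤-refl ≤-refl
        (Inc-lift (λ r _ z → at-lower z (≤-trans (q≤v (upper-box y)) (<⇒≤ r))) xs))
  where
  open BaseProperties l {p}
  centre : ∀ {n} → ¬ Inc (⟪ base l ⟫ p) (2 + n) (suc c) (suc c)
  centre (step y c<i c<v (step z i<j v<w _))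
    with beyond-centre y c<i c<v | beyond-centre z (<-trans c<i i<j) (<-trans c<v v<w)
  ... | inj₁ (_ , refl)    | inj₁ (_ , refl)    = <-irrefl refl v<w
  ... | inj₁ (_ , refl)    | inj₂ (_ , refl)    = <⇒≯ h≤e v<w
  ... | inj₂ (refl , _)    | inj₁ (refl , _)    = <⇒≯ h≤e i<j
  ... | inj₂ (refl , _)    | inj₂ (refl , _)    = <-irrefl refl i<j

-- Recovering a code from its points

≤-castˡ : ∀ {i m n} → m ≡ n → m ≤ i → n ≤ i
≤-castˡ refl m≤i = m≤i

double-injective : ∀ a b {m n} → a ≡ b → a + a + m ≡ b + b + n → m ≡ n
double-injective a .a refl p = +-cancelˡ-≡ (a + a) _ _ p

-- Equal sizes put the maximum of both at the same position, so the fixed point c of `base` stands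
-- just before the `s` of `wrap`. But the values up to that position are at least `h`, which is
-- larger than c.
wrap≢base : ∀ {k} (l : T (2 + k)) t (l′ : T (2 + k)) {p} → ∥ wrap l t ∥ ≡ ∥ base l′ ∥ →
            ⟪ wrap l t ⟫ p ⊆ ⟪ base l′ ⟫ p → ¬ ⟪ base l′ ⟫ p ⊆ ⟪ wrap l t ⟫ p
wrap≢base l t l′ {p} n≡ w⊆b b⊆w = <⇒≱ (<-trans c<s W.s<h) (q≤v (W.upper-box (W.at-upper (b⊆w (base-inner refl refl)) (<⇒≤ c<s))))
  where
  module W = WrapProperties l t {p}
  module B = BaseProperties l′ {p}
  e≡ : W.e ≡ B.e
  e≡ = suc-injective (trans W.end (trans (cong (p +_) n≡) (sym B.end)))
  c<s : B.c < W.s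
  c<s = ≤-reflexive (sym (B.base-at-max (w⊆b (wrap-outer (up (peak refl refl)))) e≡))

-- The position of the largest value is the last one only for `fix`; for `wrap` and `base` it gives
-- the size of L and thereby the place of every block.
involution-determined : ∀ {k} (t s : JT k) {p} → ∥ t ∥ ≡ ∥ s ∥ →
                        ⟪ t ⟫ p ⊆ ⟪ s ⟫ p → ⟪ s ⟫ p ⊆ ⟪ t ⟫ p → t ≡ s
involution-determined (fix t) (fix s) {p} n≡ t⊆s s⊆t = cong fix (involution-determined t s m≡
  (λ {i} x → fix-in-inner (t⊆s (fix-inner x)) (subst (λ m → i < p + m) m≡ (Square.i<p′ (involution-box t x))))
  (λ {i} x → fix-in-inner (s⊆t (fix-inner x)) (subst (λ m → i < p + m) (sym m≡) (Square.i<p′ (involution-box s x)))))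
  where m≡ = suc-injective n≡
involution-determined (fix t) (wrap l s) {p} n≡ t⊆s s⊆t =
  contradiction (trans (sym e≡) (wrap-at-max (t⊆s (fix-last refl refl)) e≡)) (>⇒≢ (<-≤-trans s<h h≤e))
  where
  open WrapProperties l s {p} hiding (s)
  e≡ : p + ∥ t ∥ ≡ e
  e≡ = suc-injective (trans (sym (+-suc p ∥ t ∥)) (trans (cong (p +_) n≡) (sym end)))
involution-determined (wrap l t) (fix s) {p} n≡ t⊆s s⊆t =
  contradiction (trans (sym e≡) (wrap-at-max (s⊆t (fix-last refl refl)) e≡)) (>⇒≢ (<-≤-trans s<h h≤e))
  where
  open WrapProperties l t {p} hiding (s)
  e≡ : p + ∥ s ∥ ≡ e
  e≡ = suc-injective (trans (sym (+-suc p ∥ s ∥)) (trans (cong (p +_) (sym n≡)) (sym end)))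
involution-determined (fix t) (base l) {p} n≡ t⊆s s⊆t =
  contradiction (trans (sym e≡) (base-at-max (t⊆s (fix-last refl refl)) e≡)) (>⇒≢ h≤e)
  where
  open BaseProperties l {p}
  e≡ : p + ∥ t ∥ ≡ e
  e≡ = suc-injective (trans (sym (+-suc p ∥ t ∥)) (trans (cong (p +_) n≡) (sym end)))
involution-determined (base l) (fix t) {p} n≡ t⊆s s⊆t =
  contradiction (trans (sym e≡) (base-at-max (s⊆t (fix-last refl refl)) e≡)) (>⇒≢ h≤e)
  where
  open BaseProperties l {p}
  e≡ : p + ∥ t ∥ ≡ e
  e≡ = suc-injective (trans (sym (+-suc p ∥ t ∥)) (trans (cong (p +_) (sym n≡)) (sym end)))
involution-determined (wrap l t) (base l′) n≡ t⊆s s⊆t = ⊥-elim (wrap≢base l t l′ n≡ t⊆s s⊆t)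
involution-determined (base l) (wrap l′ s) n≡ t⊆s s⊆t = ⊥-elim (wrap≢base l′ s l (sym n≡) s⊆t t⊆s)
involution-determined (wrap l t) (wrap l′ s) {p} n≡ t⊆s s⊆t with +-cancelˡ-≡ p _ _ s≡
  where
  module V = WrapProperties l t {p}
  module W = WrapProperties l′ s {p}
  e≡ : V.e ≡ W.e
  e≡ = suc-injective (trans V.end (trans (cong (p +_) n≡) (sym W.end)))
  s≡ : V.s ≡ W.s
  s≡ = W.wrap-at-max (t⊆s (wrap-outer (up (peak refl refl)))) e≡
... | l≡ with m≡ ← double-injective ∣ l ∣ ∣ l′ ∣ l≡ (suc-injective (suc-injective n≡))
  with tree-determined l l′ {p} l≡ (λ {i} {v} x →
    subst (λ q → ⟦ l′ ⟧ p q i v) (sym (cong₂ (λ a m → suc (p + a) + m) l≡ m≡))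
      (let open WrapProperties l′ s {p}
           i<s = <-castʳ (cong (p +_) l≡) (i<p′ (tree-box l x))
       in in-body (at-upper (t⊆s (wrap-outer (up (body x)))) (<⇒≤ i<s)) i<s))
... | refl = cong (wrap l) (involution-determined t s m≡
    (λ x → let square a _ b _ = involution-box t x in WrapProperties.at-inner l s (t⊆s (wrap-inner x)) a b)
    (λ x → let square a _ b _ = involution-box s x in WrapProperties.at-inner l t (s⊆t (wrap-inner x)) a b))
involution-determined (base l) (base l′) {p} n≡ t⊆s s⊆t = cong base (tree-determined l l′ {p} l≡ λ {i} {v} x →
    let i<c = <-castʳ (cong (p +_) l≡) (i<p′ (tree-box l x)) in
    subst (λ a → ⟦ l′ ⟧ p (suc (suc (p + a))) i v) (sym l≡)
      (B.in-body (B.at-upper (t⊆s (base-outer (up (body x)))) (m≤n⇒m≤1+n (<⇒≤ i<c)) (<⇒≢ i<c)) (m<n⇒m<1+n i<c)))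
  where
  module A = BaseProperties l {p}
  module B = BaseProperties l′ {p}
  e≡ : A.e ≡ B.e
  e≡ = suc-injective (trans A.end (trans (cong (p +_) n≡) (sym B.end)))
  l≡ : ∣ l ∣ ≡ ∣ l′ ∣
  l≡ = +-cancelˡ-≡ p _ _ (suc-injective (B.base-at-max (t⊆s (base-outer (up (peak refl refl)))) e≡))

wrap-size : ∀ l m → 2 + (l + l + m) ≡ 1 + (l + suc (l + m))
wrap-size = ℕ-solve-∀

wrap-last : ∀ p l m → p + (l + suc (l + m)) ≡ suc (p + l) + m + l
wrap-last = ℕ-solve-∀

x+[y+z]≡x+z+y : ∀ x y z → x + (y + z) ≡ x + z + y
x+[y+z]≡x+z+y = ℕ-solve-∀

x+[y+z]≡y+[x+z] : ∀ x y z → x + (y + z) ≡ y + (x + z)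
x+[y+z]≡y+[x+z] = ℕ-solve-∀

-- Decomposing an involution

InWindow : ℕ → ℕ → ℕ → Set
InWindow p n i = p ≤ i × i < p + n

-- Pigeonhole principle. It turns order relations between whole blocks into exact bounds on their
-- values.
window-injection : ∀ {f : ℕ → ℕ} → (∀ {i j} → f i ≡ f j → i ≡ j) →
                   ∀ {p n a b} → (∀ {i} → InWindow p n i → a ≤ f i × f i < b) → n ≤ b ∸ a
window-injection {f} inj {p} {n} {a} {b} maps = Fin.injective⇒≤ {f = g} g-injective
  where
  in-window : ∀ (x : Fin n) → InWindow p n (p + toℕ x)
  in-window x = m≤m+n p _ , +-monoʳ-< p (Fin.toℕ<n x)
  g< : ∀ x → f (p + toℕ x) ∸ a < b ∸ a
  g< x = let a≤ , <b = maps (in-window x) in ∸-monoˡ-< <b a≤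
  g : Fin n → Fin (b ∸ a)
  g x = fromℕ< (g< x)
  g-injective : ∀ {x y} → g x ≡ g y → x ≡ y
  g-injective {x} {y} gx≡gy = Fin.toℕ-injective (+-cancelˡ-≡ p _ _ (inj
    (∸-cancelʳ-≡ (proj₁ (maps (in-window x))) (proj₁ (maps (in-window y)))
      (trans (sym (Fin.toℕ-fromℕ< (g< x))) (trans (cong toℕ gx≡gy) (Fin.toℕ-fromℕ< (g< y)))))))

-- `f` is an involution of all natural numbers, so every block is the restriction of the same
-- function to a window.
module Decomposition (f : ℕ → ℕ) (f-involutive : ∀ i → f (f i) ≡ i) where

  f-injective : ∀ {i j} → f i ≡ f j → i ≡ j
  f-injective {i} {j} fi≡fj = trans (sym (f-involutive i)) (trans (cong f fi≡fj) (f-involutive j))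

  Graph : ℕ → ℕ → Points
  Graph p n i v = InWindow p n i × f i ≡ v

  Maps : ℕ → ℕ → ℕ → Set
  Maps p q n = ∀ {i} → InWindow p n i → InWindow q n (f i)

  Avoids132 : Points → Set
  Avoids132 G = ∀ {i j k} → ¬ Occ G i j k

  graph-⊆ : ∀ {p m q n} → (∀ {i} → InWindow p m i → InWindow q n i) → Graph p m ⊆ Graph q n
  graph-⊆ w (i∈ , eq) = w i∈ , eq

  -- The window p, …, p + (l + r) is split by the position p + l, which takes the
  -- value q + (l + r); since no i left and j right of it have f i < f j, the
  -- l values to the left are the l largest of the remaining ones.
  module Split {p q l r : ℕ} (maps : ∀ {i} → InWindow p (suc (l + r)) i → InWindow q (suc (l + r)) (f i))
               (maps⁻¹ : ∀ {v} → InWindow q (suc (l + r)) v → InWindow p (suc (l + r)) (f v))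
               (peak≡ : f (p + l) ≡ q + (l + r))
               (above : ∀ {i j} → InWindow p l i → InWindow (suc (p + l)) r j → f j < f i)
    where

    left⊆ : ∀ {i} → InWindow p l i → InWindow p (suc (l + r)) i
    left⊆ (a , b) = a , <-≤-trans b (+-monoʳ-≤ p (≤-trans (m≤m+n l r) (n≤1+n _)))

    right⊆ : ∀ {i} → InWindow (suc (p + l)) r i → InWindow p (suc (l + r)) i
    right⊆ (a , b) = ≤-trans (m≤m+n p l) (<⇒≤ a) , <-castʳ (suc-+-right p l r) b

    below-peak : ∀ {i} → InWindow p (suc (l + r)) i → i ≢ p + l → f i < q + (l + r)
    below-peak i∈ i≢ = ≤∧≢⇒< (s≤s⁻¹ (<-castʳ (+-suc q (l + r)) (proj₂ (maps i∈))))
                             (λ fi≡ → i≢ (f-injective (trans fi≡ (sym peak≡))))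

    left≢ : ∀ {i} → InWindow p l i → i ≢ p + l
    left≢ (_ , b) = <⇒≢ b

    right≢ : ∀ {i} → InWindow (suc (p + l)) r i → i ≢ p + l
    right≢ (a , _) = >⇒≢ a

    left-values : ∀ {i} → InWindow p l i → InWindow (q + r) l (f i)
    left-values {i} i∈ = q+r≤fi , <-castʳ (x+[y+z]≡x+z+y q l r) (below-peak (left⊆ i∈) (left≢ i∈))
      where
      r≤ : r ≤ f i ∸ q
      -- The r values right of the peak are distinct and lie from q up to below `f i`.
      r≤ = window-injection f-injective (λ j∈ → proj₁ (maps (right⊆ j∈)) , above i∈ j∈)
      q+r≤fi : q + r ≤ f i
      q+r≤fi = subst (_≤ f i) (+-comm r q) (m≤o∸n⇒m+n≤o r (proj₁ (maps (left⊆ i∈))) r≤)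

    right-values : ∀ {j} → InWindow (suc (p + l)) r j → InWindow q r (f j)
    right-values {j} j∈ = proj₁ (maps (right⊆ j∈)) , +-cancelˡ-≤ l _ _ (subst (l + suc (f j) ≤_) (x+[y+z]≡y+[x+z] q l r)
        (m≤o∸n⇒m+n≤o l (below-peak (right⊆ j∈) (right≢ j∈)) l≤))
      where
      l≤ : l ≤ q + (l + r) ∸ suc (f j)
      -- The l values left of the peak are distinct and lie strictly between `f j` and the peak.
      l≤ = window-injection f-injective (λ i∈ → above i∈ j∈ , below-peak (left⊆ i∈) (left≢ i∈))

    data Part (i : ℕ) : Set where
      in-l   : InWindow p l i → Part i
      at-mid : i ≡ p + l → Part i
      in-r   : InWindow (suc (p + l)) r i → Part i

    part : ∀ {i} → InWindow p (suc (l + r)) i → Part i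
    part {i} (a , b) with <-cmp i (p + l)
    ... | tri< i<s _ _ = in-l (a , i<s)
    ... | tri≈ _ i≡s _ = at-mid i≡s
    ... | tri> _ _ s<i = in-r (s<i , <-castʳ (sym (suc-+-right p l r)) b)

    left-values⁻¹ : Maps (q + r) p l
    left-values⁻¹ {v} (a , b) with part (maps⁻¹ (≤-trans (m≤m+n q r) a , <-≤-trans b (≤-trans (≤-reflexive (sym (x+[y+z]≡x+z+y q l r))) (+-monoʳ-≤ q (n≤1+n _)))))
    ... | in-l x   = x
    ... | at-mid x = contradiction (trans (sym (f-involutive v)) (trans (cong f x) peak≡)) (<⇒≢ (<-castʳ (sym (x+[y+z]≡x+z+y q l r)) b))
    ... | in-r x   = contradiction (subst (_< q + r) (f-involutive v) (proj₂ (right-values x))) (≤⇒≯ a)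

    right-values⁻¹ : Maps q (suc (p + l)) r
    right-values⁻¹ {v} (a , b) with part (maps⁻¹ (a , <-≤-trans b (+-monoʳ-≤ q (≤-trans (m≤n+m r l) (n≤1+n _)))))
    ... | in-l x   = contradiction (subst (q + r ≤_) (f-involutive v) (proj₁ (left-values x))) (<⇒≱ b)
    ... | at-mid x = contradiction (trans (sym (f-involutive v)) (trans (cong f x) peak≡))
                                   (<⇒≢ (<-≤-trans b (+-monoʳ-≤ q (m≤n+m r l))))
    ... | in-r x   = x

  -- `N` only bounds n and carries the recursion, since the block sizes are not structurally smaller
  -- than n. Positions start at p and values at q, because L occupies an off-diagonal square.
  tree-of : ∀ N k n {p q} → n ≤ N → Maps p q n → Maps q p n → Avoids132 (Graph p n) → ¬ Inc (Graph p n) k 0 0 →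
            Σ[ t ∈ T k ] ∣ t ∣ ≡ n × Graph p n ⊆ ⟦ t ⟧ p q
  tree-of N zero    n       _   _    _     _     ¬inc = contradiction [] ¬inc
  tree-of N (suc k) zero    {p} _ _ _ _ _ = leaf , refl , λ ((a , b) , _) → contradiction (<-castʳ (+-identityʳ p) b) (≤⇒≯ a)
  tree-of (suc N) (suc k) (suc n) {p} {q} (s≤s n≤N) maps maps⁻¹ ¬132 ¬inc
    -- The largest value is q + n, and since `f` is its own inverse it stands at position f (q + n).
    with maps⁻¹ (m≤m+n q n , ≤-reflexive (sym (+-suc q n)))
  ... | p≤s , s<end with l , refl-s ← m≤n⇒∃[o]m+o≡n p≤s
    with r , refl ← m≤n⇒∃[o]m+o≡n (+-cancelˡ-≤ p l n (s≤s⁻¹ (<-castʳ (+-suc p n) (subst (_< p + suc n) (sym refl-s) s<end))))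
    = build
    where
    peak≡ : f (p + l) ≡ q + (l + r)
    peak≡ = trans (cong f refl-s) (f-involutive _)
    peak∈ : InWindow p (suc (l + r)) (p + l)
    peak∈ = m≤m+n p l , +-monoʳ-< p (s≤s (m≤m+n l r))
    ≤peak : ∀ {i} → InWindow p (suc (l + r)) i → f i ≤ q + (l + r)
    ≤peak i∈ = s≤s⁻¹ (<-castʳ (+-suc q (l + r)) (proj₂ (maps i∈)))
    -- Otherwise i, the peak and j would form a 132.
    above : ∀ {i j} → InWindow p l i → InWindow (suc (p + l)) r j → f j < f i
    above {i} {j} i∈@(a , b) j∈@(c , d) = ≰⇒> λ fi≤fj → ¬132 (occ
      ((a , <-≤-trans b (+-monoʳ-≤ p (≤-trans (m≤m+n l r) (n≤1+n _)))) , refl) (peak∈ , peak≡) (j∈′ , refl) b c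
      (≤∧≢⇒< fi≤fj λ fi≡fj → <⇒≢ (<-trans b c) (f-injective fi≡fj))
      (≤∧≢⇒< (≤peak j∈′) λ fj≡ → >⇒≢ c (f-injective (trans fj≡ (sym peak≡)))))
      where
      j∈′ : InWindow p (suc (l + r)) j
      j∈′ = ≤-trans (m≤m+n p l) (<⇒≤ c) , <-castʳ (suc-+-right p l r) d
    open Split {p} {q} {l} {r} maps maps⁻¹ peak≡ above
    build : Σ[ t ∈ T (suc k) ] ∣ t ∣ ≡ suc (l + r) × Graph p (suc (l + r)) ⊆ ⟦ t ⟧ p q
    build with tree-of N k l (≤-trans (m≤m+n l r) n≤N) left-values left-values⁻¹
                 (¬132 ∘ Occ-mono (graph-⊆ left⊆))
                 (λ xs → ¬inc (Inc-append (graph-⊆ left⊆) (peak∈ , peak≡) z≤n z≤n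
                   (λ (i∈ , eq) → proj₂ i∈ , subst (_< q + (l + r)) eq (below-peak (left⊆ i∈) (left≢ i∈))) xs))
             | tree-of N (suc k) r (≤-trans (m≤n+m r l) n≤N) right-values right-values⁻¹
                 (¬132 ∘ Occ-mono (graph-⊆ right⊆)) (¬inc ∘ Inc-mono (graph-⊆ right⊆))
    ... | tl , refl , tl⊆ | tr , refl , tr⊆ = node tl tr , refl , λ (i∈ , eq) → case part i∈ of λ where
      (in-l x)   → left (tl⊆ (x , eq))
      (at-mid refl) → top refl (trans (sym eq) (trans peak≡ (x+[y+z]≡x+z+y q l r)))
      (in-r x)   → right (tr⊆ (x , eq))

  graph-sym : ∀ {p n i j k} → Maps p p n → Occ (Graph p n) i j k → Occ (Graph p n) (f i) (f k) (f j)
  graph-sym maps (occ (i∈ , refl) (j∈ , refl) (k∈ , refl) i<j j<k u<w w<v) =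
    occ (maps i∈ , f-involutive _) (maps k∈ , f-involutive _) (maps j∈ , f-involutive _) u<w w<v i<j j<k

  -- The case in which the largest value takes part in the occurrence of 132
  base-of : ∀ k n {p i} → Maps p p (suc n) → f i ≡ i → Occ (Graph p (suc n)) i (f (p + n)) (p + n) →
            (∀ {i′ j′ k′} → Occ (Graph p (suc n)) i′ j′ k′ → i′ ≡ i × j′ ≡ f (p + n) × k′ ≡ p + n) →
            ¬ Inc (Graph p (suc n)) k 0 0 → Σ[ t ∈ JT k ] ∥ t ∥ ≡ suc n × Graph p (suc n) ⊆ ⟪ t ⟫ p
  base-of k n {p} {i} maps fi≡i (occ (i∈@(p≤i , _) , _) (s∈ , _) (e∈ , _) i<s s<e _ _) uniq ¬inc
    with a , refl ← m≤n⇒∃[o]m+o≡n p≤i | b , b≡ ← m≤n⇒∃[o]m+o≡n s<e = build k ¬inc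
    where
    c s e : ℕ
    c = p + a
    s = f (p + n)
    e = p + n
    fs≡e : f s ≡ e
    fs≡e = f-involutive e
    ≤e : ∀ {x} → InWindow p (suc n) x → x ≤ e
    ≤e (_ , x<) = s≤s⁻¹ (<-castʳ (+-suc p n) x<)
    in-window : ∀ {x} → p ≤ x → x ≤ e → InWindow p (suc n) x
    in-window p≤x x≤e = p≤x , <-castʳ (sym (+-suc p n)) (s≤s x≤e)
    -- f x < s would make (x, s, e) a second occurrence
    above-s : ∀ {x} → p ≤ x → x < s → x ≢ c → s < f x
    above-s {x} p≤x x<s x≢c with <-cmp (f x) s
    ... | tri< lt _ _ = contradiction (proj₁ (uniq (occ (in-window p≤x (<⇒≤ (<-trans x<s s<e)) , refl) (s∈ , fs≡e) (e∈ , refl) x<s s<e lt s<e))) x≢c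
    ... | tri≈ _ eq _ = contradiction (trans (sym (f-involutive x)) (trans (cong f eq) fs≡e)) (<⇒≢ (<-trans x<s s<e))
    ... | tri> _ _ gt = gt
    -- If c + 1 lay before s, its value would exceed s, and (c, c + 1, e) would be a second
    -- occurrence.
    adjacent : suc c ≡ s
    adjacent with m≤n⇒m<n∨m≡n i<s
    ... | inj₂ eq    = eq
    ... | inj₁ c+1<s = contradiction
      (proj₁ (proj₂ (uniq (occ (i∈ , fi≡i) (in-window (m≤n⇒m≤1+n p≤i) (<⇒≤ (<-trans c+1<s s<e)) , refl) (e∈ , refl)
        ≤-refl (<-trans c+1<s s<e) i<s (above-s (m≤n⇒m≤1+n p≤i) c+1<s (>⇒≢ ≤-refl))))))
      (<⇒≢ c+1<s)
    below-e : ∀ {x} → InWindow p (suc n) x → x ≢ s → f x < e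
    below-e x∈ x≢s = ≤∧≢⇒< (≤e (maps x∈)) λ fx≡e → x≢s (f-injective (trans fx≡e (sym fs≡e)))
    lower : ∀ {x} → InWindow p a x → suc s ≤ f x × f x < e
    lower (p≤x , x<c) = above-s p≤x x<s (<⇒≢ x<c) , below-e (in-window p≤x (<⇒≤ (<-trans x<s s<e))) (<⇒≢ x<s)
      where x<s = <-trans x<c i<s
    -- A value of x above c would make (c, s, x) a second occurrence.
    upper : ∀ {x} → suc s ≤ x → x < e → p ≤ f x × f x < c
    upper {x} s<x x<e = proj₁ (maps x∈) , ≤∧≢⇒< (≮⇒≥ λ c<fx → <⇒≢ x<e
        (proj₂ (proj₂ (uniq (occ (i∈ , fi≡i) (s∈ , fs≡e) (x∈ , refl) i<s s<x c<fx (below-e x∈ (>⇒≢ s<x)))))))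
      λ fx≡c → >⇒≢ (<-trans i<s s<x) (f-injective (trans fx≡c (sym fi≡i)))
      where
      x∈ = in-window (≤-trans p≤i (<⇒≤ (<-trans i<s s<x))) (<⇒≤ x<e)
    -- `f` exchanges the a positions before c with the b positions between s and e.
    a≡b : a ≡ b
    a≡b = ≤-antisym
      (subst (a ≤_) (trans (cong (_∸ suc s) (sym b≡)) (m+n∸m≡n (suc s) b)) (window-injection f-injective lower))
      (subst (b ≤_) (m+n∸m≡n p a) (window-injection f-injective (λ (s<x , x<) → upper s<x (<-castʳ b≡ x<))))
    h+a≡e : suc (suc c) + a ≡ e
    h+a≡e = trans (cong₂ (λ m n → suc m + n) adjacent a≡b) b≡
    build : ∀ k → ¬ Inc (Graph p (suc n)) k 0 0 → Σ[ t ∈ JT k ] ∥ t ∥ ≡ suc n × Graph p (suc n) ⊆ ⟪ t ⟫ p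
    -- The points (c, c) and (s, e) are an increasing pair, so k is at least 3.
    build 0 ¬inc = contradiction [] ¬inc
    build 1 ¬inc = contradiction (step (i∈ , fi≡i) z≤n z≤n []) ¬inc
    build 2 ¬inc = contradiction (step (i∈ , fi≡i) z≤n z≤n (step (s∈ , fs≡e) i<s (<-trans i<s s<e) [])) ¬inc
    build (suc (suc (suc k))) ¬inc
      with tree-of a (2 + k) a {p} {suc (suc c)} ≤-refl
             (λ x∈ → let s<fx , fx<e = lower x∈ in ≤-castˡ (cong suc (sym adjacent)) s<fx , <-castʳ (sym h+a≡e) fx<e)
             (λ (s<x , x<e) → upper (≤-castˡ (cong suc adjacent) s<x) (<-castʳ h+a≡e x<e))
             -- The only occurrence ends at e, outside L.
             (λ o → <⇒≱ (<-trans (proj₂ (proj₁ (Occ.third o))) (<-trans i<s s<e))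
                      (≤-reflexive (sym (proj₂ (proj₂ (uniq (Occ-mono (graph-⊆ sub) o)))))))
             (λ xs → ¬inc (Inc-append (graph-⊆ sub) (s∈ , fs≡e) z≤n z≤n
               (λ (x∈ , eq) → <-trans (proj₂ x∈) i<s , subst (_< e) eq (proj₂ (lower x∈))) xs))
      where
      sub : ∀ {x} → InWindow p a x → InWindow p (suc n) x
      sub (p≤x , x<c) = in-window p≤x (<⇒≤ (<-trans x<c (<-trans i<s s<e)))
    ... | l , refl , l⊆ = base l , size , λ {x} (x∈ , eq) → points x x∈ eq
      where
      size : ∥ base l ∥ ≡ suc n
      size = +-cancelˡ-≡ p _ _ (trans (sym (base-end p ∣ l ∣)) (trans (cong suc h+a≡e) (sym (+-suc p n))))
      points : ∀ x {v} → InWindow p (suc n) x → f x ≡ v → ⟪ base l ⟫ p x v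
      points x x∈ refl with <-cmp x c
      ... | tri< x<c _ _ = base-outer (up (body (l⊆ ((proj₁ x∈ , x<c) , refl))))
      ... | tri≈ _ refl _ = base-inner refl fi≡i
      ... | tri> _ _ c<x with m≤n⇒m<n∨m≡n c<x
      ...   | inj₂ refl = base-outer (up (peak refl (trans (cong f adjacent) (trans fs≡e (sym h+a≡e)))))
      ...   | inj₁ h≤x with m≤n⇒m<n∨m≡n (≤e x∈)
      ...     | inj₂ refl = base-outer (down (peak (sym adjacent) (sym h+a≡e)))
      ...     | inj₁ x<e  = base-outer (down (body (l⊆ (upper (≤-castˡ (cong suc adjacent) h≤x) x<e , f-involutive x))))

  -- As in `tree-of`, `N` carries the recursion. Being the maximum, n can only be the 3 of the
  -- occurrence, so it takes part exactly if j is its position f (p + n).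
  involution-of : ∀ N k n {p} → n ≤ N → Maps p p n → Once (Graph p n) → ¬ Inc (Graph p n) k 0 0 →
                  Σ[ t ∈ JT k ] ∥ t ∥ ≡ n × Graph p n ⊆ ⟪ t ⟫ p
  involution-of N zero    n       _ _ _ ¬inc = contradiction [] ¬inc
  involution-of N (suc k) zero    {p} _ _ (once (occ ((a , b) , _) _ _ _ _ _ _) _) _ = contradiction (<-castʳ (+-identityʳ p) b) (≤⇒≯ a)
  involution-of (suc N) (suc k) (suc n) {p} (s≤s n≤N) maps (once {i} {j} {h} o@(occ x y z i<j j<h u<w w<v) uniq) ¬inc
    with uniq (graph-sym maps o) | maps e∈
    where
    e∈ : InWindow p (suc n) (p + n)
    e∈ = m≤m+n p n , ≤-reflexive (sym (+-suc p n))
  ... | fi≡i , fh≡j , fj≡h | p≤s , s<end with j ≟ f (p + n)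
  ...   | yes refl = base-of (suc k) n maps fi≡i
            (subst (Occ (Graph p (suc n)) i j) h≡e o)
            (λ o′ → let i≡ , j≡ , h′≡ = uniq o′ in i≡ , j≡ , trans h′≡ h≡e) ¬inc
    where
    h≡e : h ≡ p + n
    h≡e = trans (sym fj≡h) (f-involutive _)
  ...   | no j≢s with l , s≡ ← m≤n⇒∃[o]m+o≡n p≤s
    with r , refl ← m≤n⇒∃[o]m+o≡n (+-cancelˡ-≤ p l n (s≤s⁻¹ (<-castʳ (+-suc p n) (subst (_< p + suc n) (sym s≡) s<end))))
    = build r refl
    where
    s e : ℕ
    s = p + l
    e = p + (l + r)
    peak≡ : f s ≡ e
    peak≡ = trans (cong f s≡) (f-involutive _)
    s∈ : InWindow p (suc (l + r)) s
    s∈ = m≤m+n p l , +-monoʳ-< p (s≤s (m≤m+n l r))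
    ≤e : ∀ {x} → InWindow p (suc (l + r)) x → x ≤ e
    ≤e (_ , x<) = s≤s⁻¹ (<-castʳ (+-suc p (l + r)) x<)
    -- Otherwise x, s and y would form a 132 with n in the middle, forcing j to be the position of
    -- n.
    above : ∀ {x y} → InWindow p l x → InWindow (suc s) r y → f y < f x
    above {x} {y} x∈@(a , b) y∈@(c , d) = ≰⇒> λ fx≤fy → j≢s (sym (trans (sym s≡) (proj₁ (proj₂ (uniq (occ
      ((a , <-≤-trans b (+-monoʳ-≤ p (≤-trans (m≤m+n l r) (n≤1+n _)))) , refl) (s∈ , peak≡) (y∈′ , refl) b c
      (≤∧≢⇒< fx≤fy λ fx≡fy → <⇒≢ (<-trans b c) (f-injective fx≡fy))
      (≤∧≢⇒< (≤e (maps y∈′)) λ fy≡ → >⇒≢ c (f-injective (trans fy≡ (sym peak≡))))))))))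
      where
      y∈′ : InWindow p (suc (l + r)) y
      y∈′ = ≤-trans (m≤m+n p l) (<⇒≤ c) , <-castʳ (suc-+-right p l r) d
    open Split {p} {p} {l} {r} maps maps peak≡ above
    fe≡s : f e ≡ s
    fe≡s = trans (cong f (sym peak≡)) (f-involutive s)
    h≢s : h ≢ s
    h≢s h≡s = <⇒≱ w<v (subst (_ ≤_) (trans (sym peak≡) (trans (cong f (sym h≡s)) (proj₂ z)))
      (subst (_≤ e) (proj₂ y) (≤e (maps (proj₁ y)))))
    append-peak : ∀ {m} → Inc (Graph p l) m 0 0 → Inc (Graph p (suc (l + r))) (suc m) 0 0
    append-peak = Inc-append (graph-⊆ left⊆) (s∈ , peak≡) z≤n z≤n
      (λ (x∈ , eq) → proj₂ x∈ , subst (_< e) eq (below-peak (left⊆ x∈) (left≢ x∈)))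
    Result : Set
    Result = Σ[ t ∈ JT (suc k) ] ∥ t ∥ ≡ suc (l + r) × Graph p (suc (l + r)) ⊆ ⟪ t ⟫ p
    build-fix : r ≡ 0 → Result
    build-fix refl
      with involution-of N k l (≤-trans (m≤m+n l 0) n≤N)
             (λ x∈ → let c , d = left-values x∈ in ≤-castˡ (+-identityʳ p) c , <-castʳ (cong (_+ l) (+-identityʳ p)) d)
             (once (occ ((proj₁ (proj₁ x) , <-trans i<j (<-trans j<h h<s)) , proj₂ x)
                        ((proj₁ (proj₁ y) , <-trans j<h h<s) , proj₂ y)
                        ((proj₁ (proj₁ z) , h<s) , proj₂ z) i<j j<h u<w w<v)
                   (uniq ∘ Occ-mono (graph-⊆ left⊆)))
             (¬inc ∘ append-peak)
      where
      h<s : h < s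
      h<s with part (proj₁ z)
      ... | in-l (_ , h<)  = h<
      ... | at-mid h≡s     = contradiction h≡s h≢s
      ... | in-r (a , b)   = contradiction (<-castʳ (+-identityʳ (suc s)) b) (≤⇒≯ a)
    ... | t , refl , t⊆ = fix t , cong suc (sym (+-identityʳ _)) , λ (x∈ , eq) → points (part x∈) eq
      where
      points : ∀ {x v} → Part x → f x ≡ v → ⟪ fix t ⟫ p x v
      points (in-l x∈)       eq = fix-inner (t⊆ (x∈ , eq))
      points (at-mid refl)   eq = fix-last refl (trans (sym eq) (trans peak≡ (cong (p +_) (+-identityʳ l))))
      points (in-r (a , b))  _  = contradiction (<-castʳ (+-identityʳ (suc s)) b) (≤⇒≯ a)
    build-wrap : ∀ m → r ≡ suc (l + m) → Result
    build-wrap m refl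
      with tree-of l k l {p} {H} ≤-refl (above-H ∘ left-values) (left-values⁻¹ ∘ above-H⁻¹)
             -- An occurrence in L would begin at the fixed point i, but the values of L are at
             -- least H and its positions smaller.
             (λ o′ → let i′≡i = proj₁ (uniq (Occ-mono (graph-⊆ left⊆) o′)) ; i′∈ = proj₁ (Occ.first o′) in
               not-left (subst (InWindow p l) i′≡i i′∈))
             (¬inc ∘ append-peak)
         | involution-of N (suc k) m (≤-trans (≤-trans (m≤n+m m l) (≤-trans (n≤1+n _) (m≤n+m _ l))) n≤N) maps-M
             (once (occ ((s<i , i<H) , proj₂ x) ((s<j , j<H) , proj₂ y) ((<-trans s<j j<h , h<H) , proj₂ z) i<j j<h u<w w<v)
                   (uniq ∘ Occ-mono (graph-⊆ (right⊆ ∘ M⊆))))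
             (¬inc ∘ Inc-mono (graph-⊆ (right⊆ ∘ M⊆)))
      where
      H : ℕ
      H = suc s + m
      H≡ : p + suc (l + m) ≡ H
      H≡ = sym (suc-+-right p l m)
      above-H : ∀ {v} → InWindow (p + suc (l + m)) l v → InWindow H l v
      above-H (a , b) = ≤-castˡ H≡ a , <-castʳ (cong (_+ l) H≡) b
      above-H⁻¹ : ∀ {v} → InWindow H l v → InWindow (p + suc (l + m)) l v
      above-H⁻¹ (a , b) = ≤-castˡ (sym H≡) a , <-castʳ (cong (_+ l) (sym H≡)) b
      s<H : s < H
      s<H = s≤s (m≤m+n s m)
      M⊆ : ∀ {x} → InWindow (suc s) m x → InWindow (suc s) (suc (l + m)) x
      M⊆ (a , b) = a , <-≤-trans b (+-monoʳ-≤ (suc s) (≤-trans (m≤n+m m l) (n≤1+n _)))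
      right<H : ∀ {x} → InWindow (suc s) (suc (l + m)) x → f x < H
      right<H x∈ = <-castʳ H≡ (proj₂ (right-values x∈))
      H≤e : H ≤ e
      H≤e = ≤-castˡ H≡ (+-monoʳ-≤ p (m≤n+m (suc (l + m)) l))
      -- If f x were at most s, then x = f (f x) would be a value of `L n` and thus at least H.
      maps-M : Maps (suc s) (suc s) m
      maps-M {x} x∈@(a , b) with part (maps (right⊆ (M⊆ x∈)))
      ... | in-l y∈   = contradiction (≤-castˡ H≡ (subst (_ ≤_) (f-involutive x) (proj₁ (left-values y∈)))) (<⇒≱ b)
      ... | at-mid y≡ = contradiction (subst (H ≤_) (trans (sym (trans (cong f y≡) peak≡)) (f-involutive x)) H≤e) (<⇒≱ b)
      ... | in-r y∈   = proj₁ y∈ , right<H (M⊆ x∈)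
      not-left : ¬ InWindow p l i
      not-left i∈ = <-irrefl refl (<-≤-trans (<-trans (proj₂ i∈) s<H) (subst (H ≤_) fi≡i (≤-castˡ H≡ (proj₁ (left-values i∈)))))
      i∈R : InWindow (suc s) (suc (l + m)) i
      i∈R with part (proj₁ x)
      ... | in-l i∈   = contradiction i∈ not-left
      ... | at-mid refl = contradiction (trans (sym fi≡i) peak≡) (<⇒≢ (<-≤-trans s<H H≤e))
      ... | in-r i∈   = i∈
      s<i : s < i
      s<i = proj₁ i∈R
      s<j : s < j
      s<j = <-trans s<i i<j
      beyond-s : ∀ {x} → InWindow p (suc (l + suc (l + m))) x → s < x → InWindow (suc s) (suc (l + m)) x
      beyond-s x∈ s<x = s<x , <-castʳ (sym (suc-+-right p l (suc (l + m)))) (proj₂ x∈)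
      -- i, j, h are the values at i, h, j, positions to the right of s, where all values are below
      -- H.
      i<H : i < H
      i<H = subst (_< H) fi≡i (right<H i∈R)
      j<H : j < H
      j<H = subst (_< H) fh≡j (right<H (beyond-s (proj₁ z) (<-trans s<j j<h)))
      h<H : h < H
      h<H = subst (_< H) fj≡h (right<H (beyond-s (proj₁ y) s<j))
    ... | tl , refl , tl⊆ | tm , refl , tm⊆ = wrap tl tm , wrap-size l m , λ {x} (x∈ , eq) → points x (part x∈) x∈ eq
      where
      H : ℕ
      H = suc s + m
      H≡ : p + suc (l + m) ≡ H
      H≡ = sym (suc-+-right p l m)
      e≡ : e ≡ H + l
      e≡ = wrap-last p l m
      points : ∀ x {v} → Part x → InWindow p (suc (l + suc (l + m))) x → f x ≡ v → ⟪ wrap tl tm ⟫ p x v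
      points x (in-l x∈)     _ eq = wrap-outer (up (body (tl⊆ (x∈ , eq))))
      points x (at-mid refl) _ eq = wrap-outer (up (peak refl (trans (sym eq) (trans peak≡ e≡))))
      points x (in-r (a , _)) x∈ refl with <-≤-connex x H
      ... | inj₁ x<H = wrap-inner (tm⊆ ((a , x<H) , refl))
      ... | inj₂ H≤x with m≤n⇒m<n∨m≡n (≤e x∈)
      ...   | inj₁ x<e  = wrap-outer (down (body (tl⊆ (left-values⁻¹ (≤-castˡ (sym H≡) H≤x , <-castʳ (trans e≡ (cong (_+ l) (sym H≡))) x<e) , f-involutive x))))
      ...   | inj₂ refl = wrap-outer (down (peak fe≡s e≡))
    build : ∀ r′ → r ≡ r′ → Result
    build zero     r≡ = build-fix r≡
    build (suc r′) r≡ = let m , l+m≡ = m≤n⇒∃[o]m+o≡n (s≤s⁻¹ l<r) in build-wrap m (trans r≡ (cong suc (sym l+m≡)))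
      where
      -- The right part is nonempty, so it contains the last position e. The value there is s = p +
      -- l, and the right part has values below p + r.
      l<r : l < suc r′
      l<r = <-castʳ r≡ (+-cancelˡ-< p l r (subst (_< p + r) fe≡s (proj₂ (right-values
        (≤-castˡ (+-comm s 1) (≤-trans (+-monoʳ-≤ s (subst (1 ≤_) (sym r≡) (s≤s z≤n))) (≤-reflexive (+-assoc p l r)))
        , <-castʳ (sym (suc-+-right p l r)) (+-monoʳ-< p ≤-refl))))))

-- Counting in duplicate-free lists

lookup-injective : ∀ {A : Set} {xs : List A} → List.Unique xs → ∀ i j → List.lookup xs i ≡ List.lookup xs j → i ≡ j
lookup-injective (x≢ ∷ _)  zero    zero    _  = refl
lookup-injective (x≢ ∷ _)  zero    (suc j) eq = contradiction eq (All.lookup x≢ (∈-lookup j))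
lookup-injective (x≢ ∷ _)  (suc i) zero    eq = contradiction (sym eq) (All.lookup x≢ (∈-lookup i))
lookup-injective (_ ∷ xs!) (suc i) (suc j) eq = cong suc (lookup-injective xs! i j eq)

-- Pigeonhole for a relation: no two entries of `xs` can share a partner. Used in both directions it
-- compares permutations with codes.
length-≤ : ∀ {A B : Set} {xs : List A} {ys : List B} (R : A → B → Set) → List.Unique xs →
           (∀ {x} → x ∈ xs → ∃[ y ] y ∈ ys × R x y) → (∀ {x x′ y} → R x y → R x′ y → x ≡ x′) →
           length xs ≤ length ys
length-≤ {xs = xs} {ys} R xs! partner injective = Fin.injective⇒≤ {f = λ i → index (proj₁ (proj₂ (chosen i)))} λ {i} {j} eq →
  lookup-injective xs! i j (injective (proj₂ (proj₂ (chosen i))) (subst (R (List.lookup xs j)) (same i j eq) (proj₂ (proj₂ (chosen j)))))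
  where
  chosen = λ i → partner (∈-lookup {xs = xs} i)
  same : ∀ i j → index (proj₁ (proj₂ (chosen i))) ≡ index (proj₁ (proj₂ (chosen j))) → proj₁ (chosen j) ≡ proj₁ (chosen i)
  same i j eq = trans (lookup-index (proj₁ (proj₂ (chosen j))))
    (trans (cong (List.lookup ys) (sym eq)) (sym (lookup-index (proj₁ (proj₂ (chosen i))))))

module _ {A : Set} {P : A → Set} (P? : Decidable P) {xs : List A} (complete : ∀ x → x ∈ xs) where

  count≡0⇒none : length (filter P? xs) ≡ 0 → ∀ x → ¬ P x
  count≡0⇒none eq x px with filter P? xs | ∈-filter⁺ P? (complete x) px
  ... | _ ∷ _ | _ with () ← eq

  none⇒count≡0 : (∀ x → ¬ P x) → length (filter P? xs) ≡ 0
  none⇒count≡0 none = cong length (filter-none P? (All.universal none xs))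

  count≡1⇒unique : length (filter P? xs) ≡ 1 → ∃[ x ] P x × (∀ {y} → P y → y ≡ x)
  count≡1⇒unique eq with filter P? xs | (λ y → ∈-filter⁺ P? {y} (complete y)) | (λ y → ∈-filter⁻ P? {y} {xs})
  ... | x ∷ [] | in-list | from-list = x , proj₂ (from-list x (here refl)) , λ {y} py → case in-list y py of λ where
    (here y≡x) → y≡x

  unique⇒count≡1 : List.Unique xs → ∀ {x} → P x → (∀ {y} → P y → y ≡ x) → length (filter P? xs) ≡ 1
  unique⇒count≡1 xs! {x} px only with filter P? xs | Unique.filter⁺ P? xs! | ∈-filter⁺ P? (complete x) px | (λ {y} → ∈-filter⁻ P? {y} {xs})
  ... | y ∷ []     | _              | _ | _         = refl
  ... | y ∷ z ∷ ys | (y≢ ∷ _) | _ | from-list =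
    contradiction (trans (only (proj₂ (from-list (here refl)))) (sym (only (proj₂ (from-list (there (here refl)))))))
                  (All.head y≢)

∈-words : ∀ {n k} (α : Vec (Fin n) k) → α ∈ words n k
∈-words []      = here refl
∈-words (x ∷ α) = ∈-cartesianProductWith⁺ _∷_ (∈-allFin x) (∈-words α)

words-unique : ∀ n k → List.Unique (words n k)
words-unique n zero    = All.[] ∷ []
words-unique n (suc k) = Unique.cartesianProductWith⁺ _∷_ ∷-injective (Unique.allFin⁺ n) (words-unique n k)

∈-trees : ∀ {k} (t : T k) {d} → ∣ t ∣ ≤ d → t ∈ trees d k
∈-trees leaf       {zero}  _       = here refl
∈-trees leaf       {suc d} _       = here refl
∈-trees (node l r) {suc d} (s≤s n≤) = there (∈-cartesianProductWith⁺ node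
  (∈-trees l (≤-trans (m≤m+n ∣ l ∣ ∣ r ∣) n≤)) (∈-trees r (≤-trans (m≤n+m ∣ r ∣ ∣ l ∣) n≤)))

trees-unique : ∀ d k → List.Unique (trees d k)
trees-unique d       zero    = []
trees-unique zero    (suc k) = All.[] ∷ []
trees-unique (suc d) (suc k) = All.tabulate (λ x∈ → λ { refl → leaf∉ (∈-cartesianProductWith⁻ node (trees d k) (trees d (suc k)) x∈) })
  ∷ Unique.cartesianProductWith⁺ node (λ { refl → refl , refl }) (trees-unique d k) (trees-unique d (suc k))
  where
  leaf∉ : ¬ (∃[ l ] ∃[ r ] l ∈ trees d k × r ∈ trees d (suc k) × leaf ≡ node l r)
  leaf∉ (_ , _ , _ , _ , ())

∈-involutions : ∀ {k} (t : JT k) {d} → ∥ t ∥ < d → t ∈ involutions d k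
∈-involutions (fix {k} t) {suc d} (s≤s n<) = ∈-++⁺ˡ (∈-map⁺ fix (∈-involutions t n<))
∈-involutions (wrap {k} l t) {suc d} (s≤s n<) = ∈-++⁺ʳ (map fix (involutions d k)) (∈-++⁺ˡ (∈-cartesianProductWith⁺ wrap
  (∈-trees l (≤-trans (≤-trans (m≤m+n ∣ l ∣ ∣ l ∣) (m≤m+n _ ∥ t ∥)) (≤-trans (m≤n+m _ 2) n<)))
  (∈-involutions t (<-≤-trans (s≤s (m≤n⇒m≤1+n (m≤n+m ∥ t ∥ _))) n<))))
∈-involutions (base {k} l) {suc d} (s≤s n<) = ∈-++⁺ʳ (map fix (involutions d (2 + k)))
  (∈-++⁺ʳ (cartesianProductWith wrap (trees d (2 + k)) (involutions d (3 + k)))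
    (∈-map⁺ base (∈-trees l (≤-trans (m≤m+n ∣ l ∣ ∣ l ∣) (≤-trans (m≤n+m _ 3) n<)))))

bases-unique : ∀ d k → List.Unique (bases d k)
bases-unique d 0             = []
bases-unique d 1             = []
bases-unique d (suc (suc k)) = Unique.map⁺ (λ { refl → refl }) (trees-unique d (2 + k))

involutions-unique : ∀ d k → List.Unique (involutions d k)
involutions-unique d       zero    = []
involutions-unique zero    (suc k) = []
involutions-unique (suc d) (suc k) = Unique.++⁺ (Unique.map⁺ (λ { refl → refl }) (involutions-unique d k))
  (Unique.++⁺ (Unique.cartesianProductWith⁺ wrap (λ { refl → refl , refl }) (trees-unique d k) (involutions-unique d (suc k)))
    (bases-unique d k)
    (λ (w∈ , b∈) → case wrap∈ w∈ of λ { (_ , _ , refl) → wrap∉bases k b∈ }))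
  (λ (f∈ , x∈) → case ∈-map⁻ fix f∈ of λ { (_ , _ , refl) → case ∈-++⁻ (cartesianProductWith wrap (trees d k) (involutions d (suc k))) x∈ of λ where
    (inj₁ w∈) → case wrap∈ w∈ of λ ()
    (inj₂ b∈) → fix∉bases k b∈ })
  where
  wrap∈ : ∀ {t} → t ∈ cartesianProductWith wrap (trees d k) (involutions d (suc k)) → ∃[ l ] ∃[ s ] t ≡ wrap l s
  wrap∈ w∈ with l , s , _ , _ , eq ← ∈-cartesianProductWith⁻ wrap (trees d k) (involutions d (suc k)) w∈ = l , s , eq
  wrap∉bases : ∀ k {l : T k} {t} → ¬ wrap l t ∈ bases d k
  wrap∉bases (suc (suc k)) b∈ with () ← proj₂ (proj₂ (∈-map⁻ base b∈))
  fix∉bases : ∀ k {t : JT k} → ¬ fix t ∈ bases d k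
  fix∉bases (suc (suc k)) b∈ with () ← proj₂ (proj₂ (∈-map⁻ base b∈))

-- Permutations as sets of points

data Plot {n} (α : Vec (Fin n) n) : Points where
  plotted : ∀ x → Plot α (toℕ x) (toℕ (lookup α x))

plotted′ : ∀ {n} {α : Vec (Fin n) n} {i v} (x : Fin n) → toℕ x ≡ i → toℕ (lookup α x) ≡ v → Plot α i v
plotted′ x refl refl = plotted x

plot⁻ : ∀ {n} {α : Vec (Fin n) n} {x v} → Plot α (toℕ x) v → v ≡ toℕ (lookup α x)
plot⁻ {α = α} p = lemma p refl
  where
  lemma : ∀ {i v x} → Plot α i v → i ≡ toℕ x → v ≡ toℕ (lookup α x)
  lemma (plotted y) eq = cong (toℕ ∘ lookup α) (Fin.toℕ-injective eq)

module _ {k n} (τ : Vec (Fin k) k) (α : Vec (Fin n) n) {is : Vec (Fin n) k} where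

  -- Preserving strict inequalities is enough: the letters of τ are distinct, so by trichotomy a
  -- failure of the converse would give a reversed inequality, which is preserved as well.
  occurrence⁺ : (∀ a b → lookup τ a ≡ lookup τ b → a ≡ b) → AllPairs Fin._<_ is →
                (∀ a b → lookup τ a Fin.< lookup τ b → lookup α (lookup is a) Fin.< lookup α (lookup is b)) →
                IsOccurrence τ α is
  occurrence⁺ τ-injective is< mono = is< , λ a b → mk⇔ (mono a b) (reflect a b)
    where
    reflect : ∀ a b → lookup α (lookup is a) Fin.< lookup α (lookup is b) → lookup τ a Fin.< lookup τ b
    reflect a b αa<αb with Fin.<-cmp (lookup τ a) (lookup τ b)
    ... | tri< lt _ _ = lt
    ... | tri≈ _ eq _ with refl ← τ-injective a b eq = contradiction αa<αb (<-irrefl refl)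
    ... | tri> _ _ gt = contradiction (mono b a gt) (<⇒≯ αa<αb)

  occurrence⁻ : IsOccurrence τ α is →
                ∀ a b → lookup τ a Fin.< lookup τ b → lookup α (lookup is a) Fin.< lookup α (lookup is b)
  occurrence⁻ (_ , mono) a b = Equivalence.to (mono a b)

module _ {n} {α : Vec (Fin n) n} where

  occ⁺ : ∀ {is} → IsOccurrence pattern132 α is →
         Occ (Plot α) (toℕ (lookup is zero)) (toℕ (lookup is (suc zero))) (toℕ (lookup is (suc (suc zero))))
  occ⁺ {a ∷ b ∷ c ∷ []} o@(((a<b VecAll.∷ _) ∷ (b<c VecAll.∷ _) ∷ _) , _) =
    occ (plotted a) (plotted b) (plotted c) a<b b<c (occurrence⁻ pattern132 α o zero (suc (suc zero)) (s≤s z≤n))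
        (occurrence⁻ pattern132 α o (suc (suc zero)) (suc zero) (s≤s (s≤s z≤n)))

  occ⁻ : ∀ {a b c} → Occ (Plot α) (toℕ a) (toℕ b) (toℕ c) → IsOccurrence pattern132 α (a ∷ b ∷ c ∷ [])
  occ⁻ {a} {b} {c} (occ x y z a<b b<c u<w w<v) with refl ← plot⁻ x | refl ← plot⁻ y | refl ← plot⁻ z =
    occurrence⁺ pattern132 α injective
      ((a<b VecAll.∷ <-trans a<b b<c VecAll.∷ VecAll.[]) ∷ (b<c VecAll.∷ VecAll.[]) ∷ VecAll.[] ∷ [])
      mono
    where
    injective : ∀ a b → lookup pattern132 a ≡ lookup pattern132 b → a ≡ b
    injective zero             zero             _ = refl
    injective (suc zero)       (suc zero)       _ = refl
    injective (suc (suc zero)) (suc (suc zero)) _ = refl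
    injective zero             (suc zero)       ()
    injective zero             (suc (suc zero)) ()
    injective (suc zero)       (suc (suc zero)) ()
    mono : ∀ a′ b′ → lookup pattern132 a′ Fin.< lookup pattern132 b′ →
           lookup α (lookup (a ∷ b ∷ c ∷ []) a′) Fin.< lookup α (lookup (a ∷ b ∷ c ∷ []) b′)
    mono zero             (suc zero)       _ = <-trans u<w w<v
    mono zero             (suc (suc zero)) _ = u<w
    mono (suc (suc zero)) (suc zero)       _ = w<v
    mono (suc zero)       (suc zero)       (s≤s (s≤s ()))
    mono (suc zero)       (suc (suc zero)) (s≤s ())
    mono (suc (suc zero)) (suc (suc zero)) (s≤s ())

  position : ∀ {i v} → Plot α i v → ∃[ x ] toℕ x ≡ i
  position (plotted x) = x , refl

  once⁺ : ContainsOnce pattern132 α → Once (Plot α)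
  once⁺ count≡1 with count≡1⇒unique (isOccurrence? pattern132 α) ∈-words count≡1
  ... | a ∷ b ∷ c ∷ [] , o , only = once (occ⁺ o) unique
    where
    unique : ∀ {i j k} → Occ (Plot α) i j k → i ≡ toℕ a × j ≡ toℕ b × k ≡ toℕ c
    unique o′@(occ x y z _ _ _ _) with position x | position y | position z
    ... | _ , refl | _ , refl | _ , refl with refl ← only (occ⁻ o′) = refl , refl , refl

  once⁻ : Once (Plot α) → ContainsOnce pattern132 α
  once⁻ (once o@(occ x y z _ _ _ _) unique) with position x | position y | position z
  ... | a , refl | b , refl | c , refl =
    unique⇒count≡1 (isOccurrence? pattern132 α) ∈-words (words-unique n 3) (occ⁻ o) only
    where
    only : ∀ {is} → IsOccurrence pattern132 α is → is ≡ a ∷ b ∷ c ∷ []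
    only {_ ∷ _ ∷ _ ∷ []} o′ with p , q , r ← unique (occ⁺ o′)
      with refl ← Fin.toℕ-injective p | refl ← Fin.toℕ-injective q | refl ← Fin.toℕ-injective r = refl

  _≺_ : Fin n → Fin n → Set
  x ≺ y = x Fin.< y × lookup α x Fin.< lookup α y

  inc⁺ : ∀ {k a b} (is : Vec (Fin n) k) → VecAll.All (λ x → a ≤ toℕ x × b ≤ toℕ (lookup α x)) is →
         AllPairs _≺_ is → Inc (Plot α) k a b
  inc⁺ []       _                          _           = []
  inc⁺ (x ∷ is) ((a≤x , b≤αx) VecAll.∷ _) (x≺is ∷ is≺) = step (plotted x) a≤x b≤αx (inc⁺ is x≺is is≺)

  inc⁻ : ∀ {k a b} → Inc (Plot α) k a b →
         Σ[ is ∈ Vec (Fin n) k ] VecAll.All (λ x → a ≤ toℕ x × b ≤ toℕ (lookup α x)) is × AllPairs _≺_ is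
  inc⁻ []                          = [] , VecAll.[] , []
  inc⁻ (step (plotted x) a≤x b≤αx xs) with is , bounds , is≺ ← inc⁻ xs =
    x ∷ is , (a≤x , b≤αx) VecAll.∷ VecAll.map (λ (p , q) → ≤-trans a≤x (<⇒≤ p) , ≤-trans b≤αx (<⇒≤ q)) bounds , bounds ∷ is≺

pairs-lookup : ∀ {A : Set} {R : A → A → Set} {k} {xs : Vec A k} → AllPairs R xs →
               ∀ {a b} → a Fin.< b → R (lookup xs a) (lookup xs b)
pairs-lookup (x~ ∷ _)  {zero}  {suc b} _       = VecAll.lookup⁺ x~ b
pairs-lookup (_ ∷ xs~) {suc a} {suc b} (s≤s a<b) = pairs-lookup xs~ a<b

lookup-pairs : ∀ {A : Set} {R : A → A → Set} {k} {xs : Vec A k} →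
               (∀ {a b} → a Fin.< b → R (lookup xs a) (lookup xs b)) → AllPairs R xs
lookup-pairs {xs = []}     r = []
lookup-pairs {xs = x ∷ xs} r = VecAll.lookup⁻ (λ i → r {zero} {suc i} (s≤s z≤n)) ∷ lookup-pairs (λ a<b → r (s≤s a<b))

module _ {k n : ℕ} {α : Vec (Fin n) n} where

  avoids⁺ : Avoids (increasing k) α → ¬ Inc (Plot α) k 0 0
  avoids⁺ count≡0 xs with is , _ , is≺ ← inc⁻ xs = count≡0⇒none (isOccurrence? (increasing k) α) ∈-words count≡0 is
    (occurrence⁺ (increasing k) α (λ a b eq → trans (sym (lookup-allFin a)) (trans eq (lookup-allFin b))) (VecPairs.map proj₁ is≺)
      (λ a b a<b → proj₂ (pairs-lookup is≺ (subst₂ Fin._<_ (lookup-allFin a) (lookup-allFin b) a<b))))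

  avoids⁻ : ¬ Inc (Plot α) k 0 0 → Avoids (increasing k) α
  avoids⁻ ¬inc = none⇒count≡0 (isOccurrence? (increasing k) α) ∈-words λ is o → ¬inc
    (inc⁺ is (VecAll.universal (λ _ → z≤n , z≤n) is) (lookup-pairs λ {a} {b} a<b →
      pairs-lookup (proj₁ o) a<b ,
      occurrence⁻ (increasing k) α o a b (subst₂ Fin._<_ (sym (lookup-allFin a)) (sym (lookup-allFin b)) a<b)))

-- The correspondence between involutions and their codes

-- One inclusion suffices, because both point sets are graphs of functions on the same n positions.
Codes : ∀ {k n} → Vec (Fin n) n → JT k → Set
Codes {n = n} α t = ∥ t ∥ ≡ n × Plot α ⊆ ⟪ t ⟫ 0

Codes-injectiveˡ : ∀ {k n} {α β : Vec (Fin n) n} {t : JT k} → Codes α t → Codes β t → α ≡ β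
Codes-injectiveˡ {α = α} {β} {t} (_ , α⊆t) (_ , β⊆t) = trans (sym (tabulate∘lookup α))
  (trans (tabulate-cong λ x → Fin.toℕ-injective (involution-functional t (α⊆t (plotted x)) (β⊆t (plotted x)))) (tabulate∘lookup β))

Codes-injectiveʳ : ∀ {k n} {α : Vec (Fin n) n} {t s : JT k} → Codes α t → Codes α s → t ≡ s
Codes-injectiveʳ {n = n} {α} {t} {s} (t≡ , α⊆t) (s≡ , α⊆s) = involution-determined t s (trans t≡ (sym s≡))
  (transfer t s t≡ α⊆t α⊆s) (transfer s t s≡ α⊆s α⊆t)
  where
  transfer : ∀ t s → ∥ t ∥ ≡ n → Plot α ⊆ ⟪ t ⟫ 0 → Plot α ⊆ ⟪ s ⟫ 0 → ⟪ t ⟫ 0 ⊆ ⟪ s ⟫ 0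
  transfer t s t≡ α⊆t α⊆s {i} {v} x = subst (⟪ s ⟫ 0 i) (involution-functional t (α⊆t i∈) x) (α⊆s i∈)
    where
    i<n : i < n
    i<n = <-castʳ t≡ (Square.i<p′ (involution-box t x))
    i∈ : Plot α i (toℕ (lookup α (fromℕ< i<n)))
    i∈ = plotted′ (fromℕ< i<n) (Fin.toℕ-fromℕ< i<n) refl

encode : ∀ {k n} {α : Vec (Fin n) n} → Counted (increasing k) α → Σ[ t ∈ JT k ] Codes α t
encode {k} {n} {α} ((_ , α-involutive) , avoids , contains) =
  let t , t≡ , ⊆t = involution-of n k n ≤-refl maps once-f (avoids⁺ {k} {n} {α} avoids ∘ Inc-mono graph⊆)
  in t , t≡ , ⊆t ∘ ⊆graph
  where
  -- The permutation continued by the identity beyond n, which keeps it an involution.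
  f : ℕ → ℕ
  f i with i <? n
  ... | yes i<n = toℕ (lookup α (fromℕ< i<n))
  ... | no  _   = i
  f-toℕ : ∀ x → f (toℕ x) ≡ toℕ (lookup α x)
  f-toℕ x with toℕ x <? n
  ... | yes x<n = cong (toℕ ∘ lookup α) (Fin.fromℕ<-toℕ x x<n)
  ... | no  x≮n = contradiction (Fin.toℕ<n x) x≮n
  f-outside : ∀ {i} → ¬ i < n → f i ≡ i
  f-outside {i} i≮n with i <? n
  ... | yes i<n = contradiction i<n i≮n
  ... | no  _   = refl
  f-involutive : ∀ i → f (f i) ≡ i
  f-involutive i = case i <? n of λ where
    (no i≮n)  → trans (cong f (f-outside i≮n)) (f-outside i≮n)
    (yes i<n) → let x = fromℕ< i<n ; i≡ = sym (Fin.toℕ-fromℕ< i<n) in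
      trans (cong (f ∘ f) i≡) (trans (cong f (f-toℕ x)) (trans (f-toℕ (lookup α x))
        (trans (cong toℕ (α-involutive x)) (sym i≡))))
  open Decomposition f f-involutive
  ⊆graph : Plot α ⊆ Graph 0 n
  ⊆graph (plotted x) = (z≤n , Fin.toℕ<n x) , f-toℕ x
  graph⊆ : Graph 0 n ⊆ Plot α
  graph⊆ {i} ((_ , i<n) , refl) = plotted′ (fromℕ< i<n) (Fin.toℕ-fromℕ< i<n)
    (trans (sym (f-toℕ (fromℕ< i<n))) (cong f (Fin.toℕ-fromℕ< i<n)))
  maps : Maps 0 0 n
  maps {i} (_ , i<n) = z≤n , subst (_< n) (trans (sym (f-toℕ (fromℕ< i<n))) (cong f (Fin.toℕ-fromℕ< i<n))) (Fin.toℕ<n _)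
  once-f : Once (Graph 0 n)
  once-f with once o unique ← once⁺ contains = once (Occ-mono ⊆graph o) (unique ∘ Occ-mono graph⊆)

decode : ∀ {k n} (t : JT k) → ∥ t ∥ ≡ n → Σ[ α ∈ Vec (Fin n) n ] Counted (increasing k) α × Codes α t
decode {k} t refl = α , ((unique , α-involutive) , avoids⁻ (involution-avoids-increasing t ∘ Inc-mono ⊆t) , once⁻ once-α) , refl , ⊆t
  where
  n = ∥ t ∥
  value : ∀ (x : Fin n) → ∃[ v ] ⟪ t ⟫ 0 (toℕ x) v
  value x = involution-total t z≤n (Fin.toℕ<n x)
  value< : ∀ x → proj₁ (value x) < n
  value< x = Square.v<p′ (involution-box t (proj₂ (value x)))
  g : Fin n → Fin n
  g x = fromℕ< (value< x)
  α : Vec (Fin n) n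
  α = tabulate g
  g-points : ∀ x → ⟪ t ⟫ 0 (toℕ x) (toℕ (g x))
  g-points x = subst (⟪ t ⟫ 0 (toℕ x)) (sym (Fin.toℕ-fromℕ< (value< x))) (proj₂ (value x))
  g-involutive : ∀ x → g (g x) ≡ x
  g-involutive x = Fin.toℕ-injective (involution-functional t (g-points (g x)) (involution-sym t (g-points x)))
  α-involutive : ∀ x → lookup α (lookup α x) ≡ x
  α-involutive x = trans (lookup∘tabulate g (lookup α x)) (trans (cong g (lookup∘tabulate g x)) (g-involutive x))
  unique : Vec.Unique α
  unique = VecUnique.tabulate⁺ λ {x} {y} eq → trans (sym (g-involutive x)) (trans (cong g eq) (g-involutive y))
  ⊆t : Plot α ⊆ ⟪ t ⟫ 0
  ⊆t (plotted x) = subst (⟪ t ⟫ 0 (toℕ x)) (cong toℕ (sym (lookup∘tabulate g x))) (g-points x)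
  t⊆ : ⟪ t ⟫ 0 ⊆ Plot α
  t⊆ {i} {v} y = let i<n = Square.i<p′ (involution-box t y) ; x = fromℕ< i<n in
    plotted′ x (Fin.toℕ-fromℕ< i<n) (involution-functional t (subst (λ j → ⟪ t ⟫ 0 j (toℕ (lookup α x))) (Fin.toℕ-fromℕ< i<n) (⊆t (plotted x))) y)
  once-α : Once (Plot α)
  once-α with once o only ← involution-once t {0} = once (Occ-mono t⊆ o) (only ∘ Occ-mono ⊆t)

-- Depth `suc n` lists every code of size n, and it is the depth at which `limit` reads the
-- coefficient of degree n.
J₁₃₂-count : ∀ k n → J₁₃₂ (increasing k) n ≡ length (filter (λ t → ∥ t ∥ ≟ n) (involutions (suc n) k))
J₁₃₂-count k n = ≤-antisym
  (length-≤ Codes (Unique.filter⁺ _ (words-unique n n))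
    (λ {α} α∈ → let t , code = encode {k} {n} {α} (proj₂ (∈-filter⁻ (counted? (increasing k)) {xs = words n n} α∈)) in
      t , ∈-filter⁺ (λ t → ∥ t ∥ ≟ n) (∈-involutions t (≤-reflexive (cong suc (proj₁ code)))) (proj₁ code) , code)
    Codes-injectiveˡ)
  (length-≤ (λ t α → Codes α t) (Unique.filter⁺ _ (involutions-unique (suc n) k))
    (λ {t} t∈ → let α , counted , code = decode {k} {n} t (proj₂ (∈-filter⁻ (λ t → ∥ t ∥ ≟ n) {xs = involutions (suc n) k} t∈)) in
      α , ∈-filter⁺ (counted? (increasing k)) (∈-words α) counted , code)
    Codes-injectiveʳ)

-- From the count to the formula

generatingFunction-J₁₃₂ : ∀ k → generatingFunction (J₁₃₂ (increasing k)) ≈ ⌊ J k ⌋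
generatingFunction-J₁₃₂ k = ⌊⌋-cong (pointwise λ n → trans (cong (λ m → pos m ℚ./ 1) (J₁₃₂-count k n))
  (sym (weights-coeff ∥_∥ (involutions (suc n) k) n)))

theorem4p6 : (k : ℕ) → 1 ≤ k →
    Σ[ U⁻¹ ∈ Invertible 1# _*_ (U k 1/2x) ]
    (generatingFunction (J₁₃₂ (increasing k)) ≈ x * proj₁ U⁻¹ * sum {k ∸ 2} (λ j → U (suc (toℕ j)) 1/2x))
theorem4p6 k 1≤k = Solve.u-invertible k , L.trans {generatingFunction (J₁₃₂ (increasing k))} {⌊ J k ⌋}
  (generatingFunction-J₁₃₂ k) (Solve.J-formula k 1≤k)
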